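{- The problem of deciding, given an $I/O$ probabilistic transducer $\mathcal{T}$ (with $I=\{i_1,\ldots,i_k\}$, $O=\{o_1,\ldots,o_k\}$), a permutation $\pi\in\mathcal{S}_k$ and $\epsilon>0$, whether $\mathcal{T}$ is $(\epsilon,\pi)$-symmetric, is undecidable.
   Context: An $I/O$ probabilistic transducer is $\mathcal{T}=\langle I,O,S,s_0,\delta,\ell\rangle$ with $S$ a finite set of states, $s_0\in S$ initial, $\delta:S\times 2^I\to\Delta(S)$ a probabilistic transition function (rational probabilities), and $\ell:S\to 2^O$ a labelling. For $x=\vec i_1\cdots\vec i_n\in(2^I)^+$, a run is $q_0,\ldots,q_n$ with $q_0=s_0$, of probability $\prod_{j=0}^{n-1}\delta(q_j,\vec i_{j+1})(q_{j+1})$, and output $\ell(q_1)\cdots\ell(q_n)$. $\Pr(\mathcal{T}(x)=y)$ is the total probability of runs on $x$ with output $y$. For $\pi\in\mathcal{S}_k$, $\pi(\{i_{j_1},\ldots,i_{j_m}\})=\{i_{\pi(j_1)},\ldots,i_{\pi(j_m)}\}$, extended letter-wise to words, likewise on $O$. $\mathcal{T}$ is $(\epsilon,\pi)$-symmetric if $|\Pr(\mathcal{T}(x)=y)-\Pr(\mathcal{T}(\pi(x))=\pi(y))|\le\epsilon$ for all $x\in(2^I)^+$ and $y\in(2^O)^+$. -}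

module Defs where

open import Data.Nat as ℕ using (ℕ; zero; suc)
open import Data.Integer as ℤ using (ℤ; +_; -[1+_])
open import Data.Rational as ℚ using (ℚ; 0ℚ; 1ℚ; ∣_∣)
open import Data.Fin as Fin using (Fin)
open import Data.Fin.Permutation using (Permutation′; _⟨$⟩ˡ_; _⟨$⟩ʳ_)
open import Data.Bool using (Bool; true; false)
import Data.Bool as Bool
open import Data.Vec as Vec using (Vec; []; _∷_; lookup; tabulate)
import Data.Vec.Properties as VecP
open import Data.List as List using (List; []; _∷_)
open import Data.List.NonEmpty as List⁺ using (List⁺)
open import Data.Product using (Σ; _×_; _,_)
open import Relation.Nullary using (¬_; does)
open import Relation.Binary.PropositionalEquality using (_≡_)

-- Part 1. Probabilistic transducers, with I = {i_1..i_k}, O = {o_1..o_k}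
-- (propositions indexed by Fin k) and state set S = Fin n.

-- A letter of 2^I (resp. 2^O): characteristic vector of a subset.
Letter : ℕ → Set
Letter k = Vec Bool k

sumFin : ∀ {n} → (Fin n → ℚ) → ℚ
sumFin {zero}  f = 0ℚ
sumFin {suc n} f = f Fin.zero ℚ.+ sumFin (λ i → f (Fin.suc i))

record Transducer (k n : ℕ) : Set where
  field
    s₀       : Fin n
    δ        : Fin n → Letter k → Fin n → ℚ
    δ-nonneg : ∀ q a q' → 0ℚ ℚ.≤ δ q a q'
    δ-sum    : ∀ q a → sumFin (δ q a) ≡ 1ℚ
    ℓ        : Fin n → Letter k

_≟ᴸ_ : ∀ {k} → Letter k → Letter k → Bool
a ≟ᴸ b = does (VecP.≡-dec Bool._≟_ a b)

indicator : Bool → ℚ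
indicator true  = 1ℚ
indicator false = 0ℚ

-- Total probability of the runs q = q₀,q₁,...,q_m on x starting in q whose
-- output ℓ(q₁)⋯ℓ(q_m) equals y  (0 if |x| ≠ |y|).
probFrom : ∀ {k n} → Transducer k n → Fin n → List (Letter k) → List (Letter k) → ℚ
probFrom T q []      []      = 1ℚ
probFrom T q (a ∷ x) (b ∷ y) =
  sumFin (λ q' → Transducer.δ T q a q' ℚ.* (indicator (Transducer.ℓ T q' ≟ᴸ b) ℚ.* probFrom T q' x y))
probFrom T q []      (_ ∷ _) = 0ℚ
probFrom T q (_ ∷ _) []      = 0ℚ

Pr : ∀ {k n} → Transducer k n → List⁺ (Letter k) → List⁺ (Letter k) → ℚ
Pr T x y = probFrom T (Transducer.s₀ T) (List⁺.toList x) (List⁺.toList y)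

-- π({i_{j1},...,i_{jm}}) = {i_{π(j1)},...,i_{π(jm)}}:  j ∈ π(S) iff π⁻¹(j) ∈ S
permLetter : ∀ {k} → Permutation′ k → Letter k → Letter k
permLetter π S = tabulate (λ j → lookup S (π ⟨$⟩ˡ j))

permWord : ∀ {k} → Permutation′ k → List⁺ (Letter k) → List⁺ (Letter k)
permWord π = List⁺.map (permLetter π)

Symmetric : ∀ {k n} → Transducer k n → Permutation′ k → ℚ → Set
Symmetric T π ε = ∀ (x y : List⁺ (Letter _)) →
  ∣ Pr T x y ℚ.- Pr T (permWord π x) (permWord π y) ∣ ℚ.≤ ε

record Instance : Set where
  field
    k n  : ℕ
    T    : Transducer k n
    π    : Permutation′ k
    ε    : ℚ
    ε>0  : 0ℚ ℚ.< ε

IsYes : Instance → Set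
IsYes I = Symmetric T π ε where open Instance I

pair : ℕ → ℕ → ℕ
pair a b = (2 ℕ.^ a) ℕ.* (2 ℕ.* b ℕ.+ 1) ℕ.∸ 1

codeList : List ℕ → ℕ
codeList []       = 0
codeList (x ∷ xs) = suc (pair x (codeList xs))

codeBool : Bool → ℕ
codeBool false = 0
codeBool true  = 1

codeLetter : ∀ {k} → Letter k → ℕ
codeLetter a = codeList (Vec.toList (Vec.map codeBool a))

codeℤ : ℤ → ℕ
codeℤ (+ n)     = 2 ℕ.* n
codeℤ -[1+ n ]  = suc (2 ℕ.* n)

codeℚ : ℚ → ℕ
codeℚ r = pair (codeℤ (ℚ.numerator r)) (ℚ.denominator-1 r)

codeFin : ∀ {n} → Fin n → ℕ
codeFin = Fin.toℕ

allLetters : (k : ℕ) → List (Letter k)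
allLetters zero    = [] ∷ []
allLetters (suc k) = List.map (false ∷_) (allLetters k) List.++ List.map (true ∷_) (allLetters k)

tab : ∀ {n} {A : Set} → (Fin n → A) → List A
tab f = Vec.toList (tabulate f)

codeInstance : Instance → ℕ
codeInstance I = codeList
  ( k
  ∷ n
  ∷ codeFin (Transducer.s₀ T)
  ∷ codeList (tab (λ q → codeList (List.map (λ a →
        codeList (tab (λ q' → codeℚ (Transducer.δ T q a q')))) (allLetters k))))
  ∷ codeList (tab (λ q → codeLetter (Transducer.ℓ T q)))
  ∷ codeList (tab (λ j → codeFin (π ⟨$⟩ʳ j)))
  ∷ codeℚ ε
  ∷ [] )
  where open Instance I

data μRec : ℕ → Set where
  zer  : ∀ {n} → μRec n
  suc′ : μRec 1
  proj : ∀ {n} → Fin n → μRec n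
  comp : ∀ {m n} → μRec m → Vec (μRec n) m → μRec n
  prec : ∀ {n} → μRec n → μRec (suc (suc n)) → μRec (suc n)
  mu   : ∀ {n} → μRec (suc n) → μRec n

mutual
  data _⟦_⟧⇓_ : ∀ {n} → μRec n → Vec ℕ n → ℕ → Set where
    ev-zer  : ∀ {n} {xs : Vec ℕ n} → zer ⟦ xs ⟧⇓ 0
    ev-suc  : ∀ {x} → suc′ ⟦ x ∷ [] ⟧⇓ suc x
    ev-proj : ∀ {n} {i : Fin n} {xs} → proj i ⟦ xs ⟧⇓ lookup xs i
    ev-comp : ∀ {m n} {f : μRec m} {gs : Vec (μRec n) m} {xs ys v} →
              gs ⟦ xs ⟧⇓* ys → f ⟦ ys ⟧⇓ v → comp f gs ⟦ xs ⟧⇓ v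
    ev-prec-zero : ∀ {n} {g : μRec n} {h xs v} →
              g ⟦ xs ⟧⇓ v → prec g h ⟦ 0 ∷ xs ⟧⇓ v
    ev-prec-suc  : ∀ {n} {g : μRec n} {h xs y r v} →
              prec g h ⟦ y ∷ xs ⟧⇓ r → h ⟦ y ∷ r ∷ xs ⟧⇓ v →
              prec g h ⟦ suc y ∷ xs ⟧⇓ v
    ev-mu   : ∀ {n} {f : μRec (suc n)} {xs y} →
              MuSearch f xs 0 y → mu f ⟦ xs ⟧⇓ y

  data _⟦_⟧⇓*_ : ∀ {m n} → Vec (μRec n) m → Vec ℕ n → Vec ℕ m → Set where
    ev-[] : ∀ {n} {xs : Vec ℕ n} → [] ⟦ xs ⟧⇓* []
    ev-∷  : ∀ {m n} {g : μRec n} {gs : Vec (μRec n) m} {xs v vs} →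
            g ⟦ xs ⟧⇓ v → gs ⟦ xs ⟧⇓* vs → (g ∷ gs) ⟦ xs ⟧⇓* (v ∷ vs)

  data MuSearch {n} (f : μRec (suc n)) (xs : Vec ℕ n) : ℕ → ℕ → Set where
    mu-here : ∀ {z} → f ⟦ z ∷ xs ⟧⇓ 0 → MuSearch f xs z z
    mu-next : ∀ {z y v} → f ⟦ z ∷ xs ⟧⇓ suc v → MuSearch f xs (suc z) y →
              MuSearch f xs z y

DecidesSymmetry : μRec 1 → Set
DecidesSymmetry p = ∀ (I : Instance) →
  (IsYes I → p ⟦ codeInstance I ∷ [] ⟧⇓ 1) × (¬ IsYes I → p ⟦ codeInstance I ∷ [] ⟧⇓ 0)

SymmetryDecidable : Set
SymmetryDecidable = Σ (μRec 1) DecidesSymmetry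

{-# OPTIONS --safe #-}
-- A μ-recursive function is compiled to a nondeterministic program over registers whose only tests
-- are equalities, hence to finitely many instructions that test equalities of register sums and
-- apply a linear update.  A transducer can carry the second moments x_i x_j of the registers as
-- probabilities, scaled by a power of a constant ρ: an instruction acts linearly on them, and the
-- squared errors of the equality tests accumulate as the difference of the masses of two further
-- states.  The input letters on which π acts nontrivially read off the positive or the negative part
-- of 2 pc - pc² - Σ errors, an integer that is positive exactly on accepting runs.  A state A of mass
-- 1/2 contributes a constant 1/2 to the gap, so the gap between a word and its image exceeds ε = 1/2
-- for some word iff the program has an accepting run.  The input n of the program enters only the
-- first row of δ, so the code of the transducer is a simple function of n and of six constants.
-- Given a decision procedure p, a program that asks p about the transducer built from the program
-- itself (n encoding its own six constants) and halts iff the answer is "symmetric" is contradictory.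
module Submission where

open import Defs

-- Second moments are needed because a failed test must be noticed by a device that acts linearly,
-- and in first moments positive and negative errors could cancel. Squared errors are natural
-- numbers and linear in the moments x_i x_j, so they add up and each failure costs at least 1.
-- Since 2 pc - pc² = 1 - (pc - 1)² never exceeds 1, one failure already makes the total
-- nonpositive. The total may be hugely negative, however, and symmetry bounds an absolute value.
-- The constant from `A` cures this: a nonpositive total pulls against it and, being a difference of
-- probabilities carried by the other half of the mass, stays within 1/2, so the sum stays within
-- 1/2 too. An accepting surplus is scaled by powers of ρ, so only strict excess over ε can signal
-- it. Self-reference replaces a universal machine. The program cannot hold the code of its own
-- transducer as literals, because that code depends on the program; it guesses the six constants
-- and compares them with the input, a number chosen after the program is fixed.

module RecursiveFunctions where

  -- Arithmetic by μ-recursive functions.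

  open import Data.Nat using (ℕ; zero; suc; _+_; _*_; _^_; _∸_)
  open import Data.Nat.Properties using (+-identityʳ)
  open import Data.Fin using (Fin; zero; suc)
  open import Data.List using (List; []; _∷_)
  open import Data.Vec using (Vec; []; _∷_; lookup)
  open import Relation.Binary.PropositionalEquality using (_≡_; refl; sym; subst; cong)

  mutual
    -- Determinism makes two different answers of a decision procedure contradictory, and it
    -- identifies computed codes with the intended ones.
    ⇓-deterministic : ∀ {n} {f : μRec n} {xs u v} → f ⟦ xs ⟧⇓ u → f ⟦ xs ⟧⇓ v → u ≡ v
    ⇓-deterministic ev-zer ev-zer = refl
    ⇓-deterministic ev-suc ev-suc = refl
    ⇓-deterministic ev-proj ev-proj = refl
    ⇓-deterministic (ev-comp gs f) (ev-comp gs' f') with ⇓*-deterministic gs gs'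
    ... | refl = ⇓-deterministic f f'
    ⇓-deterministic (ev-prec-zero d) (ev-prec-zero e) = ⇓-deterministic d e
    ⇓-deterministic (ev-prec-suc r h) (ev-prec-suc r' h') with ⇓-deterministic r r'
    ... | refl = ⇓-deterministic h h'
    ⇓-deterministic (ev-mu s) (ev-mu s') = search-deterministic s s'

    ⇓*-deterministic : ∀ {m n} {gs : Vec (μRec n) m} {xs us vs} →
                       gs ⟦ xs ⟧⇓* us → gs ⟦ xs ⟧⇓* vs → us ≡ vs
    ⇓*-deterministic ev-[] ev-[] = refl
    ⇓*-deterministic (ev-∷ d ds) (ev-∷ e es) with ⇓-deterministic d e | ⇓*-deterministic ds es
    ... | refl | refl = refl

    search-deterministic : ∀ {n} {f : μRec (suc n)} {xs z u v} →
                           MuSearch f xs z u → MuSearch f xs z v → u ≡ v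
    search-deterministic (mu-here _) (mu-here _) = refl
    search-deterministic (mu-here d) (mu-next e _) with ⇓-deterministic d e
    ... | ()
    search-deterministic (mu-next d _) (mu-here e) with ⇓-deterministic d e
    ... | ()
    search-deterministic (mu-next _ s) (mu-next _ s') = search-deterministic s s'

  addR mulR : μRec 2
  addR = prec (proj zero) (comp suc′ (proj (suc zero) ∷ []))
  mulR = prec zer (comp addR (proj (suc (suc zero)) ∷ proj (suc zero) ∷ []))

  pow2R predR : μRec 1
  pow2R = prec (comp suc′ (zer ∷ [])) (comp addR (proj (suc zero) ∷ proj (suc zero) ∷ []))
  predR = prec zer (proj zero)

  literal : ∀ {n} → ℕ → μRec n
  literal zero    = zer
  literal (suc c) = comp suc′ (literal c ∷ [])

  addR-correct : ∀ x y → addR ⟦ x ∷ y ∷ [] ⟧⇓ (x + y)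
  addR-correct zero    y = ev-prec-zero ev-proj
  addR-correct (suc x) y = ev-prec-suc (addR-correct x y) (ev-comp (ev-∷ ev-proj ev-[]) ev-suc)

  mulR-correct : ∀ x y → mulR ⟦ x ∷ y ∷ [] ⟧⇓ (x * y)
  mulR-correct zero    y = ev-prec-zero ev-zer
  mulR-correct (suc x) y =
    ev-prec-suc (mulR-correct x y)
      (ev-comp (ev-∷ ev-proj (ev-∷ ev-proj ev-[])) (addR-correct y (x * y)))

  pow2R-correct : ∀ x → pow2R ⟦ x ∷ [] ⟧⇓ (2 ^ x)
  pow2R-correct zero    = ev-prec-zero (ev-comp (ev-∷ ev-zer ev-[]) ev-suc)
  pow2R-correct (suc x) =
    ev-prec-suc (pow2R-correct x)
      (ev-comp (ev-∷ ev-proj (ev-∷ ev-proj ev-[]))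
        (subst (λ v → addR ⟦ 2 ^ x ∷ 2 ^ x ∷ [] ⟧⇓ (2 ^ x + v)) (sym (+-identityʳ (2 ^ x)))
          (addR-correct (2 ^ x) (2 ^ x))))

  predR-correct : ∀ x → predR ⟦ x ∷ [] ⟧⇓ (x ∸ 1)
  predR-correct zero    = ev-prec-zero ev-zer
  predR-correct (suc x) = ev-prec-suc (predR-correct x) ev-proj

  literal-correct : ∀ {n} c (xs : Vec ℕ n) → literal c ⟦ xs ⟧⇓ c
  literal-correct zero    xs = ev-zer
  literal-correct (suc c) xs = ev-comp (ev-∷ (literal-correct c xs) ev-[]) ev-suc

  pairR consR : μRec 2
  pairR = comp predR
    (comp mulR (comp pow2R (proj zero ∷ []) ∷
                comp addR (comp mulR (literal 2 ∷ proj (suc zero) ∷ []) ∷ literal 1 ∷ []) ∷ []) ∷ [])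
  consR = comp suc′ (pairR ∷ [])

  -- Opaque copies of pair and of its successor: unfolding the originals on the codes below would make
  -- the type checker compute with numbers of astronomical size.
  opaque
    ⟪_,_⟫ : ℕ → ℕ → ℕ
    ⟪ a , b ⟫ = pair a b

    cons : ℕ → ℕ → ℕ
    cons a b = suc (pair a b)

  fold : List ℕ → ℕ
  fold []       = 0
  fold (x ∷ xs) = cons x (fold xs)

  opaque
    unfolding cons

    codeList-fold : ∀ xs → codeList xs ≡ fold xs
    codeList-fold []       = refl
    codeList-fold (x ∷ xs) = cong (cons x) (codeList-fold xs)

    pairR-correct : ∀ a b → pairR ⟦ a ∷ b ∷ [] ⟧⇓ ⟪ a , b ⟫
    pairR-correct a b = ev-comp (ev-∷ (ev-comp (ev-∷ (ev-comp (ev-∷ ev-proj ev-[]) (pow2R-correct a)) (ev-∷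
      (ev-comp (ev-∷ (ev-comp (ev-∷ (literal-correct 2 _) (ev-∷ ev-proj ev-[])) (mulR-correct 2 b))
        (ev-∷ (literal-correct 1 _) ev-[])) (addR-correct (2 * b) 1)) ev-[]))
      (mulR-correct (2 ^ a) (2 * b + 1))) ev-[]) (predR-correct (2 ^ a * (2 * b + 1)))

    consR-correct : ∀ a b → consR ⟦ a ∷ b ∷ [] ⟧⇓ cons a b
    consR-correct a b = ev-comp (ev-∷ (pairR-correct a b) ev-[]) ev-suc

  infixl 6 _⊕_
  infixl 7 _⊗_

  -- A syntax for the arithmetic of codes, so that a single correctness proof, `term-correct`,
  -- serves both `packE` and `instanceE`.
  data Expr (n : ℕ) : Set where
    var         : Fin n → Expr n
    lit         : ℕ → Expr n
    _⊕_ _⊗_     : Expr n → Expr n → Expr n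
    pairE consE : Expr n → Expr n → Expr n

  eval : ∀ {n} → Expr n → Vec ℕ n → ℕ
  eval (var i)     xs = lookup xs i
  eval (lit c)     xs = c
  eval (d ⊕ e)     xs = eval d xs + eval e xs
  eval (d ⊗ e)     xs = eval d xs * eval e xs
  eval (pairE d e) xs = ⟪ eval d xs , eval e xs ⟫
  eval (consE d e) xs = cons (eval d xs) (eval e xs)

  term : ∀ {n} → Expr n → μRec n
  term (var i)     = proj i
  term (lit c)     = literal c
  term (d ⊕ e)     = comp addR (term d ∷ term e ∷ [])
  term (d ⊗ e)     = comp mulR (term d ∷ term e ∷ [])
  term (pairE d e) = comp pairR (term d ∷ term e ∷ [])
  term (consE d e) = comp consR (term d ∷ term e ∷ [])

  term-correct : ∀ {n} (e : Expr n) xs → term e ⟦ xs ⟧⇓ eval e xs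
  term-correct (var i)     xs = ev-proj
  term-correct (lit c)     xs = literal-correct c xs
  term-correct (d ⊕ e)     xs =
    ev-comp (ev-∷ (term-correct d xs) (ev-∷ (term-correct e xs) ev-[])) (addR-correct (eval d xs) (eval e xs))
  term-correct (d ⊗ e)     xs =
    ev-comp (ev-∷ (term-correct d xs) (ev-∷ (term-correct e xs) ev-[])) (mulR-correct (eval d xs) (eval e xs))
  term-correct (pairE d e) xs =
    ev-comp (ev-∷ (term-correct d xs) (ev-∷ (term-correct e xs) ev-[])) (pairR-correct (eval d xs) (eval e xs))
  term-correct (consE d e) xs =
    ev-comp (ev-∷ (term-correct d xs) (ev-∷ (term-correct e xs) ev-[])) (consR-correct (eval d xs) (eval e xs))

-- Nondeterministic register programs and compilation into them.

module Programs where

  open import Data.Nat using (ℕ; zero; suc; _+_; _≤_; _<_; _≟_; s≤s)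
  open import Data.Nat.Properties using (+-suc; +-identityʳ; n<1+n; n≤1+n; m≤n+m; m≤m+n; m<n⇒m<1+n; <-≤-trans; <⇒≢; ≤-refl)
  open import Data.Fin using (zero; suc)
  open import Data.Vec as Vec using (Vec; []; _∷_; lookup)
  open import Data.Vec.Properties using (lookup-map)
  open import Data.Vec.Relation.Unary.All as All using (All; []; _∷_)
  open import Data.Product using (∃; _×_; _,_; proj₁; proj₂)
  open import Relation.Nullary using (yes; no; contradiction)
  open import Relation.Binary.PropositionalEquality using (_≡_; _≢_; refl; sym; trans; subst; subst₂; cong; cong₂)

  Store : Set
  Store = ℕ → ℕ

  data Source : Set where
    const : ℕ → Source
    _⊹_   : ℕ → ℕ → Source

  source : Source → Store → ℕ
  source (const c) g = c
  source (c ⊹ j)   g = c + g j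

  data Cmd : Set where
    asg : ℕ → Source → Cmd
    eq  : ℕ → ℕ → Cmd
    nop : Cmd

  -- Assignment is specified pointwise, so that a store known only register by register qualifies as
  -- its result without function extensionality.
  Act : Cmd → Store → Store → Set
  Act (asg i e) g g' = g' i ≡ source e g × (∀ r → r ≢ i → g' r ≡ g r)
  Act (eq i j)  g g' = g i ≡ g j × g' ≡ g
  Act nop       g g' = g' ≡ g

  infixr 6 _⨾_

  data Prog : Set where
    act  : Cmd → Prog
    _⨾_  : Prog → Prog → Prog
    star : Prog → Prog

  data Run : Prog → Store → Store → Set where
    run-act  : ∀ {c g g'} → Act c g g' → Run (act c) g g'
    run-⨾    : ∀ {P Q g h k} → Run P g h → Run Q h k → Run (P ⨾ Q) g k
    run-done : ∀ {P g} → Run (star P) g g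
    run-more : ∀ {P g h k} → Run P g h → Run (star P) h k → Run (star P) g k

  run-snoc : ∀ {P g h k} → Run (star P) g h → Run P h k → Run (star P) g k
  run-snoc run-done       p = run-more p run-done
  run-snoc (run-more q r) p = run-more q (run-snoc r p)

  _[_↦_] : Store → ℕ → ℕ → Store
  (g [ i ↦ v ]) r with r ≟ i
  ... | yes _ = v
  ... | no  _ = g r

  update-same : ∀ g i v → (g [ i ↦ v ]) i ≡ v
  update-same g i v with i ≟ i
  ... | yes _   = refl
  ... | no  i≢i = contradiction refl i≢i

  update-other : ∀ g i v r → r ≢ i → (g [ i ↦ v ]) r ≡ g r
  update-other g i v r r≢i with r ≟ i
  ... | yes r≡i = contradiction r≡i r≢i
  ... | no  _   = refl

  run-asg : ∀ g i e → Run (act (asg i e)) g (g [ i ↦ source e g ])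
  run-asg g i e = run-act (update-same g i _ , update-other g i _)

  -- The frame condition: code working from register `b` upward leaves alone everything below, where
  -- its arguments and earlier results live.
  record Agree (b : ℕ) (g g' : Store) : Set where
    constructor agrees
    field at : ∀ r → r < b → g' r ≡ g r

  open Agree

  agree-refl : ∀ {b g} → Agree b g g
  agree-refl = agrees λ _ _ → refl

  agree-trans : ∀ {b g h k} → Agree b g h → Agree b h k → Agree b g k
  agree-trans p q = agrees λ r r<b → trans (at q r r<b) (at p r r<b)

  agree-≤ : ∀ {b c g h} → b ≤ c → Agree c g h → Agree b g h
  agree-≤ b≤c p = agrees λ r r<b → at p r (<-≤-trans r<b b≤c)

  agree-except : ∀ {b i g g'} → b ≤ i → (∀ r → r ≢ i → g' r ≡ g r) → Agree b g g'
  agree-except b≤i f = agrees λ r r<b → f r (<⇒≢ (<-≤-trans r<b b≤i))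

  map-agree : ∀ {n b g g'} {ins : Vec ℕ n} → All (_< b) ins → Agree b g g' →
              Vec.map g' ins ≡ Vec.map g ins
  map-agree []       p = refl
  map-agree (i ∷ is) p = cong₂ _∷_ (at p _ i) (map-agree is p)

  -- Adds an arbitrary amount. Started from 1 it reaches exactly the positive numbers, started from
  -- 0 it guesses any number.
  count-up : ∀ i → Prog
  count-up i = star (act (asg i (1 ⊹ i)))

  count-up-sound : ∀ {i g g'} → Run (count-up i) g g' → (∃ λ k → g' i ≡ k + g i) × (∀ r → r ≢ i → g' r ≡ g r)
  count-up-sound run-done = (0 , refl) , λ _ _ → refl
  count-up-sound {i} {g} (run-more (run-act (e , f)) r) with count-up-sound r
  ... | (k , p) , q = (suc k , trans p (trans (cong (k +_) e) (+-suc k (g i)))) ,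
                      λ r r≢i → trans (q r r≢i) (f r r≢i)

  count-up-complete : ∀ i k g → ∃ λ g' → Run (count-up i) g g' × g' i ≡ k + g i
  count-up-complete i zero    g = g , run-done , refl
  count-up-complete i (suc k) g with count-up-complete i k g
  ... | h , r , e = _ , run-snoc r (run-asg h i (1 ⊹ i)) , trans (update-same h i _) (cong suc e)

  range : ∀ m → ℕ → Vec ℕ m
  range zero    b = []
  range (suc m) b = b ∷ range m (suc b)

  range-< : ∀ m b → All (_< b + m) (range m b)
  range-< zero    b = []
  range-< (suc m) b =
    subst (λ c → All (_< c) (b ∷ range m (suc b))) (sym (+-suc b m)) (s≤s (m≤m+n b m) ∷ range-< m (suc b))

  -- Register `b` holds the value reached so far, `suc b` the recursion counter, and `2 + b`
  -- receives the result of `H`.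
  precBody : Prog → ℕ → Prog
  precBody H b = H ⨾ act (asg b (0 ⊹ (2 + b))) ⨾ act (asg (suc b) (1 ⊹ suc b))

  -- Only equality can be tested, so a nonzero value of `f` is certified by guessing a number from 1
  -- upward in `2 + b` and comparing. The counter of the search is `b`.
  muBody : Prog → ℕ → Prog
  muBody F b = F ⨾ act (asg (2 + b) (const 1)) ⨾ count-up (2 + b) ⨾ act (eq (suc b) (2 + b))
                 ⨾ act (asg b (1 ⊹ b))

  -- The result is left in register b and only registers ≥ b are written.
  -- Loops are left nondeterministically; the equality tests after them discard the wrong exits.
  mutual
    compile : ∀ {n} → μRec n → Vec ℕ n → ℕ → Prog
    compile zer        ins       b = act (asg b (const 0))
    compile suc′       (i ∷ [])  b = act (asg b (1 ⊹ i))
    compile (proj k)   ins       b = act (asg b (0 ⊹ lookup ins k))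
    compile (comp {m} f gs) ins  b =
      compile* gs ins b ⨾ compile f (range m b) (b + m) ⨾ act (asg b (0 ⊹ (b + m)))
    compile (prec g h) (y ∷ ins) b =
      compile g ins b ⨾ act (asg (suc b) (const 0))
        ⨾ star (precBody (compile h (suc b ∷ b ∷ ins) (2 + b)) b)
        ⨾ act (eq (suc b) y)
    compile (mu f)     ins       b =
      act (asg b (const 0)) ⨾ star (muBody (compile f (b ∷ ins) (suc b)) b)
        ⨾ compile f (b ∷ ins) (suc b) ⨾ act (asg (2 + b) (const 0)) ⨾ act (eq (suc b) (2 + b))

    compile* : ∀ {m n} → Vec (μRec n) m → Vec ℕ n → ℕ → Prog
    compile* []       ins b = act nop
    compile* (g ∷ gs) ins b = compile g ins b ⨾ compile* gs ins (suc b)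

  -- Soundness of the compilation.

  Sound : ∀ {n} → μRec n → Set
  Sound t = ∀ ins b {g g'} → All (_< b) ins → Run (compile t ins b) g g' →
            t ⟦ Vec.map g ins ⟧⇓ g' b × Agree b g g'

  Sound* : ∀ {m n} → Vec (μRec n) m → Set
  Sound* {m} ts = ∀ ins b {g g'} → All (_< b) ins → Run (compile* ts ins b) g g' →
                  ts ⟦ Vec.map g ins ⟧⇓* Vec.map g' (range m b) × Agree b g g'

  weaken : ∀ {n b} {ins : Vec ℕ n} → All (_< b) ins → All (_< suc b) ins
  weaken = All.map m<n⇒m<1+n

  b≤2+b : ∀ b → b ≤ 2 + b
  b≤2+b b = m≤n+m b 2

  sound-prec : ∀ {n} {gt : μRec n} {ht : μRec (2 + n)} → Sound gt → Sound ht → Sound (prec gt ht)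
  sound-prec {gt = gt} {ht} soundᵍ soundʰ (y ∷ ins) b {g} (y<b ∷ ins<)
    (run-⨾ {h = h₁} rg (run-⨾ {h = h₂} (run-act (e₀ , f₀)) (run-⨾ {h = h₃} rs (run-act (e₁ , refl)))))
    with soundᵍ ins b ins< rg
  ... | evg , agg = evp , agg₃
    where
    xs = Vec.map g ins
    -- Invariant: register `b` is the value of the recursion at the counter `suc b`. It survives any
    -- number of iterations; the equality test after the loop then ties the counter to the argument
    -- `y`.
    loop : ∀ {k k'} → Vec.map k ins ≡ xs →
           Run (star (precBody (compile ht (suc b ∷ b ∷ ins) (2 + b)) b)) k k' →
           prec gt ht ⟦ k (suc b) ∷ xs ⟧⇓ k b →
           prec gt ht ⟦ k' (suc b) ∷ xs ⟧⇓ k' b × Agree b k k'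
    loop eqn run-done ev = ev , agree-refl
    loop {k} eqn
      (run-more {h = k₃} (run-⨾ {h = k₁} rh (run-⨾ {h = k₂} (run-act (e₁ , f₁)) (run-act (e₂ , f₂)))) rest) ev
      with soundʰ (suc b ∷ b ∷ ins) (2 + b) (n<1+n _ ∷ m<n⇒m<1+n (n<1+n b) ∷ weaken (weaken ins<)) rh
    ... | evh , agh = let ev' , ag' = loop (trans (map-agree ins< agree₃) eqn) rest ev₃
                      in ev' , agree-trans agree₃ ag'
      where
      agree₃ : Agree b k k₃
      agree₃ = agree-trans (agree-≤ (b≤2+b b) agh)
                 (agree-trans (agree-except ≤-refl f₁) (agree-except (n≤1+n b) f₂))
      counter : k₃ (suc b) ≡ suc (k (suc b))
      counter = trans e₂ (cong suc (trans (f₁ (suc b) (λ ())) (at agh (suc b) (n<1+n _))))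
      value : k₃ b ≡ k₁ (2 + b)
      value = trans (f₂ b λ ()) e₁
      ev₃ : prec gt ht ⟦ k₃ (suc b) ∷ xs ⟧⇓ k₃ b
      ev₃ = subst₂ (λ u v → prec gt ht ⟦ u ∷ xs ⟧⇓ v) (sym counter) (sym value)
              (ev-prec-suc ev (subst (λ ys → ht ⟦ k (suc b) ∷ k b ∷ ys ⟧⇓ k₁ (2 + b)) eqn evh))
    agg₂ : Agree b g h₂
    agg₂ = agree-trans agg (agree-except (n≤1+n b) f₀)
    looped = loop (map-agree ins< agg₂) rs
               (subst₂ (λ u v → prec gt ht ⟦ u ∷ xs ⟧⇓ v) (sym e₀) (sym (f₀ b λ ())) (ev-prec-zero evg))
    agg₃ : Agree b g h₃
    agg₃ = agree-trans agg₂ (proj₂ looped)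
    evp = subst (λ u → prec gt ht ⟦ u ∷ xs ⟧⇓ _) (trans e₁ (at agg₃ y y<b)) (proj₁ looped)

  sound-mu : ∀ {n} {f : μRec (suc n)} → Sound f → Sound (mu f)
  sound-mu {f = f} soundᶠ ins b {g} ins<
    (run-⨾ {h = h₁} (run-act (e₀ , f₀)) (run-⨾ {h = h₂} rs
      (run-⨾ {h = h₃} rf (run-⨾ {h = h₄} (run-act (e₁ , f₁)) (run-act (e₂ , refl))))))
    = subst (mu f ⟦ xs ⟧⇓_) (sym final-b) (ev-mu (subst (λ z → MuSearch f xs z (h₂ b)) e₀ found)) ,
      agree-trans agg₂ (agree-trans (agree-≤ (n≤1+n b) (proj₂ last)) (agree-except (b≤2+b b) f₁))
    where
    xs = Vec.map g ins
    ins<' : All (_< suc b) (b ∷ ins)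
    ins<' = n<1+n b ∷ weaken ins<
    -- The invariant points backwards: each iteration prepends a `mu-next` to whatever search
    -- succeeds from the final counter. The closing `mu-here` comes from the evaluation after the
    -- loop.
    loop : ∀ {k k'} → Vec.map k ins ≡ xs → Run (star (muBody (compile f (b ∷ ins) (suc b)) b)) k k' →
           Agree b k k' × (∀ {y} → MuSearch f xs (k' b) y → MuSearch f xs (k b) y)
    loop eqn run-done = agree-refl , λ s → s
    loop {k} eqn (run-more {h = k₅}
        (run-⨾ {h = k₁} rf (run-⨾ {h = k₂} (run-act (e₁ , f₁)) (run-⨾ {h = k₃} rc
          (run-⨾ {h = k₄} (run-act (e₃ , refl)) (run-act (e₄ , f₄)))))) rest)
      with soundᶠ (b ∷ ins) (suc b) ins<' rf | count-up-sound rc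
    ... | evf , agf | (j , e₂) , f₂ =
      let ag' , s' = loop (trans (map-agree ins< agree₅) eqn) rest
      in agree-trans agree₅ ag' ,
         λ s → mu-next (subst₂ (λ u v → f ⟦ k b ∷ u ⟧⇓ v) eqn positive evf)
                 (subst (λ z → MuSearch f xs z _) counter (s' s))
      where
      positive : k₁ (suc b) ≡ suc j
      positive = trans (sym (trans (f₂ (suc b) λ ()) (f₁ (suc b) λ ())))
                   (trans e₃ (trans e₂ (trans (cong (j +_) e₁) (trans (+-suc j 0) (cong suc (+-identityʳ j))))))
      counter : k₅ b ≡ suc (k b)
      counter = trans e₄ (cong suc (trans (f₂ b λ ()) (trans (f₁ b λ ()) (at agf b (n<1+n b)))))
      agree₅ : Agree b k k₅
      agree₅ = agree-trans (agree-≤ (n≤1+n b) agf)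
        (agree-trans (agree-except (b≤2+b b) f₁) (agree-trans (agree-except (b≤2+b b) f₂)
          (agree-except ≤-refl f₄)))
    agg₁ : Agree b g h₁
    agg₁ = agree-except ≤-refl f₀
    looped = loop (map-agree ins< agg₁) rs
    agg₂ : Agree b g h₂
    agg₂ = agree-trans agg₁ (proj₁ looped)
    last = soundᶠ (b ∷ ins) (suc b) ins<' rf
    is-zero : h₃ (suc b) ≡ 0
    is-zero = trans (sym (f₁ (suc b) λ ())) (trans e₂ e₁)
    found : MuSearch f xs (h₁ b) (h₂ b)
    found = proj₂ looped (mu-here (subst₂ (λ u v → f ⟦ h₂ b ∷ u ⟧⇓ v) (map-agree ins< agg₂) is-zero (proj₁ last)))
    final-b = trans (f₁ b λ ()) (at (proj₂ last) b (n<1+n b))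

  mutual
    sound : ∀ {n} (t : μRec n) → Sound t
    sound zer ins b _ (run-act (e , f)) =
      subst (zer ⟦ _ ⟧⇓_) (sym e) ev-zer , agree-except ≤-refl f
    sound suc′ (i ∷ []) b _ (run-act (e , f)) =
      subst (suc′ ⟦ _ ⟧⇓_) (sym e) ev-suc , agree-except ≤-refl f
    sound (proj k) ins b {g} _ (run-act (e , f)) =
      subst (proj k ⟦ _ ⟧⇓_) (trans (lookup-map k g ins) (sym e)) ev-proj , agree-except ≤-refl f
    sound (comp {m} f gs) ins b ins< (run-⨾ rs (run-⨾ rf (run-act (e , f'))))
      with sound* gs ins b ins< rs | sound f (range m b) (b + m) (range-< m b) rf
    ... | evs , ags | evf , agf =
      ev-comp evs (subst (f ⟦ _ ⟧⇓_) (sym e) evf) ,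
      agree-trans ags (agree-trans (agree-≤ (m≤m+n b m) agf) (agree-except ≤-refl f'))
    sound (prec g h) = sound-prec (sound g) (sound h)
    sound (mu f)     = sound-mu (sound f)

    sound* : ∀ {m n} (ts : Vec (μRec n) m) → Sound* ts
    sound* [] ins b _ (run-act refl) = ev-[] , agree-refl
    sound* (t ∷ ts) ins b ins< (run-⨾ r rs)
      with sound t ins b ins< r | sound* ts ins (suc b) (weaken ins<) rs
    ... | ev , ag | evs , ags =
      ev-∷ (subst (t ⟦ _ ⟧⇓_) (sym (at ags b (n<1+n b))) ev)
           (subst (λ u → ts ⟦ u ⟧⇓* _) (map-agree ins< ag) evs) ,
      agree-trans ag (agree-≤ (n≤1+n b) ags)

  -- Completeness of the compilation.

  Complete : ∀ {n} → μRec n → Set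
  Complete t = ∀ ins b {v} g → All (_< b) ins → t ⟦ Vec.map g ins ⟧⇓ v →
               ∃ λ g' → Run (compile t ins b) g g' × g' b ≡ v

  -- The frame condition of the constructed run is taken from `sound`, so `Complete` does not have
  -- to carry it through its induction.
  complete-at : ∀ {n} {t : μRec n} → Complete t → ∀ ins b {xs v} g → All (_< b) ins →
                Vec.map g ins ≡ xs → t ⟦ xs ⟧⇓ v →
                ∃ λ g' → Run (compile t ins b) g g' × g' b ≡ v × Agree b g g'
  complete-at {t = t} c ins b g ins< refl ev with c ins b g ins< ev
  ... | g' , r , e = g' , r , e , proj₂ (sound t ins b ins< r)

  run-eq : ∀ {i j} g → g i ≡ g j → Run (act (eq i j)) g g
  run-eq g e = run-act (e , refl)

  complete-prec : ∀ {n} {gt : μRec n} {ht : μRec (2 + n)} → Complete gt → Complete ht → Complete (prec gt ht)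
  complete-prec {gt = gt} {ht} completeᵍ completeʰ (y ∷ ins) b g (y<b ∷ ins<) ev =
    let k , (h₁ , h₂ , r₁ , r₂ , rs) , e , c , ag = looped ev
    in k , run-⨾ r₁ (run-⨾ r₂ (run-⨾ rs (run-eq k (trans c (sym (at ag y y<b)))))) , e
    where
    xs = Vec.map g ins
    -- The run is kept in three pieces because a derivation of `prec` exposes the last iteration
    -- first: the loop has to be extended at its end, by `run-snoc`.
    Reached : Store → Set
    Reached k = ∃ λ h₁ → ∃ λ h₂ →
      Run (compile gt ins b) g h₁ × Run (act (asg (suc b) (const 0))) h₁ h₂ ×
      Run (star (precBody (compile ht (suc b ∷ b ∷ ins) (2 + b)) b)) h₂ k
    looped : ∀ {u v} → prec gt ht ⟦ u ∷ xs ⟧⇓ v →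
             ∃ λ k → Reached k × k b ≡ v × k (suc b) ≡ u × Agree b g k
    looped (ev-prec-zero evg) with complete-at completeᵍ ins b g ins< refl evg
    ... | h , r , e , ag =
      let k = h [ suc b ↦ 0 ]
          other = update-other h (suc b) 0
      in k , (h , k , r , run-asg h (suc b) (const 0) , run-done) ,
         trans (other b λ ()) e , update-same h (suc b) 0 ,
         agree-trans ag (agree-except (n≤1+n b) other)
    looped (ev-prec-suc evr evh) with looped evr
    ... | k , (h₁ , h₂ , r₁ , r₂ , rs) , e , c , ag
      with complete-at completeʰ (suc b ∷ b ∷ ins) (2 + b) k
             (n<1+n _ ∷ m<n⇒m<1+n (n<1+n b) ∷ weaken (weaken ins<))
             (cong₂ _∷_ c (cong₂ _∷_ e (map-agree ins< ag))) evh
    ... | k₁ , rh , e₁ , ag₁ =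
      let k₂ = k₁ [ b ↦ k₁ (2 + b) ]
          k₃ = k₂ [ suc b ↦ suc (k₂ (suc b)) ]
          other₂ = update-other k₁ b (k₁ (2 + b))
          other₃ = update-other k₂ (suc b) (suc (k₂ (suc b)))
      in k₃ ,
         (h₁ , h₂ , r₁ , r₂ ,
          run-snoc rs (run-⨾ rh (run-⨾ (run-asg k₁ b (0 ⊹ (2 + b))) (run-asg k₂ (suc b) (1 ⊹ suc b))))) ,
         trans (other₃ b λ ()) (trans (update-same k₁ b _) e₁) ,
         trans (update-same k₂ (suc b) _)
           (cong suc (trans (other₂ (suc b) λ ()) (trans (at ag₁ (suc b) (n<1+n _)) c))) ,
         agree-trans ag (agree-trans (agree-≤ (b≤2+b b) ag₁)
           (agree-trans (agree-except ≤-refl other₂) (agree-except (n≤1+n b) other₃)))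

  complete-mu : ∀ {n} {f : μRec (suc n)} → Complete f → Complete (mu f)
  complete-mu {f = f} completeᶠ ins b {y} g ins< (ev-mu search) =
    let h₁ = g [ b ↦ 0 ]
        h₂ , rs , e₂ , ev , ag₂ = loop search h₁ (update-same g b 0) (agree-except ≤-refl (update-other g b 0))
        h₃ , rf , e₃ , ag₃ = complete-at completeᶠ (b ∷ ins) (suc b) h₂ ins<'
                               (cong₂ _∷_ e₂ (map-agree ins< ag₂)) ev
        h₄ = h₃ [ 2 + b ↦ 0 ]
        other₄ = update-other h₃ (2 + b) 0
    in h₄ ,
       run-⨾ (run-asg g b (const 0)) (run-⨾ rs (run-⨾ rf (run-⨾ (run-asg h₃ (2 + b) (const 0))
         (run-eq h₄ (trans (other₄ (suc b) λ ()) (trans e₃ (sym (update-same h₃ (2 + b) 0)))))))) ,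
       trans (other₄ b λ ()) (trans (at ag₃ b (n<1+n b)) e₂)
    where
    xs = Vec.map g ins
    ins<' : All (_< suc b) (b ∷ ins)
    ins<' = n<1+n b ∷ weaken ins<
    loop : ∀ {z} → MuSearch f xs z y → ∀ k → k b ≡ z → Agree b g k →
           ∃ λ k' → Run (star (muBody (compile f (b ∷ ins) (suc b)) b)) k k' ×
                    k' b ≡ y × f ⟦ y ∷ xs ⟧⇓ 0 × Agree b g k'
    loop (mu-here ev) k e ag = k , run-done , e , ev , ag
    loop (mu-next {v = v} ev search) k e ag
      with complete-at completeᶠ (b ∷ ins) (suc b) k ins<' (cong₂ _∷_ e (map-agree ins< ag)) ev
    ... | k₁ , rf , e₁ , ag₁
      with count-up-complete (2 + b) v (k₁ [ 2 + b ↦ 1 ])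
    ... | k₃ , rc , e₃
      with count-up-sound rc
    ... | _ , other₃ =
      let k₂ = k₁ [ 2 + b ↦ 1 ]
          other₂ = update-other k₁ (2 + b) 1
          k₅ = k₃ [ b ↦ suc (k₃ b) ]
          other₅ = update-other k₃ b (suc (k₃ b))
          tested : k₃ (suc b) ≡ k₃ (2 + b)
          tested = trans (other₃ (suc b) λ ()) (trans (other₂ (suc b) λ ()) (trans e₁ (sym
                     (trans e₃ (trans (cong (v +_) (update-same k₁ (2 + b) 1)) (trans (+-suc v 0) (cong suc (+-identityʳ v))))))))
          k' , rs , rest = loop search k₅
            (trans (update-same k₃ b _)
              (cong suc (trans (other₃ b λ ()) (trans (other₂ b λ ()) (trans (at ag₁ b (n<1+n b)) e)))))
            (agree-trans ag (agree-trans (agree-≤ (n≤1+n b) ag₁)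
              (agree-trans (agree-except (b≤2+b b) other₂)
                (agree-trans (agree-except (b≤2+b b) other₃) (agree-except ≤-refl other₅)))))
      in k' ,
         run-more (run-⨾ rf (run-⨾ (run-asg k₁ (2 + b) (const 1)) (run-⨾ rc
           (run-⨾ (run-eq k₃ tested) (run-asg k₃ b (1 ⊹ b)))))) rs ,
         rest

  mutual
    complete : ∀ {n} (t : μRec n) → Complete t
    complete zer ins b g _ ev-zer = _ , run-asg g b (const 0) , update-same g b 0
    complete suc′ (i ∷ []) b g _ ev-suc = _ , run-asg g b (1 ⊹ i) , update-same g b _
    complete (proj k) ins b g _ ev-proj =
      _ , run-asg g b (0 ⊹ lookup ins k) , trans (update-same g b _) (sym (lookup-map k g ins))
    complete (comp {m} f gs) ins b g ins< (ev-comp evs ev)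
      with complete* gs ins b g ins< evs
    ... | h , rs , es with complete-at (complete f) (range m b) (b + m) h (range-< m b) es ev
    ... | k , r , e , _ =
      _ , run-⨾ rs (run-⨾ r (run-asg k b (0 ⊹ (b + m)))) , trans (update-same k b _) e
    complete (prec g h) = complete-prec (complete g) (complete h)
    complete (mu f)     = complete-mu (complete f)

    complete* : ∀ {m n} (ts : Vec (μRec n) m) ins b {vs} g → All (_< b) ins → ts ⟦ Vec.map g ins ⟧⇓* vs →
                ∃ λ g' → Run (compile* ts ins b) g g' × Vec.map g' (range m b) ≡ vs
    complete* [] ins b g _ ev-[] = g , run-act refl , refl
    complete* (t ∷ ts) ins b g ins< (ev-∷ ev evs)
      with complete-at (complete t) ins b g ins< refl ev
    ... | h , r , e , ag
      with complete* ts ins (suc b) h (weaken ins<) (subst (λ u → ts ⟦ u ⟧⇓* _) (sym (map-agree ins< ag)) evs)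
    ... | k , rs , es =
      k , run-⨾ r rs , cong₂ _∷_ (trans (at (proj₂ (sound* ts ins (suc b) (weaken ins<) rs)) b (n<1+n b)) e) es

-- Flat machines with linear updates and equality tests.

module Machines where

  open Programs
  open import Data.Nat using (ℕ; zero; suc; _+_; _*_; _^_; _≤_; _<_; _≟_; z≤n; s≤s)
  open import Data.Nat.Properties
  open import Data.Nat.ListAction using (sum)
  open import Data.Fin using (Fin; zero; suc)
  open import Data.List using (List; []; _∷_; _++_; map; replicate; length; lookup)
  open import Data.List.Properties using (∷-injective)
  open import Data.List.Relation.Unary.All as All using (All; []; _∷_)
  import Data.List.Relation.Unary.All.Properties as AllP
  open import Data.List.Relation.Unary.Any as Any using (here; there)
  import Data.List.Relation.Unary.Any.Properties as AnyP
  open import Data.List.Membership.Propositional using (_∈_)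
  open import Data.List.Membership.Propositional.Properties using (∈-++⁺ˡ; ∈-++⁺ʳ; ∈-lookup)
  open import Data.Product using (∃; _×_; _,_; proj₁; proj₂)
  open import Relation.Nullary using (yes; no; contradiction)
  open import Relation.Binary.PropositionalEquality using (_≡_; _≢_; refl; sym; trans; subst; cong; cong₂)

  -- A linear form with natural coefficients, each coefficient being the multiplicity of a register.
  -- Constants are multiples of register 0.
  Form : Set
  Form = List ℕ

  ⟨_⟩ : Form → Store → ℕ
  ⟨ L ⟩ s = sum (map s L)

  -- Two tests suffice: one compares the program counter with a label, the other is the test of the
  -- command itself.
  record Instr : Set where
    field
      upd : ℕ → Form
      lhs₁ rhs₁ lhs₂ rhs₂ : Form

  open Instr public

  next : Instr → Store → Store
  next I s k = ⟨ upd I k ⟩ s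

  Passes : Instr → Store → Set
  Passes I s = (⟨ lhs₁ I ⟩ s ≡ ⟨ rhs₁ I ⟩ s) × (⟨ lhs₂ I ⟩ s ≡ ⟨ rhs₂ I ⟩ s)

  Accepts : ∀ {N} → (Fin N → Instr) → List (Fin N) → Store → Set
  Accepts ins []      s = s 1 ≡ 1
  Accepts ins (i ∷ w) s = Passes (ins i) s × Accepts ins w (next (ins i) s)

  record Bounded (D : ℕ) (I : Instr) : Set where
    field
      keeps : upd I 0 ≡ 0 ∷ []
      upd<  : ∀ k → k < D → All (_< D) (upd I k)
      lhs₁< : All (_< D) (lhs₁ I)
      rhs₁< : All (_< D) (rhs₁ I)
      lhs₂< : All (_< D) (lhs₂ I)
      rhs₂< : All (_< D) (rhs₂ I)

  -- Injectivity of the coding of lists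

  odd≢even : ∀ a b → 2 * a + 1 ≢ 2 * b
  odd≢even zero    (suc b) e with trans e (*-suc 2 b)
  ... | ()
  odd≢even (suc a) (suc b) e =
    odd≢even a b (suc-injective (suc-injective (trans (sym (cong (_+ 1) (*-suc 2 a))) (trans e (*-suc 2 b)))))

  suc-pair : ∀ x a → suc (pair x a) ≡ 2 ^ x * (2 * a + 1)
  suc-pair x a = m+[n∸m]≡n (*-mono-≤ (m^n>0 2 x) (m≤n+m 1 (2 * a)))

  -- Cancel factors 2 on both sides until one exponent is 0; if the other is not, an odd number
  -- equals an even one.
  odd-part-injective : ∀ x y {a b} → 2 ^ x * (2 * a + 1) ≡ 2 ^ y * (2 * b + 1) → x ≡ y × a ≡ b
  odd-part-injective zero zero {a} {b} e =
    refl , *-cancelˡ-≡ a b 2 (+-cancelʳ-≡ 1 (2 * a) (2 * b) (+-cancelʳ-≡ 0 _ _ e))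
  odd-part-injective zero (suc y) {a} {b} e =
    contradiction (trans (sym (*-identityˡ _)) (trans e (*-assoc 2 (2 ^ y) _))) (odd≢even a (2 ^ y * (2 * b + 1)))
  odd-part-injective (suc x) zero {a} {b} e =
    contradiction (trans (sym (*-identityˡ _)) (trans (sym e) (*-assoc 2 (2 ^ x) _))) (odd≢even b (2 ^ x * (2 * a + 1)))
  odd-part-injective (suc x) (suc y) {a} {b} e
    with odd-part-injective x y {a} {b} (*-cancelˡ-≡ _ _ 2 (trans (sym (*-assoc 2 (2 ^ x) _)) (trans e (*-assoc 2 (2 ^ y) _))))
  ... | refl , refl = refl , refl

  pair-injective : ∀ {x y a b} → pair x a ≡ pair y b → x ≡ y × a ≡ b
  pair-injective {x} {y} {a} {b} e =
    odd-part-injective x y {a} {b} (trans (sym (suc-pair x a)) (trans (cong suc e) (suc-pair y b)))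

  codeList-injective : ∀ xs ys → codeList xs ≡ codeList ys → xs ≡ ys
  codeList-injective []       []       e = refl
  codeList-injective (x ∷ xs) (y ∷ ys) e with pair-injective {x} {y} {codeList xs} {codeList ys} (suc-injective e)
  ... | refl , e' = cong (x ∷_) (codeList-injective xs ys e')

  -- Flattening programs

  shapeCmd : Cmd → List ℕ
  shapeCmd (asg i (const c)) = 0 ∷ i ∷ c ∷ []
  shapeCmd (asg i (c ⊹ j))   = 1 ∷ i ∷ c ∷ j ∷ []
  shapeCmd (eq i j)          = 2 ∷ i ∷ j ∷ []
  shapeCmd nop               = 3 ∷ []

  codeProg : Prog → ℕ
  codeProg (act c)  = codeList (0 ∷ shapeCmd c)
  codeProg (P ⨾ Q)  = codeList (1 ∷ codeProg P ∷ codeProg Q ∷ [])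
  codeProg (star P) = codeList (2 ∷ codeProg P ∷ [])

  shapeCmd-injective : ∀ c d → shapeCmd c ≡ shapeCmd d → c ≡ d
  shapeCmd-injective (asg i (const c)) (asg .i (const .c)) refl = refl
  shapeCmd-injective (asg i (c ⊹ j))   (asg .i (.c ⊹ .j))  refl = refl
  shapeCmd-injective (eq i j)          (eq .i .j)          refl = refl
  shapeCmd-injective nop               nop                 refl = refl
  shapeCmd-injective (asg _ (const _)) (asg _ (_ ⊹ _))     ()
  shapeCmd-injective (asg _ (const _)) (eq _ _)            ()
  shapeCmd-injective (asg _ (const _)) nop                 ()
  shapeCmd-injective (asg _ (_ ⊹ _))   (asg _ (const _))   ()
  shapeCmd-injective (asg _ (_ ⊹ _))   (eq _ _)            ()
  shapeCmd-injective (asg _ (_ ⊹ _))   nop                 ()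
  shapeCmd-injective (eq _ _)          (asg _ (const _))   ()
  shapeCmd-injective (eq _ _)          (asg _ (_ ⊹ _))     ()
  shapeCmd-injective nop               (asg _ (const _))   ()
  shapeCmd-injective nop               (asg _ (_ ⊹ _))     ()

  shape : Prog → List ℕ
  shape (act c)  = 0 ∷ shapeCmd c
  shape (P ⨾ Q)  = 1 ∷ codeProg P ∷ codeProg Q ∷ []
  shape (star P) = 2 ∷ codeProg P ∷ []

  codeProg-shape : ∀ P → codeProg P ≡ codeList (shape P)
  codeProg-shape (act c)  = refl
  codeProg-shape (P ⨾ Q)  = refl
  codeProg-shape (star P) = refl

  mutual
    codeProg-injective : ∀ P Q → codeProg P ≡ codeProg Q → P ≡ Q
    codeProg-injective P Q e = shape-injective P Q
      (codeList-injective (shape P) (shape Q) (trans (sym (codeProg-shape P)) (trans e (codeProg-shape Q))))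

    shape-injective : ∀ P Q → shape P ≡ shape Q → P ≡ Q
    shape-injective (act c)  (act d)    e = cong act (shapeCmd-injective c d (proj₂ (∷-injective e)))
    shape-injective (P ⨾ Q)  (P' ⨾ Q')  e =
      let e₁ , e' = ∷-injective (proj₂ (∷-injective e))
      in cong₂ _⨾_ (codeProg-injective P P' e₁) (codeProg-injective Q Q' (proj₁ (∷-injective e')))
    shape-injective (star P) (star P')  e =
      cong star (codeProg-injective P P' (proj₁ (∷-injective (proj₂ (∷-injective e)))))
    shape-injective (act _)  (_ ⨾ _)  ()
    shape-injective (act _)  (star _) ()
    shape-injective (_ ⨾ _)  (act _)  ()
    shape-injective (_ ⨾ _)  (star _) ()
    shape-injective (star _) (act _)  ()
    shape-injective (star _) (_ ⨾ _)  ()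

  -- The program counter belonging to a stack of pending programs. The empty stack gets 1, the only
  -- natural number at which 2 pc - pc² is positive, and 0 stays free for the start.
  label : List Prog → ℕ
  label K = suc (codeList (map codeProg K))

  label-injective : ∀ K K' → label K ≡ label K' → K ≡ K'
  label-injective K K' e = go K K' (codeList-injective (map codeProg K) (map codeProg K') (suc-injective e))
    where
    go : ∀ K K' → map codeProg K ≡ map codeProg K' → K ≡ K'
    go []      []        e = refl
    go (P ∷ K) (P' ∷ K') e =
      let e₁ , e₂ = ∷-injective e in cong₂ _∷_ (codeProg-injective P P' e₁) (go K K' e₂)

  Edge : Set
  Edge = List Prog × Cmd × List Prog

  -- Small steps between stacks of pending programs. Finitely many stacks suffice, because the body
  -- of a loop runs on top of the loop and so returns to a stack already listed.
  edges : Prog → List Prog → List Edge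
  edges (act c)  K = (act c ∷ K , c , K) ∷ []
  edges (P ⨾ Q)  K = (P ⨾ Q ∷ K , nop , P ∷ Q ∷ K) ∷ edges P (Q ∷ K) ++ edges Q K
  edges (star P) K = (star P ∷ K , nop , K) ∷ (star P ∷ K , nop , P ∷ star P ∷ K) ∷ edges P (star P ∷ K)

  data RunAll : List Prog → Store → Set where
    []  : ∀ {g} → RunAll [] g
    _∷_ : ∀ {P K g h} → Run P g h → RunAll K h → RunAll (P ∷ K) g

  -- Phrased backwards, since `accepts-sound` rebuilds the run from its accepting end.
  Valid : Edge → Set
  Valid (K , c , K') = ∀ {g g'} → Act c g g' → RunAll K' g' → RunAll K g

  edges-valid : ∀ P K → All Valid (edges P K)
  edges-valid (act c)  K = (λ a r → run-act a ∷ r) ∷ []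
  edges-valid (P ⨾ Q)  K = (λ { refl (p ∷ q ∷ r) → run-⨾ p q ∷ r }) ∷
                           AllP.++⁺ (edges-valid P (Q ∷ K)) (edges-valid Q K)
  edges-valid (star P) K = (λ { refl r → run-done ∷ r }) ∷
                           (λ { refl (p ∷ q ∷ r) → run-more p q ∷ r }) ∷
                           edges-valid P (star P ∷ K)

  -- Register 0 holds the constant 1, register 1 the program counter, register 2 + r the program's register r.

  sourceForm : Source → Form
  sourceForm (const c) = replicate c 0
  sourceForm (c ⊹ j)   = replicate c 0 ++ (2 + j) ∷ []

  regForm : Cmd → ℕ → Form
  regForm (asg i e) r with r ≟ i
  ... | yes _ = sourceForm e
  ... | no  _ = 2 + r ∷ []
  regForm (eq _ _)  r = 2 + r ∷ []
  regForm nop       r = 2 + r ∷ []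

  testˡ testʳ : Cmd → Form
  testˡ (asg _ _) = []
  testˡ (eq i j)  = 2 + i ∷ []
  testˡ nop       = []
  testʳ (asg _ _) = []
  testʳ (eq i j)  = 2 + j ∷ []
  testʳ nop       = []

  updForm : Cmd → ℕ → ℕ → Form
  updForm c l' zero          = 0 ∷ []
  updForm c l' (suc zero)    = replicate l' 0
  updForm c l' (suc (suc r)) = regForm c r

  instr : ℕ → Cmd → ℕ → Instr
  instr l c l' = record
    { upd = updForm c l' ; lhs₁ = 1 ∷ [] ; rhs₁ = replicate l 0 ; lhs₂ = testˡ c ; rhs₂ = testʳ c }

  record Represents (s : Store) (l : ℕ) (g : Store) : Set where
    field
      one  : s 0 ≡ 1
      pc   : s 1 ≡ l
      regs : ∀ r → s (2 + r) ≡ g r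

  open Represents

  replicate-form : ∀ c {s} → s 0 ≡ 1 → ⟨ replicate c 0 ⟩ s ≡ c
  replicate-form zero    one = refl
  replicate-form (suc c) one = cong₂ _+_ one (replicate-form c one)

  ⟨⟩-++ : ∀ L L' s → ⟨ L ++ L' ⟩ s ≡ ⟨ L ⟩ s + ⟨ L' ⟩ s
  ⟨⟩-++ []      L' s = refl
  ⟨⟩-++ (i ∷ L) L' s = trans (cong (s i +_) (⟨⟩-++ L L' s)) (sym (+-assoc (s i) _ _))

  sourceForm-correct : ∀ e {s l g} → Represents s l g → ⟨ sourceForm e ⟩ s ≡ source e g
  sourceForm-correct (const c) R = replicate-form c (one R)
  sourceForm-correct (c ⊹ j) {s} R =
    trans (⟨⟩-++ (replicate c 0) _ s)
      (cong₂ _+_ (replicate-form c (one R)) (trans (+-identityʳ _) (regs R j)))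

  reg-same : ∀ i e → regForm (asg i e) i ≡ sourceForm e
  reg-same i e with i ≟ i
  ... | yes _   = refl
  ... | no  i≢i = contradiction refl i≢i

  reg-other : ∀ i e r → r ≢ i → regForm (asg i e) r ≡ 2 + r ∷ []
  reg-other i e r r≢i with r ≟ i
  ... | yes r≡i = contradiction r≡i r≢i
  ... | no  _   = refl

  step-complete : ∀ {s l g g'} c l' → Represents s l g → Act c g g' →
                  Passes (instr l c l') s × Represents (next (instr l c l') s) l' g'
  step-complete {s} {l} {g} {g'} c l' R a = (test₁ , test₂ c a) , record
    { one = trans (+-identityʳ _) (one R) ; pc = replicate-form l' (one R) ; regs = regs' c a }
    where
    test₁ = trans (+-identityʳ _) (trans (pc R) (sym (replicate-form l (one R))))
    keep : ∀ r → ⟨ 2 + r ∷ [] ⟩ s ≡ g r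
    keep r = trans (+-identityʳ _) (regs R r)
    test₂ : ∀ c → Act c g g' → ⟨ testˡ c ⟩ s ≡ ⟨ testʳ c ⟩ s
    test₂ (asg _ _) a       = refl
    test₂ (eq i j)  (e , _) = trans (keep i) (trans e (sym (keep j)))
    test₂ nop       a       = refl
    regs' : ∀ c → Act c g g' → ∀ r → ⟨ regForm c r ⟩ s ≡ g' r
    regs' (asg i e) (e₁ , f) r with r ≟ i
    ... | yes refl = trans (sourceForm-correct e R) (sym e₁)
    ... | no  r≢i  = trans (keep r) (sym (f r r≢i))
    regs' (eq i j)  (_ , refl) r = keep r
    regs' nop       refl       r = keep r

  step-sound : ∀ {s l₀ g} l c l' → Represents s l₀ g → Passes (instr l c l') s →
               l₀ ≡ l × ∃ λ g' → Act c g g' × Represents (next (instr l c l') s) l' g'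
  step-sound {s} {l₀} {g} l c l' R (p₁ , p₂) =
    trans (sym (pc R)) (trans (sym (+-identityʳ _)) (trans p₁ (replicate-form l (one R)))) ,
    result c p₂
    where
    keep : ∀ r → ⟨ 2 + r ∷ [] ⟩ s ≡ g r
    keep r = trans (+-identityʳ _) (regs R r)
    rep : ∀ {c g'} → (∀ r → ⟨ regForm c r ⟩ s ≡ g' r) → Represents (next (instr l c l') s) l' g'
    rep f = record { one = trans (+-identityʳ _) (one R) ; pc = replicate-form l' (one R) ; regs = f }
    result : ∀ c → ⟨ testˡ c ⟩ s ≡ ⟨ testʳ c ⟩ s →
             ∃ λ g' → Act c g g' × Represents (next (instr l c l') s) l' g'
    result (asg i e) _ =
      (λ r → ⟨ regForm (asg i e) r ⟩ s) ,
      (trans (cong (λ L → ⟨ L ⟩ s) (reg-same i e)) (sourceForm-correct e R) ,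
       λ r r≢i → trans (cong (λ L → ⟨ L ⟩ s) (reg-other i e r r≢i)) (keep r)) ,
      rep λ r → refl
    result (eq i j) p = g , (trans (sym (keep i)) (trans p (keep j)) , refl) , rep keep
    result nop      _ = g , refl , rep keep

  module Machine (P₀ : Prog) where

    size : ℕ
    size = length (edges P₀ [])

    edgeInstr : Edge → Instr
    edgeInstr (K , c , K') = instr (label K) c (label K')

    -- The program counter starts at 0, so all initial moments that involve register 1 vanish and
    -- only those of registers 0 and 2 have to be loaded.
    start : Instr
    start = instr 0 nop (label (P₀ ∷ []))

    code : Fin (suc size) → Instr
    code zero    = start
    code (suc i) = edgeInstr (lookup (edges P₀ []) i)

    accepts-sound : ∀ w K {s g} → Represents s (label K) g → Accepts code w s → RunAll K g
    accepts-sound [] K R acc with label-injective K [] (trans (sym (pc R)) acc)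
    ... | refl = []
    -- The start instruction demands the counter 0, whereas every label is positive.
    accepts-sound (zero ∷ w) K R (p , _) with step-sound 0 nop (label (P₀ ∷ [])) R p
    ... | () , _
    accepts-sound (suc i ∷ w) K R (p , acc)
      with lookup (edges P₀ []) i | All.lookup (edges-valid P₀ []) (∈-lookup {xs = edges P₀ []} i)
    ... | K₁ , c , K₂ | valid with step-sound (label K₁) c (label K₂) R p
    ... | l≡ , g' , a , R' with label-injective K K₁ l≡
    ... | refl = valid a (accepts-sound w K₂ R' acc)

    machine-sound : ∀ w {s g} → Represents s 0 g → Accepts code w s → ∃ (Run P₀ g)
    machine-sound []          R acc = contradiction (trans (sym (pc R)) acc) λ ()
    machine-sound (zero ∷ w)  R (p , acc) with step-sound 0 nop (label (P₀ ∷ [])) R p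
    ... | _ , g' , refl , R' with accepts-sound w (P₀ ∷ []) R' acc
    ... | r ∷ [] = _ , r
    machine-sound (suc i ∷ w) R (p , acc) with lookup (edges P₀ []) i
    ... | K₁ , c , K₂ with step-sound (label K₁) c (label K₂) R p
    ... | () , _

    take-edge : ∀ {K c K' s g g'} → (K , c , K') ∈ edges P₀ [] → Represents s (label K) g → Act c g g' →
                (∀ {s'} → Represents s' (label K') g' → ∃ λ w → Accepts code w s') →
                ∃ λ w → Accepts code w s
    take-edge {K} {c} {K'} {s} e∈ R a cont with step-complete c (label K') R a
    ... | passes , R' with cont R'
    ... | w , acc =
      suc (Any.index e∈) ∷ w ,
      subst (λ e → Passes (edgeInstr e) s × Accepts code w (next (edgeInstr e) s)) (AnyP.lookup-index e∈) (passes , acc)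

    -- Continuation-passing style: acceptance is assumed for whatever follows `P` and transported
    -- back through its run. The inclusion of edges restricts to subprograms and is unchanged when a
    -- loop is re-entered.
    run-complete : ∀ {P g g'} → Run P g g' → ∀ K {s} → Represents s (label (P ∷ K)) g →
                   (∀ {e} → e ∈ edges P K → e ∈ edges P₀ []) →
                   (∀ {s'} → Represents s' (label K) g' → ∃ λ w → Accepts code w s') →
                   ∃ λ w → Accepts code w s
    run-complete (run-act a) K R ⊆ cont = take-edge (⊆ (here refl)) R a cont
    run-complete {P ⨾ Q} (run-⨾ p q) K R ⊆ cont =
      take-edge (⊆ (here refl)) R refl λ R₁ →
      run-complete p (Q ∷ K) R₁ (λ e∈ → ⊆ (there (∈-++⁺ˡ e∈))) λ R₂ →
      run-complete q K R₂ (λ e∈ → ⊆ (there (∈-++⁺ʳ (edges P (Q ∷ K)) e∈))) cont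
    run-complete run-done K R ⊆ cont = take-edge (⊆ (here refl)) R refl cont
    run-complete {star P} (run-more p q) K R ⊆ cont =
      take-edge (⊆ (there (here refl))) R refl λ R₁ →
      run-complete p (star P ∷ K) R₁ (λ e∈ → ⊆ (there (there e∈))) λ R₂ →
      run-complete q K R₂ ⊆ cont

    machine-complete : ∀ {s g g'} → Represents s 0 g → Run P₀ g g' → ∃ λ w → Accepts code w s
    machine-complete R r with step-complete nop (label (P₀ ∷ [])) R refl
    ... | passes , R' with run-complete r [] R' (λ e∈ → e∈) (λ R'' → [] , pc R'')
    ... | w , acc = zero ∷ w , passes , acc

    edgeBound : Edge → ℕ
    edgeBound (_ , asg _ (const _) , _) = 0
    edgeBound (_ , asg _ (_ ⊹ j) , _)   = j
    edgeBound (_ , eq i j , _)          = i + j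
    edgeBound (_ , nop , _)             = 0

    -- The 3 covers the constant, the program counter and the input register. Beyond these only
    -- registers that are read matter, since an update restricted to the kept coordinates must stay
    -- among them; the sum stands in for a maximum.
    dim : ℕ
    dim = 3 + sum (map edgeBound (edges P₀ []))

    ∈⇒≤sum : ∀ {e} es → e ∈ es → edgeBound e ≤ sum (map edgeBound es)
    ∈⇒≤sum (e ∷ es) (here refl) = m≤m+n _ _
    ∈⇒≤sum (e ∷ es) (there p)   = m≤n⇒m≤o+n (edgeBound e) (∈⇒≤sum es p)

    replicate-< : ∀ c {D} → All (_< suc D) (replicate c 0)
    replicate-< zero    = []
    replicate-< (suc c) = s≤s z≤n ∷ replicate-< c

    instr-bounded : ∀ l c l' B → edgeBound ([] , c , []) ≤ B → Bounded (3 + B) (instr l c l')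
    instr-bounded l c l' B le = record
      { keeps = refl
      ; upd<  = upd<' c le
      ; lhs₁< = s≤s (s≤s z≤n) ∷ []
      ; rhs₁< = replicate-< l
      ; lhs₂< = testˡ< c le
      ; rhs₂< = testʳ< c le
      }
      where
      upd<' : ∀ c → edgeBound ([] , c , []) ≤ B → ∀ k → k < 3 + B → All (_< 3 + B) (updForm c l' k)
      upd<' c le zero k< = s≤s z≤n ∷ []
      upd<' c le (suc zero) k< = replicate-< l'
      upd<' (asg i e) le (suc (suc r)) k< with r ≟ i
      upd<' (asg i (const c)) le (suc (suc r)) k< | yes _ = replicate-< c
      upd<' (asg i (c ⊹ j))   le (suc (suc r)) k< | yes _ =
        AllP.++⁺ (replicate-< c) (s≤s (s≤s (s≤s le)) ∷ [])
      upd<' (asg i e) le (suc (suc r)) k< | no _ = k< ∷ []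
      upd<' (eq i j)  le (suc (suc r)) k< = k< ∷ []
      upd<' nop       le (suc (suc r)) k< = k< ∷ []
      testˡ< : ∀ c → edgeBound ([] , c , []) ≤ B → All (_< 3 + B) (testˡ c)
      testˡ< (asg _ _) le = []
      testˡ< (eq i j)  le = s≤s (s≤s (s≤s (m+n≤o⇒m≤o i le))) ∷ []
      testˡ< nop       le = []
      testʳ< : ∀ c → edgeBound ([] , c , []) ≤ B → All (_< 3 + B) (testʳ c)
      testʳ< (asg _ _) le = []
      testʳ< (eq i j)  le = s≤s (s≤s (s≤s (m+n≤o⇒n≤o i le))) ∷ []
      testʳ< nop       le = []

    code-bounded : ∀ i → Bounded dim (code i)
    code-bounded zero    = instr-bounded 0 nop (label (P₀ ∷ [])) _ z≤n
    code-bounded (suc i) = edge-bounded _ (∈-lookup {xs = edges P₀ []} i)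
      where
      edge-bounded : ∀ e → e ∈ edges P₀ [] → Bounded dim (edgeInstr e)
      edge-bounded (K , asg j (const v) , K') e∈ = instr-bounded (label K) (asg j (const v)) (label K') _ z≤n
      edge-bounded (K , asg j (v ⊹ k) , K') e∈ = instr-bounded (label K) (asg j (v ⊹ k)) (label K') _ (∈⇒≤sum _ e∈)
      edge-bounded (K , eq j k , K') e∈ = instr-bounded (label K) (eq j k) (label K') _ (∈⇒≤sum _ e∈)
      edge-bounded (K , nop , K') e∈ = instr-bounded (label K) nop (label K') _ z≤n

-- Finite sums, linear and quadratic forms over the rationals.

module QuadraticForms where

  open Programs using (Store)
  open Machines using (Form; ⟨_⟩)
  open import Data.Nat as ℕ using (ℕ; zero; suc; z≤n; s≤s; _≡ᵇ_)
  open import Data.Bool using (true; false; if_then_else_)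
  open import Data.Fin as Fin using (Fin; zero; suc; toℕ; remQuot; fromℕ<; _↑ˡ_; _↑ʳ_)
  open import Data.Fin.Properties using (toℕ-fromℕ<; remQuot-combine; splitAt-↑ʳ)
  open import Data.Rational using (ℚ; 0ℚ; 1ℚ; _+_; _*_; _-_; -_; _≤_; nonNegative)
  open import Data.Rational.Properties
  open import Data.Rational.Solver using (module +-*-Solver)
  open import Data.List using ([]; _∷_)
  open import Data.List.Relation.Unary.All using (All; []; _∷_)
  open import Data.Product using (_×_; _,_; map₁)
  open import Relation.Binary.PropositionalEquality using (_≡_; refl; sym; trans; subst; cong; cong₂; module ≡-Reasoning)
  open +-*-Solver using (solve; _:=_; _:+_; _:*_; _:-_; :-_; con)

  -- Finite sums

  sum-cong : ∀ {n} {f g : Fin n → ℚ} → (∀ i → f i ≡ g i) → sumFin f ≡ sumFin g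
  sum-cong {zero}  e = refl
  sum-cong {suc n} e = cong₂ _+_ (e zero) (sum-cong (λ i → e (suc i)))

  sum-0 : ∀ n → sumFin {n} (λ _ → 0ℚ) ≡ 0ℚ
  sum-0 zero    = refl
  sum-0 (suc n) = trans (+-identityˡ _) (sum-0 n)

  sum-+ : ∀ {n} (f g : Fin n → ℚ) → sumFin (λ i → f i + g i) ≡ sumFin f + sumFin g
  sum-+ {zero}  f g = refl
  sum-+ {suc n} f g = trans (cong (f zero + g zero +_) (sum-+ (λ i → f (suc i)) (λ i → g (suc i))))
    (solve 4 (λ a b c d → (a :+ b) :+ (c :+ d) := (a :+ c) :+ (b :+ d)) refl (f zero) (g zero) _ _)

  sum-*ˡ : ∀ {n} c (f : Fin n → ℚ) → sumFin (λ i → c * f i) ≡ c * sumFin f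
  sum-*ˡ {zero}  c f = sym (*-zeroʳ c)
  sum-*ˡ {suc n} c f = trans (cong (c * f zero +_) (sum-*ˡ c (λ i → f (suc i)))) (sym (*-distribˡ-+ c _ _))

  sum-*ʳ : ∀ {n} c (f : Fin n → ℚ) → sumFin (λ i → f i * c) ≡ sumFin f * c
  sum-*ʳ c f = trans (sum-cong (λ i → *-comm (f i) c)) (trans (sum-*ˡ c f) (*-comm c _))

  sum-swap : ∀ {m n} (f : Fin m → Fin n → ℚ) →
             sumFin (λ i → sumFin (λ j → f i j)) ≡ sumFin (λ j → sumFin (λ i → f i j))
  sum-swap {zero}  {n} f = sym (sum-0 n)
  sum-swap {suc m} {n} f = trans (cong (sumFin (f zero) +_) (sum-swap (λ i → f (suc i))))
                                 (sym (sum-+ (f zero) (λ j → sumFin (λ i → f (suc i) j))))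

  sum-nonneg : ∀ {n} {f : Fin n → ℚ} → (∀ i → 0ℚ ≤ f i) → 0ℚ ≤ sumFin f
  sum-nonneg {zero}  p = ≤-refl
  sum-nonneg {suc n} p = +-mono-≤ (p zero) (sum-nonneg (λ i → p (suc i)))

  sum-mono : ∀ {n} {f g : Fin n → ℚ} → (∀ i → f i ≤ g i) → sumFin f ≤ sumFin g
  sum-mono {zero}  p = ≤-refl
  sum-mono {suc n} p = +-mono-≤ (p zero) (sum-mono (λ i → p (suc i)))

  term≤sum : ∀ {n} (f : Fin n → ℚ) → (∀ i → 0ℚ ≤ f i) → ∀ i → f i ≤ sumFin f
  term≤sum f p zero    =
    subst (_≤ sumFin f) (+-identityʳ (f zero)) (+-monoʳ-≤ (f zero) (sum-nonneg (λ i → p (suc i))))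
  term≤sum f p (suc i) =
    subst (_≤ sumFin f) (+-identityˡ (f (suc i))) (+-mono-≤ (p zero) (term≤sum (λ i → f (suc i)) (λ i → p (suc i)) i))

  sum-↑ : ∀ m {n} (f : Fin (m ℕ.+ n) → ℚ) →
          sumFin f ≡ sumFin (λ i → f (i ↑ˡ n)) + sumFin (λ j → f (m ↑ʳ j))
  sum-↑ zero    f = sym (+-identityˡ _)
  sum-↑ (suc m) f = trans (cong (f zero +_) (sum-↑ m (λ i → f (suc i)))) (sym (+-assoc (f zero) _ _))

  remQuot-↑ʳ : ∀ m n q → remQuot {suc m} n (n ↑ʳ q) ≡ map₁ suc (remQuot {m} n q)
  remQuot-↑ʳ m n q rewrite splitAt-↑ʳ n (m ℕ.* n) q = refl

  sum-remQuot : ∀ m n (f : Fin m × Fin n → ℚ) →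
                sumFin (λ q → f (remQuot {m} n q)) ≡ sumFin (λ i → sumFin (λ j → f (i , j)))
  sum-remQuot zero    n f = refl
  sum-remQuot (suc m) n f = trans (sum-↑ n (λ q → f (remQuot {suc m} n q))) (cong₂ _+_
    (sum-cong λ j → cong f (remQuot-combine {suc m} {n} zero j))
    (trans (sum-cong {f = λ q → f (remQuot {suc m} n (n ↑ʳ q))} λ q → cong f (remQuot-↑ʳ m n q))
           (sum-remQuot m n λ p → f (map₁ suc p))))

  -- Naturals as rationals

  ι : ℕ → ℚ
  ι zero    = 0ℚ
  ι (suc n) = 1ℚ + ι n

  ι-+ : ∀ m n → ι (m ℕ.+ n) ≡ ι m + ι n
  ι-+ zero    n = sym (+-identityˡ (ι n))
  ι-+ (suc m) n = trans (cong (1ℚ +_) (ι-+ m n)) (sym (+-assoc 1ℚ (ι m) (ι n)))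

  ι-* : ∀ m n → ι (m ℕ.* n) ≡ ι m * ι n
  ι-* zero    n = sym (*-zeroˡ (ι n))
  ι-* (suc m) n = trans (ι-+ n (m ℕ.* n)) (trans (cong (ι n +_) (ι-* m n))
    (solve 2 (λ a b → b :+ a :* b := (con 1ℚ :+ a) :* b) refl (ι m) (ι n)))

  0≤1 : 0ℚ ≤ 1ℚ
  0≤1 = nonNegative⁻¹ 1ℚ

  ι-nonneg : ∀ n → 0ℚ ≤ ι n
  ι-nonneg zero    = ≤-refl
  ι-nonneg (suc n) = +-mono-≤ 0≤1 (ι-nonneg n)

  ι-mono : ∀ {m n} → m ℕ.≤ n → ι m ≤ ι n
  ι-mono {n = n} z≤n = ι-nonneg n
  ι-mono (s≤s m≤n)   = +-monoʳ-≤ 1ℚ (ι-mono m≤n)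

  *-nonneg : ∀ {p q} → 0ℚ ≤ p → 0ℚ ≤ q → 0ℚ ≤ p * q
  *-nonneg {p} {q} 0≤p 0≤q = subst (_≤ p * q) (*-zeroʳ p) (*-monoˡ-≤-nonNeg p {{nonNegative 0≤p}} 0≤q)

  -- Integrality is the point: a squared error is 0 or at least 1, so failures cannot be arbitrarily
  -- cheap.
  square-diff : ∀ m n → ι m * ι m + ι n * ι n - (1ℚ + 1ℚ) * (ι m * ι n) ≡ ι (ℕ.∣ m - n ∣ ℕ.* ℕ.∣ m - n ∣)
  square-diff m n = trans (factor (ι m) (ι n)) (trans (abs m n) (sym (ι-* ℕ.∣ m - n ∣ ℕ.∣ m - n ∣)))
    where
    factor : ∀ a b → a * a + b * b - (1ℚ + 1ℚ) * (a * b) ≡ (a - b) * (a - b)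
    factor = solve 2 (λ a b → a :* a :+ b :* b :- (con 1ℚ :+ con 1ℚ) :* (a :* b) := (a :- b) :* (a :- b)) refl
    abs : ∀ m n → (ι m - ι n) * (ι m - ι n) ≡ ι ℕ.∣ m - n ∣ * ι ℕ.∣ m - n ∣
    abs zero    n       = solve 1 (λ b → (con 0ℚ :- b) :* (con 0ℚ :- b) := b :* b) refl (ι n)
    abs (suc m) zero    = solve 1 (λ b → (b :- con 0ℚ) :* (b :- con 0ℚ) := b :* b) refl (ι (suc m))
    abs (suc m) (suc n) = trans
      (solve 2 (λ a b → ((con 1ℚ :+ a) :- (con 1ℚ :+ b)) :* ((con 1ℚ :+ a) :- (con 1ℚ :+ b)) := (a :- b) :* (a :- b))
             refl (ι m) (ι n))
      (abs m n)

  -- Linear and quadratic forms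

  opaque
    dot : ∀ {D} → (Fin D → ℚ) → (Fin D → ℚ) → ℚ
    dot a x = sumFin (λ i → a i * x i)

    quad : ∀ {D} → (Fin D → Fin D → ℚ) → (Fin D → ℚ) → ℚ
    quad Φ x = sumFin λ i → sumFin λ j → (x i * x j) * Φ i j

  module _ {D : ℕ} where
    opaque
      unfolding dot quad

      quad-cong : {Φ Ψ : Fin D → Fin D → ℚ} (x : Fin D → ℚ) {y : Fin D → ℚ} →
                  (∀ i j → Φ i j ≡ Ψ i j) → (∀ i → x i ≡ y i) → quad Φ x ≡ quad Ψ y
      quad-cong x e f = sum-cong λ i → sum-cong λ j → cong₂ _*_ (cong₂ _*_ (f i) (f j)) (e i j)

      quad-+ : (Φ Ψ : Fin D → Fin D → ℚ) (x : Fin D → ℚ) →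
               quad (λ i j → Φ i j + Ψ i j) x ≡ quad Φ x + quad Ψ x
      quad-+ Φ Ψ x = trans
        (sum-cong λ i → trans (sum-cong λ j → *-distribˡ-+ (x i * x j) (Φ i j) (Ψ i j))
                             (sum-+ (λ j → (x i * x j) * Φ i j) (λ j → (x i * x j) * Ψ i j)))
        (sum-+ (λ i → sumFin λ j → (x i * x j) * Φ i j) (λ i → sumFin λ j → (x i * x j) * Ψ i j))

      quad-*ˡ : (c : ℚ) (Φ : Fin D → Fin D → ℚ) (x : Fin D → ℚ) →
                quad (λ i j → c * Φ i j) x ≡ c * quad Φ x
      quad-*ˡ c Φ x = trans
        (sum-cong λ i → trans
          (sum-cong λ j → solve 3 (λ a b d → a :* (b :* d) := b :* (a :* d)) refl (x i * x j) c (Φ i j))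
          (sum-*ˡ c (λ j → (x i * x j) * Φ i j)))
        (sum-*ˡ c (λ i → sumFin λ j → (x i * x j) * Φ i j))

      quad-- : (Φ Ψ : Fin D → Fin D → ℚ) (x : Fin D → ℚ) →
               quad (λ i j → Φ i j - Ψ i j) x ≡ quad Φ x - quad Ψ x
      quad-- Φ Ψ x = begin
        quad (λ i j → Φ i j - Ψ i j) x             ≡⟨ quad-cong x (λ i j → minus (Φ i j) (Ψ i j)) (λ _ → refl) ⟩
        quad (λ i j → Φ i j + - 1ℚ * Ψ i j) x      ≡⟨ quad-+ Φ (λ i j → - 1ℚ * Ψ i j) x ⟩
        quad Φ x + quad (λ i j → - 1ℚ * Ψ i j) x   ≡⟨ cong (quad Φ x +_) (quad-*ˡ (- 1ℚ) Ψ x) ⟩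
        quad Φ x + - 1ℚ * quad Ψ x                 ≡⟨ minus (quad Φ x) (quad Ψ x) ⟨
        quad Φ x - quad Ψ x                        ∎
        where
        open ≡-Reasoning
        minus : ∀ a b → a - b ≡ a + - 1ℚ * b
        minus = solve 2 (λ a b → a :- b := a :+ con (- 1ℚ) :* b) refl

      quad-sum : ∀ {n} (Φ : Fin n → Fin D → Fin D → ℚ) (x : Fin D → ℚ) →
                 quad (λ i j → sumFin (λ k → Φ k i j)) x ≡ sumFin (λ k → quad (Φ k) x)
      quad-sum Φ x = trans
        (sum-cong λ i → trans
          (sum-cong λ j → sym (sum-*ˡ (x i * x j) (λ k → Φ k i j)))
          (sum-swap (λ j k → (x i * x j) * Φ k i j)))
        (sum-swap (λ i k → sumFin (λ j → (x i * x j) * Φ k i j)))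

      quad-product : (a b x : Fin D → ℚ) → quad (λ i j → a i * b j) x ≡ dot a x * dot b x
      quad-product a b x = trans
        (sum-cong λ i → trans
          (sum-cong λ j → solve 4 (λ x y a b → (x :* y) :* (a :* b) := (a :* x) :* (b :* y)) refl (x i) (x j) (a i) (b j))
          (sum-*ˡ (a i * x i) (λ j → b j * x j)))
        (sum-*ʳ (dot b x) (λ i → a i * x i))

      -- The matrix on the left is the congruence uᵀ Φ u, the substitution of a linear map into a
      -- form. An update of the registers thereby becomes a linear action on forms.
      quad-pull : (u : Fin D → Fin D → ℚ) (Φ : Fin D → Fin D → ℚ) (x : Fin D → ℚ) →
                  quad (λ i j → sumFin λ k → sumFin λ l → (u k i * u l j) * Φ k l) x ≡ quad Φ (λ k → dot (u k) x)
      quad-pull u Φ x = trans (quad-sum (λ k i j → sumFin λ l → (u k i * u l j) * Φ k l) x) (sum-cong λ k →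
        trans (quad-sum (λ l i j → (u k i * u l j) * Φ k l) x) (sum-cong λ l → begin
        quad (λ i j → (u k i * u l j) * Φ k l) x ≡⟨ quad-cong x (λ i j → *-comm (u k i * u l j) (Φ k l)) (λ _ → refl) ⟩
        quad (λ i j → Φ k l * (u k i * u l j)) x ≡⟨ quad-*ˡ (Φ k l) (λ i j → u k i * u l j) x ⟩
        Φ k l * quad (λ i j → u k i * u l j) x   ≡⟨ *-comm (Φ k l) _ ⟩
        quad (λ i j → u k i * u l j) x * Φ k l   ≡⟨ cong (_* Φ k l) (quad-product (u k) (u l) x) ⟩
        (dot (u k) x * dot (u l) x) * Φ k l      ∎))
        where open ≡-Reasoning

  -- The Kronecker delta.
  hit : ℕ → ℕ → ℚ
  hit r i = if r ≡ᵇ i then 1ℚ else 0ℚ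

  hit-nonneg : ∀ r i → 0ℚ ≤ hit r i
  hit-nonneg r i with r ≡ᵇ i
  ... | true  = 0≤1
  ... | false = ≤-refl

  sum-hit : ∀ {D} (k : Fin D) (f : Fin D → ℚ) → sumFin (λ i → hit (toℕ k) (toℕ i) * f i) ≡ f k
  sum-hit {suc D} zero    f =
    trans (cong₂ _+_ (*-identityˡ (f zero)) (trans (sum-cong {D} λ i → *-zeroˡ (f (suc i))) (sum-0 D))) (+-identityʳ (f zero))
  sum-hit {suc D} (suc k) f =
    trans (cong₂ _+_ (*-zeroˡ (f zero)) (sum-hit k (λ i → f (suc i)))) (+-identityˡ (f (suc k)))

  coef : Form → ℕ → ℚ
  coef []      i = 0ℚ
  coef (r ∷ L) i = hit r i + coef L i

  coef-nonneg : ∀ L i → 0ℚ ≤ coef L i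
  coef-nonneg []      i = ≤-refl
  coef-nonneg (r ∷ L) i = +-mono-≤ (hit-nonneg r i) (coef-nonneg L i)

  vec : ∀ {D} → Store → Fin D → ℚ
  vec s i = ι (s (toℕ i))

  row : ∀ {D} → Form → Fin D → ℚ
  row L i = coef L (toℕ i)

  opaque
    unfolding dot

    dot-row : ∀ {D} L s → All (ℕ._< D) L → dot {D} (row L) (vec s) ≡ ι (⟨ L ⟩ s)
    dot-row {D} [] s [] = trans (sum-cong {D} λ i → *-zeroˡ (vec s i)) (sum-0 D)
    dot-row {D} (r ∷ L) s (r< ∷ L<) = begin
      dot {D} (row (r ∷ L)) (vec s)
        ≡⟨ sum-cong {D} (λ i → *-distribʳ-+ (vec s i) (hit r (toℕ i)) (row L i)) ⟩
      sumFin {D} (λ i → hit r (toℕ i) * vec s i + row L i * vec s i)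
        ≡⟨ sum-+ {D} _ _ ⟩
      sumFin {D} (λ i → hit r (toℕ i) * vec s i) + dot {D} (row L) (vec s)
        ≡⟨ cong₂ _+_ hit-eval (dot-row L s L<) ⟩
      ι (s r) + ι (⟨ L ⟩ s)
        ≡⟨ ι-+ (s r) (⟨ L ⟩ s) ⟨
      ι (⟨ r ∷ L ⟩ s) ∎
      where
      open ≡-Reasoning
      hit-eval : sumFin {D} (λ i → hit r (toℕ i) * vec s i) ≡ ι (s r)
      hit-eval = subst (λ r → sumFin {D} (λ i → hit r (toℕ i) * vec s i) ≡ ι (s r)) (toℕ-fromℕ< r<)
                   (sum-hit (fromℕ< r<) (vec s))

-- The value of an instruction sequence as a quadratic form.

module Values where

  open Programs using (Store)
  open Machines
  open QuadraticForms
  open import Data.Nat as ℕ using (ℕ; zero; suc; z≤n; s≤s)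
  import Data.Nat.Properties as ℕₚ
  open import Data.Fin as Fin using (Fin; zero; suc; toℕ)
  open import Data.Fin.Properties using (toℕ<n)
  open import Data.Rational using (ℚ; 0ℚ; 1ℚ; _+_; _*_; _-_; -_; _≤_; _<_)
  open import Data.Rational.Properties
  open import Data.Rational.Solver using (module +-*-Solver)
  open import Data.List using (List; []; _∷_)
  open import Data.List.Relation.Unary.All using (All; []; _∷_)
  open import Data.Product using (_×_; _,_)
  open import Relation.Nullary using (contradiction)
  open import Relation.Binary.PropositionalEquality using (_≡_; refl; sym; trans; subst; cong; cong₂; module ≡-Reasoning)
  open +-*-Solver using (solve; _:=_; _:+_; _:*_; _:-_; :-_; con)

  two : ℚ
  two = 1ℚ + 1ℚ

  module Value {N D : ℕ} (code : Fin N → Instr) (1<D : 1 ℕ.< D)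
               (bounded : ∀ a → Bounded D (code a)) where

    private
      Ix = Fin D

    upd# : Fin N → Ix → Ix → ℚ
    upd# a k i = row (upd (code a) (toℕ k)) i

    l₁ r₁ l₂ r₂ : Fin N → Ix → ℚ
    l₁ a = row (lhs₁ (code a))
    r₁ a = row (rhs₁ (code a))
    l₂ a = row (lhs₂ (code a))
    r₂ a = row (rhs₂ (code a))

    -- The two halves of (l₁ - r₁)² + (l₂ - r₂)²: squares and cross terms are kept apart, since
    -- transition probabilities can only carry nonnegative coefficients.
    test⁺ test⁻ : Fin N → Ix → Ix → ℚ
    test⁺ a i j = (l₁ a i * l₁ a j + r₁ a i * r₁ a j) + (l₂ a i * l₂ a j + r₂ a i * r₂ a j)
    test⁻ a i j = two * (l₁ a i * r₁ a j) + two * (l₂ a i * r₂ a j)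

    -- The parts of 2 pc - pc², made homogeneous of degree 2 by multiplying the linear term with
    -- register 0.
    final⁺ final⁻ : Ix → Ix → ℚ
    final⁺ i j = two * (row (1 ∷ []) i * row (0 ∷ []) j)
    final⁻ i j = row (1 ∷ []) i * row (1 ∷ []) j

    -- The adjoint picture: instead of pushing the registers forward, the final payoff is pulled
    -- back through the instructions, each subtracting its squared errors. This matches the
    -- recursion of `probFrom`, which also peels off the first letter.
    Φ : List (Fin N) → Ix → Ix → ℚ
    Φ []      i j = final⁺ i j - final⁻ i j
    Φ (a ∷ w) i j = (sumFin λ k → sumFin λ l → (upd# a k i * upd# a l j) * Φ w k l) + (test⁻ a i j - test⁺ a i j)

    value : List (Fin N) → Store → ℚ
    value w s = quad (Φ w) (vec s)

    sq : ℕ → ℕ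
    sq n = n ℕ.* n

    cost : Fin N → Store → ℕ
    cost a s = sq ℕ.∣ ⟨ lhs₁ (code a) ⟩ s - ⟨ rhs₁ (code a) ⟩ s ∣ ℕ.+
               sq ℕ.∣ ⟨ lhs₂ (code a) ⟩ s - ⟨ rhs₂ (code a) ⟩ s ∣

    module _ (a : Fin N) (s : Store) where
      open Bounded (bounded a)

      private
        I = code a
        L₁ = ι (⟨ lhs₁ I ⟩ s)
        R₁ = ι (⟨ rhs₁ I ⟩ s)
        L₂ = ι (⟨ lhs₂ I ⟩ s)
        R₂ = ι (⟨ rhs₂ I ⟩ s)

        product : ∀ L L' → All (ℕ._< D) L → All (ℕ._< D) L' →
                  quad (λ i j → row L i * row L' j) (vec {D} s) ≡ ι (⟨ L ⟩ s) * ι (⟨ L' ⟩ s)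
        product L L' L< L'< = trans (quad-product (row L) (row L') (vec s)) (cong₂ _*_ (dot-row L s L<) (dot-row L' s L'<))

      quad-test⁺ : quad (test⁺ a) (vec s) ≡ (L₁ * L₁ + R₁ * R₁) + (L₂ * L₂ + R₂ * R₂)
      quad-test⁺ = trans (quad-+ (λ i j → l₁ a i * l₁ a j + r₁ a i * r₁ a j) _ (vec s)) (cong₂ _+_
        (trans (quad-+ (λ i j → l₁ a i * l₁ a j) _ (vec s))
               (cong₂ _+_ (product _ _ lhs₁< lhs₁<) (product _ _ rhs₁< rhs₁<)))
        (trans (quad-+ (λ i j → l₂ a i * l₂ a j) _ (vec s))
               (cong₂ _+_ (product _ _ lhs₂< lhs₂<) (product _ _ rhs₂< rhs₂<))))

      quad-test⁻ : quad (test⁻ a) (vec s) ≡ two * (L₁ * R₁) + two * (L₂ * R₂)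
      quad-test⁻ = trans (quad-+ (λ i j → two * (l₁ a i * r₁ a j)) _ (vec s)) (cong₂ _+_
        (trans (quad-*ˡ two _ (vec s)) (cong (two *_) (product _ _ lhs₁< rhs₁<)))
        (trans (quad-*ˡ two _ (vec s)) (cong (two *_) (product _ _ lhs₂< rhs₂<))))

      quad-tests : quad (test⁻ a) (vec s) - quad (test⁺ a) (vec s) ≡ - ι (cost a s)
      quad-tests = begin
        quad (test⁻ a) (vec s) - quad (test⁺ a) (vec s)
          ≡⟨ cong₂ _-_ quad-test⁻ quad-test⁺ ⟩
        (two * (L₁ * R₁) + two * (L₂ * R₂)) - ((L₁ * L₁ + R₁ * R₁) + (L₂ * L₂ + R₂ * R₂))
          ≡⟨ solve 6 (λ p q a b c d → (p :+ q) :- ((a :+ b) :+ (c :+ d)) := :- ((a :+ b :- p) :+ (c :+ d :- q))) refl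
               (two * (L₁ * R₁)) (two * (L₂ * R₂)) (L₁ * L₁) (R₁ * R₁) (L₂ * L₂) (R₂ * R₂) ⟩
        - ((L₁ * L₁ + R₁ * R₁ - two * (L₁ * R₁)) + (L₂ * L₂ + R₂ * R₂ - two * (L₂ * R₂)))
          ≡⟨ cong -_ (cong₂ _+_ (square-diff (⟨ lhs₁ I ⟩ s) _) (square-diff (⟨ lhs₂ I ⟩ s) _)) ⟩
        - (ι (sq ℕ.∣ ⟨ lhs₁ I ⟩ s - ⟨ rhs₁ I ⟩ s ∣) + ι (sq ℕ.∣ ⟨ lhs₂ I ⟩ s - ⟨ rhs₂ I ⟩ s ∣))
          ≡⟨ cong -_ (ι-+ (sq ℕ.∣ ⟨ lhs₁ I ⟩ s - ⟨ rhs₁ I ⟩ s ∣) _) ⟨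
        - ι (cost a s) ∎
        where open ≡-Reasoning

      value-∷ : ∀ w → value (a ∷ w) s ≡ value w (next I s) - ι (cost a s)
      value-∷ w = begin
        value (a ∷ w) s
          ≡⟨ quad-+ (λ i j → sumFin λ k → sumFin λ l → (upd# a k i * upd# a l j) * Φ w k l) _ (vec s) ⟩
        quad (λ i j → sumFin λ k → sumFin λ l → (upd# a k i * upd# a l j) * Φ w k l) (vec s) + quad (λ i j → test⁻ a i j - test⁺ a i j) (vec s)
          ≡⟨ cong₂ _+_
               (trans (quad-pull (upd# a) (Φ w) (vec s))
                      (quad-cong (λ k → dot (upd# a k) (vec s)) (λ _ _ → refl)
                                 (λ k → dot-row (upd I (toℕ k)) s (upd< (toℕ k) (toℕ<n k)))))
               (trans (quad-- (test⁻ a) (test⁺ a) (vec s)) quad-tests) ⟩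
        value w (next I s) - ι (cost a s) ∎
        where open ≡-Reasoning

      cost-passes : Passes I s → cost a s ≡ 0
      cost-passes (p₁ , p₂) = cong₂ (λ m n → sq m ℕ.+ sq n) (ℕₚ.m≡n⇒∣m-n∣≡0 p₁) (ℕₚ.m≡n⇒∣m-n∣≡0 p₂)

      passes-cost : cost a s ≡ 0 → Passes I s
      passes-cost e =
        ℕₚ.∣m-n∣≡0⇒m≡n (sq≡0 _ (ℕₚ.m+n≡0⇒m≡0 _ e)) ,
        ℕₚ.∣m-n∣≡0⇒m≡n (sq≡0 _ (ℕₚ.m+n≡0⇒n≡0 (sq ℕ.∣ ⟨ lhs₁ I ⟩ s - ⟨ rhs₁ I ⟩ s ∣) e))
        where
        sq≡0 : ∀ n → sq n ≡ 0 → n ≡ 0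
        sq≡0 zero e = refl

      next-one : s 0 ≡ 1 → next I s 0 ≡ 1
      next-one e = trans (cong (λ L → ⟨ L ⟩ s) keeps) (trans (ℕₚ.+-identityʳ _) e)

    value-[] : ∀ s → s 0 ≡ 1 → value [] s ≡ two * ι (s 1) - ι (s 1) * ι (s 1)
    value-[] s e = trans (quad-- final⁺ final⁻ (vec s)) (cong₂ _-_
      (trans (quad-*ˡ two _ (vec s)) (cong (two *_)
        (trans (quad-product (row (1 ∷ [])) (row (0 ∷ [])) (vec s))
          (trans (cong₂ _*_ pc-eval one-eval) (*-identityʳ (ι (s 1)))))))
      (trans (quad-product (row (1 ∷ [])) (row (1 ∷ [])) (vec s)) (cong₂ _*_ pc-eval pc-eval)))
      where
      pc-eval : dot {D} (row (1 ∷ [])) (vec s) ≡ ι (s 1)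
      pc-eval = trans (dot-row (1 ∷ []) s (1<D ∷ [])) (cong ι (ℕₚ.+-identityʳ (s 1)))
      one-eval : dot {D} (row (0 ∷ [])) (vec s) ≡ 1ℚ
      one-eval = trans (dot-row (0 ∷ []) s (ℕₚ.<-trans (s≤s z≤n) 1<D ∷ [])) (cong ι (trans (ℕₚ.+-identityʳ (s 0)) e))

    accepts-value : ∀ w s → s 0 ≡ 1 → Accepts code w s → value w s ≡ 1ℚ
    accepts-value [] s one acc = trans (value-[] s one) (cong (λ n → two * ι n - ι n * ι n) acc)
    accepts-value (a ∷ w) s one (p , acc) =
      trans (value-∷ a s w) (trans (cong₂ (λ v c → v - ι c) (accepts-value w (next (code a) s) (next-one a s one) acc) (cost-passes a s p)) refl)

    value-[]-large : ∀ n → two * ι (2 ℕ.+ n) - ι (2 ℕ.+ n) * ι (2 ℕ.+ n) ≤ 0ℚ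
    value-[]-large n = subst (_≤ 0ℚ)
      (solve 1 (λ x → :- (x :* (con two :+ x)) := con two :* (con 1ℚ :+ (con 1ℚ :+ x)) :- (con 1ℚ :+ (con 1ℚ :+ x)) :* (con 1ℚ :+ (con 1ℚ :+ x))) refl (ι n))
      (neg-antimono-≤ (*-nonneg (ι-nonneg n) (+-mono-≤ (ι-nonneg 2) (ι-nonneg n))))

    value≤1 : ∀ w s → s 0 ≡ 1 → value w s ≤ 1ℚ
    value≤1 [] s one = subst (_≤ 1ℚ) (sym (value-[] s one)) (go (s 1))
      where
      go : ∀ n → two * ι n - ι n * ι n ≤ 1ℚ
      go zero          = 0≤1
      go (suc zero)    = ≤-refl
      go (suc (suc n)) = ≤-trans (value-[]-large n) 0≤1
    value≤1 (a ∷ w) s one = subst (_≤ 1ℚ) (sym (value-∷ a s w))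
      (+-mono-≤ (value≤1 w (next (code a) s) (next-one a s one)) (neg-antimono-≤ (ι-nonneg (cost a s))))

    -- What remains after an instruction is worth at most 1 and a failed test costs at least 1, so
    -- positivity forces every test to pass; at the end it forces pc = 1.
    value-accepts : ∀ w s → s 0 ≡ 1 → 0ℚ < value w s → Accepts code w s
    value-accepts [] s one v = go (s 1) (subst (0ℚ <_) (value-[] s one) v)
      where
      go : ∀ n → 0ℚ < two * ι n - ι n * ι n → n ≡ 1
      go zero          p = contradiction p (<-irrefl refl)
      go (suc zero)    p = refl
      go (suc (suc n)) p = contradiction (<-≤-trans p (value-[]-large n)) (<-irrefl refl)
    value-accepts (a ∷ w) s one v = go (cost a s) refl
      where
      v' : 0ℚ < value w (next (code a) s) - ι (cost a s)
      v' = subst (0ℚ <_) (value-∷ a s w) v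
      go : ∀ c → cost a s ≡ c → Passes (code a) s × Accepts code w (next (code a) s)
      go zero e = passes-cost a s e ,
        value-accepts w (next (code a) s) (next-one a s one) (subst (0ℚ <_) (trans (cong (λ c → value w (next (code a) s) - ι c) e) (+-identityʳ _)) v')
      go (suc c) e = contradiction
        (<-≤-trans (subst (λ c → 0ℚ < value w (next (code a) s) - ι c) e v')
          (+-mono-≤ (value≤1 w (next (code a) s) (next-one a s one)) (neg-antimono-≤ (ι-mono {1} {suc c} (s≤s z≤n)))))
        (<-irrefl refl)

-- Probabilities and fractions in lowest terms.

module Rationals where

  open QuadraticForms
  open import Data.Nat as ℕ using (ℕ; zero; suc)
  import Data.Nat.Properties as ℕₚ
  open import Data.Nat.Coprimality as Coprimality using (Coprime)
  open import Data.Nat.Divisibility using (∣-trans)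
  open import Data.Integer as ℤ using (+_)
  import Data.Integer.Properties as ℤₚ

  open import Data.Bool using (true; false)
  open import Data.Fin using (zero; suc)
  open import Data.Rational using (0ℚ; 1ℚ; mkℚ; toℚᵘ; _+_; _*_; _≤_; nonNegative)
  open import Data.Rational.Properties
  open import Data.Rational.Unnormalised as ℚᵘ using (mkℚᵘ; *≡*)
  import Data.Rational.Unnormalised.Properties as ℚᵘₚ
  open import Data.List using ([]; _∷_)
  open import Data.Product using (_,_)
  open import Relation.Binary.PropositionalEquality using (_≡_; sym; trans; subst; cong)

  indicator-nonneg : ∀ b → 0ℚ ≤ indicator b
  indicator-nonneg true  = 0≤1
  indicator-nonneg false = ≤-refl

  indicator≤1 : ∀ b → indicator b ≤ 1ℚ
  indicator≤1 true  = ≤-refl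
  indicator≤1 false = 0≤1

  *-mono-≤1 : ∀ {p q} → 0ℚ ≤ p → q ≤ 1ℚ → p * q ≤ p
  *-mono-≤1 {p} {q} 0≤p q≤1 = subst (p * q ≤_) (*-identityʳ p) (*-monoˡ-≤-nonNeg p {{nonNegative 0≤p}} q≤1)

  module _ {k n} (T : Transducer k n) where
    open Transducer T

    prob-nonneg : ∀ q x y → 0ℚ ≤ probFrom T q x y
    prob-nonneg q []      []      = 0≤1
    prob-nonneg q []      (_ ∷ _) = ≤-refl
    prob-nonneg q (_ ∷ _) []      = ≤-refl
    prob-nonneg q (a ∷ x) (b ∷ y) = sum-nonneg λ q' →
      *-nonneg (δ-nonneg q a q') (*-nonneg (indicator-nonneg (ℓ q' ≟ᴸ b)) (prob-nonneg q' x y))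

    prob≤1 : ∀ q x y → probFrom T q x y ≤ 1ℚ
    prob≤1 q []      []      = ≤-refl
    prob≤1 q []      (_ ∷ _) = 0≤1
    prob≤1 q (_ ∷ _) []      = 0≤1
    prob≤1 q (a ∷ x) (b ∷ y) = subst (probFrom T q (a ∷ x) (b ∷ y) ≤_) (δ-sum q a) (sum-mono λ q' →
      *-mono-≤1 (δ-nonneg q a q')
        (≤-trans (*-mono-≤1 (indicator-nonneg (ℓ q' ≟ᴸ b)) (prob≤1 q' x y)) (indicator≤1 (ℓ q' ≟ᴸ b))))

  toℚᵘ-ι : ∀ n → toℚᵘ (ι n) ℚᵘ.≃ mkℚᵘ (+ n) 0
  toℚᵘ-ι zero    = ℚᵘₚ.≃-refl
  toℚᵘ-ι (suc n) = ℚᵘₚ.≃-trans (toℚᵘ-homo-+ 1ℚ (ι n))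
    (ℚᵘₚ.≃-trans (ℚᵘₚ.+-congʳ (toℚᵘ 1ℚ) (toℚᵘ-ι n))
      (*≡* (cong (ℤ._* + 1) (cong (λ z → + 1 ℤ.+ z) (ℤₚ.*-identityʳ (+ n))))))

  mkℚ*ι : ∀ a d .(c : Coprime a (suc d)) → mkℚ (+ a) d c * ι (suc d) ≡ ι a
  mkℚ*ι a d c = toℚᵘ-injective (ℚᵘₚ.≃-trans (toℚᵘ-homo-* (mkℚ (+ a) d c) (ι (suc d)))
    (ℚᵘₚ.≃-trans (ℚᵘₚ.*-congˡ {mkℚᵘ (+ a) d} (toℚᵘ-ι (suc d)))
      (ℚᵘₚ.≃-trans (*≡* (trans (ℤₚ.*-identityʳ _) (cong (λ m → + a ℤ.* + m) (sym (cong suc (ℕₚ.*-identityʳ d))))))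
        (ℚᵘₚ.≃-sym (toℚᵘ-ι a)))))

  -- Initial probabilities are needed both as literal reduced fractions, whose code can be read off,
  -- and as multiples of one unit fraction, on which ring identities work. This converts the first
  -- into the second.
  mkℚ-scale : ∀ a d .(c : Coprime a (suc d)) .(c₁ : Coprime 1 (suc d)) → mkℚ (+ a) d c ≡ ι a * mkℚ (+ 1) d c₁
  mkℚ-scale a d c c₁ = trans (sym (*-identityʳ p)) (trans (cong (p *_) (sym unit)) (trans (sym (*-assoc p (ι (suc d)) κ)) (cong (_* κ) (mkℚ*ι a d c))))
    where
    p = mkℚ (+ a) d c
    κ = mkℚ (+ 1) d c₁
    unit : ι (suc d) * κ ≡ 1ℚ
    unit = trans (*-comm (ι (suc d)) κ) (mkℚ*ι 1 d c₁)

  coprime-* : ∀ {a b c} → Coprime a c → Coprime b c → Coprime (a ℕ.* b) c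
  coprime-* {a} {b} {c} ac bc {d} (d∣ab , d∣c) =
    bc (Coprimality.coprime-divisor {d} {a} (λ (e∣d , e∣a) → ac (e∣a , ∣-trans e∣d d∣c)) d∣ab , d∣c)

-- The transducer of a machine and its symmetry.

module Transducers where

  open Programs using (Store)
  open Machines
  open QuadraticForms
  open Values
  open Rationals
  open import Data.Nat as ℕ using (ℕ; zero; suc; z≤n; s≤s)
  import Data.Nat.Properties as ℕₚ
  open import Data.Nat.Coprimality as Coprimality using (Coprime)
  open import Data.Nat.Divisibility using (_∣_; ∣m+n∣m⇒∣n; ∣m⇒∣m*n; ∣n⇒∣m*n; ∣1⇒≡1)
  open import Data.Integer using () renaming (+_ to pos)
  open import Data.Bool using (Bool; true; false; not; _∧_)
  open import Data.Fin as Fin using (Fin; zero; suc; toℕ; remQuot)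
  open import Data.Fin.Permutation using (Permutation′; transpose)
  open import Data.Fin.Patterns
  open import Data.Fin.Properties using (toℕ-fromℕ<)
  open import Data.List.Properties using (map-cong)
  open import Relation.Nullary.Decidable using (dec-true)
  open import Data.Vec as Vec using (Vec; []; _∷_; replicate)
  open import Data.Vec.Properties using (tabulate∘lookup; ≡-dec)
  open import Data.Rational using (ℚ; 0ℚ; 1ℚ; ½; mkℚ; 1/_; ∣_∣; _+_; _*_; _-_; -_; _≤_; _<_; Positive; NonZero; nonNegative; nonPositive; positive)
  open import Data.Rational.Properties
  open import Data.Rational.Solver using (module +-*-Solver)
  open import Data.List as List using (List; []; _∷_)
  open import Data.List.NonEmpty using (_∷_)
  open import Data.Product using (∃; _×_; _,_; proj₁; proj₂; uncurry)
  open import Data.Sum using (inj₁; inj₂)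
  open import Relation.Nullary using (¬_)
  open import Relation.Binary.PropositionalEquality using (_≡_; refl; sym; trans; subst; subst₂; cong; cong₂; module ≡-Reasoning)
  open +-*-Solver using (solve; _:=_; _:+_; _:*_; _:-_; :-_; con)

  -- The number of leading `false` bits. Being total, it makes every letter with equal first two
  -- bits an instruction, so no letter is malformed.
  decode : ∀ {K} → Vec Bool K → Fin (suc K)
  decode []          = zero
  decode (true ∷ v)  = zero
  decode (false ∷ v) = suc (decode v)

  encode : ∀ {K} → Fin (suc K) → Vec Bool K
  encode {zero}  zero    = []
  encode {suc K} zero    = true ∷ replicate K false
  encode {suc K} (suc i) = false ∷ encode i

  decode-encode : ∀ {K} (i : Fin (suc K)) → decode (encode i) ≡ i
  decode-encode {zero}  zero    = refl
  decode-encode {suc K} zero    = refl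
  decode-encode {suc K} (suc i) = cong suc (decode-encode i)

  flip : ∀ {K} → Letter (2 ℕ.+ K) → Letter (2 ℕ.+ K)
  flip (a ∷ b ∷ v) = b ∷ a ∷ v

  swap₀₁ : ∀ {K} → Permutation′ (2 ℕ.+ K)
  swap₀₁ = transpose zero (suc zero)

  permLetter-swap : ∀ {K} (a : Letter (2 ℕ.+ K)) → permLetter swap₀₁ a ≡ flip a
  permLetter-swap (a ∷ b ∷ v) = cong (λ v → b ∷ a ∷ v) (tabulate∘lookup v)

  +-nonneg : ∀ {p q} → 0ℚ ≤ p → 0ℚ ≤ q → 0ℚ ≤ p + q
  +-nonneg = +-mono-≤

  data Kind (K : ℕ) : Set where
    op        : Fin (suc K) → Kind K
    end₁ end₂ : Kind K

  -- The permutation swaps the first two propositions: letters on which they agree are fixed, and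
  -- the two kinds of end letters are exchanged.
  kind : ∀ {K} → Letter (2 ℕ.+ K) → Kind K
  kind (true  ∷ false ∷ v) = end₁
  kind (false ∷ true  ∷ v) = end₂
  kind (true  ∷ true  ∷ v) = op (decode v)
  kind (false ∷ false ∷ v) = op (decode v)

  flipKind : ∀ {K} → Kind K → Kind K
  flipKind (op a) = op a
  flipKind end₁   = end₂
  flipKind end₂   = end₁

  kind-flip : ∀ {K} (a : Letter (2 ℕ.+ K)) → kind (flip a) ≡ flipKind (kind a)
  kind-flip (true  ∷ false ∷ v) = refl
  kind-flip (false ∷ true  ∷ v) = refl
  kind-flip (true  ∷ true  ∷ v) = refl
  kind-flip (false ∷ false ∷ v) = refl

  -- Recognizes the one letter that loads the input. It is fixed by the permutation, and
  -- `allLetters` lists it first, so the varying row precedes the constant ones in the code.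
  allFalse : ∀ {k} → Letter k → Bool
  allFalse []      = true
  allFalse (b ∷ v) = not b ∧ allFalse v

  allFalse-flip : ∀ {K} (a : Letter (2 ℕ.+ K)) → allFalse (flip a) ≡ allFalse a
  allFalse-flip (true  ∷ false ∷ v) = refl
  allFalse-flip (false ∷ true  ∷ v) = refl
  allFalse-flip (true  ∷ true  ∷ v) = refl
  allFalse-flip (false ∷ false ∷ v) = refl

  allFalse-replicate : ∀ k → allFalse (replicate k false) ≡ true
  allFalse-replicate zero    = refl
  allFalse-replicate (suc k) = allFalse-replicate k

  -- All states emit constant letters, which every permutation fixes; hence the output side of a
  -- word and of its image impose the same conditions.
  is : ∀ {k} → Bool → Letter k → ℚ
  is {k} c b = indicator (replicate k c ≟ᴸ b)

  is-flip : ∀ {K} c (b : Letter (2 ℕ.+ K)) → is c (flip b) ≡ is c b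
  is-flip true  (true  ∷ true  ∷ v) = refl
  is-flip true  (true  ∷ false ∷ v) = refl
  is-flip true  (false ∷ true  ∷ v) = refl
  is-flip true  (false ∷ false ∷ v) = refl
  is-flip false (true  ∷ true  ∷ v) = refl
  is-flip false (true  ∷ false ∷ v) = refl
  is-flip false (false ∷ true  ∷ v) = refl
  is-flip false (false ∷ false ∷ v) = refl

  module Reduction {K D : ℕ} (code : Fin (suc K) → Instr) (2<D : 2 ℕ.< D)
                   (bounded : ∀ a → Bounded D (code a)) where

    1<D : 1 ℕ.< D
    1<D = ℕₚ.<-trans (s≤s (s≤s z≤n)) 2<D

    open Value code 1<D bounded public

    Ix : Set
    Ix = Fin D

    ΣΣ : (Ix → Ix → ℚ) → ℚ
    ΣΣ f = sumFin λ i → sumFin λ j → f i j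

    ΣΣ-nonneg : (f : Ix → Ix → ℚ) → (∀ i j → 0ℚ ≤ f i j) → 0ℚ ≤ ΣΣ f
    ΣΣ-nonneg f p = sum-nonneg λ i → sum-nonneg (p i)

    i₀ i₂ : Ix
    i₀ = Fin.fromℕ< (ℕₚ.<-trans (s≤s z≤n) 2<D)
    i₂ = Fin.fromℕ< 2<D

    two-nonneg : 0ℚ ≤ two
    two-nonneg = +-mono-≤ 0≤1 0≤1

    row-nonneg : ∀ L i → 0ℚ ≤ row {D} L i
    row-nonneg L i = coef-nonneg L (toℕ i)

    row*row : ∀ L L' i j → 0ℚ ≤ row {D} L i * row {D} L' j
    row*row L L' i j = *-nonneg (row-nonneg L i) (row-nonneg L' j)

    test⁺-nonneg : ∀ a i j → 0ℚ ≤ test⁺ a i j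
    test⁺-nonneg a i j = +-nonneg
      (+-nonneg (row*row (lhs₁ (code a)) (lhs₁ (code a)) i j) (row*row (rhs₁ (code a)) (rhs₁ (code a)) i j))
      (+-nonneg (row*row (lhs₂ (code a)) (lhs₂ (code a)) i j) (row*row (rhs₂ (code a)) (rhs₂ (code a)) i j))

    test⁻-nonneg : ∀ a i j → 0ℚ ≤ test⁻ a i j
    test⁻-nonneg a i j = +-nonneg
      (*-nonneg two-nonneg (row*row (lhs₁ (code a)) (rhs₁ (code a)) i j))
      (*-nonneg two-nonneg (row*row (lhs₂ (code a)) (rhs₂ (code a)) i j))

    final⁺-nonneg : ∀ i j → 0ℚ ≤ final⁺ i j
    final⁺-nonneg i j = *-nonneg two-nonneg (row*row (1 ∷ []) (0 ∷ []) i j)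

    final⁻-nonneg : ∀ i j → 0ℚ ≤ final⁻ i j
    final⁻-nonneg i j = row*row (1 ∷ []) (1 ∷ []) i j

    weight : Fin (suc K) → Ix → Ix → ℚ
    weight a i j = test⁺ a i j + (test⁻ a i j + ΣΣ (λ k l → upd# a k i * upd# a l j))

    weight-nonneg : ∀ a i j → 0ℚ ≤ weight a i j
    weight-nonneg a i j = +-nonneg (test⁺-nonneg a i j) (+-nonneg (test⁻-nonneg a i j)
      (ΣΣ-nonneg (λ k l → upd# a k i * upd# a l j) λ k l → row*row (upd (code a) (toℕ k)) (upd (code a) (toℕ l)) i j))

    -- A crude common bound on the unscaled mass leaving a moment state under any letter. The
    -- summand 1 ensures ρ ≤ 1, as the rows of `e⁺` and `e⁻` require.
    bound : ℚ
    bound = 1ℚ + (ΣΣ final⁺ + (ΣΣ final⁻ + sumFin (λ a → ΣΣ (weight a))))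

    ΣΣ-term : (f : Ix → Ix → ℚ) → (∀ i j → 0ℚ ≤ f i j) → ∀ i j → f i j ≤ ΣΣ f
    ΣΣ-term f p i j = ≤-trans (term≤sum (f i) (p i) j) (term≤sum (λ i → sumFin (f i)) (λ i → sum-nonneg (p i)) i)

    private
      0≤F⁺ = ΣΣ-nonneg final⁺ final⁺-nonneg
      0≤F⁻ = ΣΣ-nonneg final⁻ final⁻-nonneg
      0≤W : 0ℚ ≤ sumFin (λ a → ΣΣ (weight a))
      0≤W = sum-nonneg λ a → ΣΣ-nonneg (weight a) (weight-nonneg a)

      ≤+ˡ : ∀ {p q r} → p ≤ q → 0ℚ ≤ r → p ≤ q + r
      ≤+ˡ {p} {q} {r} p≤q 0≤r = subst (_≤ q + r) (+-identityʳ p) (+-mono-≤ p≤q 0≤r)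

      ≤+ʳ : ∀ {p q r} → p ≤ q → 0ℚ ≤ r → p ≤ r + q
      ≤+ʳ {p} {q} {r} p≤q 0≤r = subst (_≤ r + q) (+-identityˡ p) (+-mono-≤ 0≤r p≤q)

    final⁺≤bound : ∀ i j → final⁺ i j ≤ bound
    final⁺≤bound i j = ≤+ʳ (≤+ˡ (ΣΣ-term final⁺ final⁺-nonneg i j) (+-nonneg 0≤F⁻ 0≤W)) 0≤1

    final⁻≤bound : ∀ i j → final⁻ i j ≤ bound
    final⁻≤bound i j = ≤+ʳ (≤+ʳ (≤+ˡ (ΣΣ-term final⁻ final⁻-nonneg i j) 0≤W) 0≤F⁺) 0≤1

    weight≤bound : ∀ a i j → weight a i j ≤ bound
    weight≤bound a i j = ≤+ʳ (≤+ʳ (≤+ʳ (≤-trans (ΣΣ-term (weight a) (weight-nonneg a) i j)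
      (term≤sum (λ a → ΣΣ (weight a)) (λ a → ΣΣ-nonneg (weight a) (weight-nonneg a)) a)) 0≤F⁻) 0≤F⁺) 0≤1

    1≤bound : 1ℚ ≤ bound
    1≤bound = ≤+ˡ ≤-refl (+-nonneg 0≤F⁺ (+-nonneg 0≤F⁻ 0≤W))

    opaque
      scale : ∃ λ ρ → 0ℚ < ρ × (∀ {p} → p ≤ bound → ρ * p ≤ 1ℚ)
      scale = 1/ bound , positive⁻¹ (1/ bound) {{ρ>0}} ,
              λ {p} p≤ → subst (1/ bound * p ≤_) (*-inverseˡ bound) (*-monoˡ-≤-nonNeg (1/ bound) {{pos⇒nonNeg (1/ bound) {{ρ>0}}}} p≤)
        where
        instance
          bound>0 : Positive bound
          bound>0 = positive (<-≤-trans (positive⁻¹ 1ℚ) 1≤bound)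
          bound≢0 : NonZero bound
          bound≢0 = pos⇒nonZero bound
        ρ>0 : Positive (1/ bound)
        ρ>0 = 1/pos⇒pos bound

    ρ : ℚ
    ρ = proj₁ scale

    ρ>0 : 0ℚ < ρ
    ρ>0 = proj₁ (proj₂ scale)

    0≤ρ : 0ℚ ≤ ρ
    0≤ρ = <⇒≤ ρ>0

    ρ*≤1 : ∀ {p} → p ≤ bound → ρ * p ≤ 1ℚ
    ρ*≤1 = proj₂ (proj₂ scale)

    -- A subprobability row; `spread` sends the missing mass to `sink`.
    record Row : Set where
      constructor mkRow
      field
        toA toAcc to⁺ to⁻ : ℚ
        toM               : Ix → Ix → ℚ

      total : ℚ
      total = toA + (toAcc + (to⁺ + (to⁻ + ΣΣ toM)))

    open Row

    accRow : ℚ → Row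
    accRow p = mkRow 0ℚ p 0ℚ 0ℚ (λ _ _ → 0ℚ)

    ΣΣ-0 : ΣΣ (λ _ _ → 0ℚ) ≡ 0ℚ
    ΣΣ-0 = trans (sum-cong {D} λ _ → sum-0 D) (sum-0 D)

    data Live : Set where
      A sink acc e⁺ e⁻ : Live
      m                : Ix → Ix → Live

    -- The states `e⁺` and `e⁻` decay by ρ at each instruction, so that errors recorded at different
    -- times keep the current scale of the moments. One end letter collects `final⁺` and `e⁻`, the
    -- other `final⁻` and `e⁺`; up to scale the difference is the value.
    rowOf : Live → Kind K → Row
    rowOf A       (op a) = mkRow 1ℚ 0ℚ 0ℚ 0ℚ (λ _ _ → 0ℚ)
    rowOf A       end₁   = accRow 1ℚ
    rowOf A       end₂   = accRow 0ℚ
    rowOf sink    _      = accRow 0ℚ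
    rowOf acc     _      = accRow 1ℚ
    rowOf e⁺      (op a) = mkRow 0ℚ 0ℚ ρ 0ℚ (λ _ _ → 0ℚ)
    rowOf e⁺      end₁   = accRow 0ℚ
    rowOf e⁺      end₂   = accRow ρ
    rowOf e⁻      (op a) = mkRow 0ℚ 0ℚ 0ℚ ρ (λ _ _ → 0ℚ)
    rowOf e⁻      end₁   = accRow ρ
    rowOf e⁻      end₂   = accRow 0ℚ
    rowOf (m i j) (op a) = mkRow 0ℚ 0ℚ (ρ * test⁺ a i j) (ρ * test⁻ a i j) (λ k l → ρ * (upd# a k i * upd# a l j))
    rowOf (m i j) end₁   = accRow (ρ * final⁺ i j)
    rowOf (m i j) end₂   = accRow (ρ * final⁻ i j)

    record Stochastic (r : Row) : Set where
      field
        0≤A   : 0ℚ ≤ toA r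
        0≤Acc : 0ℚ ≤ toAcc r
        0≤⁺   : 0ℚ ≤ to⁺ r
        0≤⁻   : 0ℚ ≤ to⁻ r
        0≤M   : ∀ i j → 0ℚ ≤ toM r i j
        tot≤1 : total r ≤ 1ℚ

    zeros : ∀ p q r s → p + (q + (r + (s + ΣΣ (λ _ _ → 0ℚ)))) ≡ p + (q + (r + s))
    zeros p q r s = cong (λ z → p + (q + (r + z))) (trans (cong (s +_) ΣΣ-0) (+-identityʳ s))

    accRow-stochastic : ∀ {p} → 0ℚ ≤ p → p ≤ 1ℚ → Stochastic (accRow p)
    accRow-stochastic {p} 0≤p p≤1 = record
      { 0≤A = ≤-refl ; 0≤Acc = 0≤p ; 0≤⁺ = ≤-refl ; 0≤⁻ = ≤-refl ; 0≤M = λ _ _ → ≤-refl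
      ; tot≤1 = subst (_≤ 1ℚ) (sym (trans (zeros 0ℚ p 0ℚ 0ℚ) (trans (+-identityˡ _) (+-identityʳ p)))) p≤1 }

    ρ≤1 : ρ ≤ 1ℚ
    ρ≤1 = subst (_≤ 1ℚ) (*-identityʳ ρ) (ρ*≤1 1≤bound)

    rowOf-stochastic : ∀ l c → Stochastic (rowOf l c)
    rowOf-stochastic A (op a) = record
      { 0≤A = 0≤1 ; 0≤Acc = ≤-refl ; 0≤⁺ = ≤-refl ; 0≤⁻ = ≤-refl ; 0≤M = λ _ _ → ≤-refl
      ; tot≤1 = ≤-reflexive (zeros 1ℚ 0ℚ 0ℚ 0ℚ) }
    rowOf-stochastic A end₁ = accRow-stochastic 0≤1 ≤-refl
    rowOf-stochastic A end₂ = accRow-stochastic ≤-refl 0≤1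
    rowOf-stochastic sink _ = accRow-stochastic ≤-refl 0≤1
    rowOf-stochastic acc _  = accRow-stochastic 0≤1 ≤-refl
    rowOf-stochastic e⁺ (op a) = record
      { 0≤A = ≤-refl ; 0≤Acc = ≤-refl ; 0≤⁺ = 0≤ρ ; 0≤⁻ = ≤-refl ; 0≤M = λ _ _ → ≤-refl
      ; tot≤1 = subst (_≤ 1ℚ) (sym (trans (zeros 0ℚ 0ℚ ρ 0ℚ) (solve 1 (λ x → con 0ℚ :+ (con 0ℚ :+ (x :+ con 0ℚ)) := x) refl ρ))) ρ≤1 }
    rowOf-stochastic e⁺ end₁ = accRow-stochastic ≤-refl 0≤1
    rowOf-stochastic e⁺ end₂ = accRow-stochastic 0≤ρ ρ≤1
    rowOf-stochastic e⁻ (op a) = record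
      { 0≤A = ≤-refl ; 0≤Acc = ≤-refl ; 0≤⁺ = ≤-refl ; 0≤⁻ = 0≤ρ ; 0≤M = λ _ _ → ≤-refl
      ; tot≤1 = subst (_≤ 1ℚ) (sym (trans (zeros 0ℚ 0ℚ 0ℚ ρ) (solve 1 (λ x → con 0ℚ :+ (con 0ℚ :+ (con 0ℚ :+ x)) := x) refl ρ))) ρ≤1 }
    rowOf-stochastic e⁻ end₁ = accRow-stochastic 0≤ρ ρ≤1
    rowOf-stochastic e⁻ end₂ = accRow-stochastic ≤-refl 0≤1
    rowOf-stochastic (m i j) (op a) = record
      { 0≤A = ≤-refl ; 0≤Acc = ≤-refl
      ; 0≤⁺ = *-nonneg 0≤ρ (test⁺-nonneg a i j) ; 0≤⁻ = *-nonneg 0≤ρ (test⁻-nonneg a i j)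
      ; 0≤M = λ k l → *-nonneg 0≤ρ (row*row (upd (code a) (toℕ k)) (upd (code a) (toℕ l)) i j)
      ; tot≤1 = subst (_≤ 1ℚ) (sym total≡) (ρ*≤1 (weight≤bound a i j)) }
      where
      total≡ : total (rowOf (m i j) (op a)) ≡ ρ * weight a i j
      total≡ = trans
        (cong (λ z → 0ℚ + (0ℚ + (ρ * test⁺ a i j + (ρ * test⁻ a i j + z))))
          (trans (sum-cong λ k → sum-*ˡ ρ (λ l → upd# a k i * upd# a l j)) (sum-*ˡ ρ (λ k → sumFin λ l → upd# a k i * upd# a l j))))
        (solve 4 (λ r x y z → con 0ℚ :+ (con 0ℚ :+ (r :* x :+ (r :* y :+ r :* z))) := r :* (x :+ (y :+ z))) refl
          ρ (test⁺ a i j) (test⁻ a i j) (ΣΣ λ k l → upd# a k i * upd# a l j))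
    rowOf-stochastic (m i j) end₁ = accRow-stochastic (*-nonneg 0≤ρ (final⁺-nonneg i j)) (ρ*≤1 (final⁺≤bound i j))
    rowOf-stochastic (m i j) end₂ = accRow-stochastic (*-nonneg 0≤ρ (final⁻-nonneg i j)) (ρ*≤1 (final⁻≤bound i j))

    -- States 2, …, 5 duplicate the moments of the registers 0 and 2, so that the only row depending on
    -- the input has its varying entries at the front.
    States : ℕ
    States = 10 ℕ.+ D ℕ.* D

    view : Fin (9 ℕ.+ D ℕ.* D) → Live
    view zero                                                      = A
    view (suc zero)                                                = m i₀ i₀
    view (suc (suc zero))                                          = m i₀ i₂
    view (suc (suc (suc zero)))                                    = m i₂ i₀
    view (suc (suc (suc (suc zero))))                              = m i₂ i₂
    view (suc (suc (suc (suc (suc zero)))))                        = sink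
    view (suc (suc (suc (suc (suc (suc zero))))))                  = acc
    view (suc (suc (suc (suc (suc (suc (suc zero)))))))            = e⁺
    view (suc (suc (suc (suc (suc (suc (suc (suc zero))))))))      = e⁻
    view (suc (suc (suc (suc (suc (suc (suc (suc (suc q)))))))))   = uncurry m (remQuot {D} D q)

    spread : Row → Fin States → ℚ
    spread r zero                                                          = 0ℚ
    spread r (suc zero)                                                    = toA r
    spread r (suc (suc zero))                                              = 0ℚ
    spread r (suc (suc (suc zero)))                                        = 0ℚ
    spread r (suc (suc (suc (suc zero))))                                  = 0ℚ
    spread r (suc (suc (suc (suc (suc zero)))))                            = 0ℚ
    spread r (suc (suc (suc (suc (suc (suc zero))))))                      = 1ℚ - total r
    spread r (suc (suc (suc (suc (suc (suc (suc zero)))))))                = toAcc r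
    spread r (suc (suc (suc (suc (suc (suc (suc (suc zero))))))))          = to⁺ r
    spread r (suc (suc (suc (suc (suc (suc (suc (suc (suc zero)))))))))    = to⁻ r
    spread r (suc (suc (suc (suc (suc (suc (suc (suc (suc (suc q)))))))))) = uncurry (toM r) (remQuot {D} D q)

    spread-nonneg : ∀ {r} → Stochastic r → ∀ q → 0ℚ ≤ spread r q
    spread-nonneg S zero = ≤-refl
    spread-nonneg S (suc zero) = Stochastic.0≤A S
    spread-nonneg S (suc (suc zero)) = ≤-refl
    spread-nonneg S (suc (suc (suc zero))) = ≤-refl
    spread-nonneg S (suc (suc (suc (suc zero)))) = ≤-refl
    spread-nonneg S (suc (suc (suc (suc (suc zero))))) = ≤-refl
    spread-nonneg {r} S (suc (suc (suc (suc (suc (suc zero)))))) =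
      subst (_≤ 1ℚ - total r) (+-inverseʳ (total r)) (+-monoˡ-≤ (- total r) (Stochastic.tot≤1 S))
    spread-nonneg S (suc (suc (suc (suc (suc (suc (suc zero))))))) = Stochastic.0≤Acc S
    spread-nonneg S (suc (suc (suc (suc (suc (suc (suc (suc zero)))))))) = Stochastic.0≤⁺ S
    spread-nonneg S (suc (suc (suc (suc (suc (suc (suc (suc (suc zero))))))))) = Stochastic.0≤⁻ S
    spread-nonneg S (suc (suc (suc (suc (suc (suc (suc (suc (suc (suc q)))))))))) = Stochastic.0≤M S _ _

    spread-sum : ∀ r → sumFin (spread r) ≡ 1ℚ
    spread-sum r = trans
      (cong (λ z → 0ℚ + (toA r + (0ℚ + (0ℚ + (0ℚ + (0ℚ + ((1ℚ - total r) + (toAcc r + (to⁺ r + (to⁻ r + z))))))))))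
        (sum-remQuot D D (uncurry (toM r))))
      (solve 5 (λ a c p n z →
         con 0ℚ :+ (a :+ (con 0ℚ :+ (con 0ℚ :+ (con 0ℚ :+ (con 0ℚ :+ ((con 1ℚ :- (a :+ (c :+ (p :+ (n :+ z))))) :+ (c :+ (p :+ (n :+ z)))))))))
           := con 1ℚ)
         refl (toA r) (toAcc r) (to⁺ r) (to⁻ r) (ΣΣ (toM r)))

    output : Live → Bool
    output sink = true
    output _    = false

    -- One step of the probability recursion for the continuation `h`: β and σ say whether the
    -- output letter is all false or all true, and only `sink` emits the latter.
    apply : Row → (β σ : ℚ) → (Live → ℚ) → ℚ
    apply r β σ h =
      β * (toA r * h A + (toAcc r * h acc + (to⁺ r * h e⁺ + (to⁻ r * h e⁻ + ΣΣ (λ i j → toM r i j * h (m i j)))))) +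
      σ * ((1ℚ - total r) * h sink)

    k : ℕ
    k = 2 ℕ.+ K

    stateLabel : Fin States → Letter k
    stateLabel zero    = replicate k false
    stateLabel (suc q) = replicate k (output (view q))

    sum-spread : ∀ r b (f : Fin States → ℚ) (h : Live → ℚ) → (∀ q → f (suc q) ≡ h (view q)) →
      sumFin (λ q → spread r q * (indicator (stateLabel q ≟ᴸ b) * f q)) ≡ apply r (is false b) (is true b) h
    sum-spread r b f h e = begin
      sumFin (λ q → spread r q * (indicator (stateLabel q ≟ᴸ b) * f q))
        ≡⟨ cong₂ _+_ (*-zeroˡ (β * f zero)) (sum-cong λ q → cong (λ v → spread r (suc q) * (indicator (stateLabel (suc q) ≟ᴸ b) * v)) (e q)) ⟩
      0ℚ + (toA r * (β * h A) + (0ℚ * (β * h (m i₀ i₀)) + (0ℚ * (β * h (m i₀ i₂)) + (0ℚ * (β * h (m i₂ i₀)) + (0ℚ * (β * h (m i₂ i₂)) + (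
        (1ℚ - total r) * (σ * h sink) + (toAcc r * (β * h acc) + (to⁺ r * (β * h e⁺) + (to⁻ r * (β * h e⁻) +
          sumFin (λ q → moment (remQuot {D} D q)))))))))))
        ≡⟨ cong (λ z → 0ℚ + (toA r * (β * h A) + z)) (cong₂ _+_ (*-zeroˡ (β * h (m i₀ i₀))) (cong₂ _+_ (*-zeroˡ (β * h (m i₀ i₂)))
             (cong₂ _+_ (*-zeroˡ (β * h (m i₂ i₀))) (cong₂ _+_ (*-zeroˡ (β * h (m i₂ i₂)))
             (cong (λ z → (1ℚ - total r) * (σ * h sink) + (toAcc r * (β * h acc) + (to⁺ r * (β * h e⁺) + (to⁻ r * (β * h e⁻) + z))))
               moments))))) ⟩
      0ℚ + (toA r * (β * h A) + (0ℚ + (0ℚ + (0ℚ + (0ℚ + (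
        (1ℚ - total r) * (σ * h sink) + (toAcc r * (β * h acc) + (to⁺ r * (β * h e⁺) + (to⁻ r * (β * h e⁻) + β * ΣΣ (λ i j → toM r i j * h (m i j)))))))))))
        ≡⟨ regroup (toA r) (h A) (1ℚ - total r) (h sink) (toAcc r) (h acc) (to⁺ r) (h e⁺) (to⁻ r) (h e⁻) β σ (ΣΣ (λ i j → toM r i j * h (m i j))) ⟩
      apply r β σ h ∎
      where
      open ≡-Reasoning
      β = is false b
      σ = is true b
      moment : Ix × Ix → ℚ
      moment p = uncurry (toM r) p * (β * h (uncurry m p))
      moments : sumFin (λ q → moment (remQuot {D} D q)) ≡ β * ΣΣ (λ i j → toM r i j * h (m i j))
      moments = trans (sum-remQuot D D moment) (trans
        (sum-cong λ i → trans
          (sum-cong λ j → solve 3 (λ x y z → x :* (y :* z) := y :* (x :* z)) refl (toM r i j) β (h (m i j)))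
          (sum-*ˡ β (λ j → toM r i j * h (m i j))))
        (sum-*ˡ β (λ i → sumFin λ j → toM r i j * h (m i j))))
      regroup : ∀ a hA s hs c hc p hp n hn β σ z →
        0ℚ + (a * (β * hA) + (0ℚ + (0ℚ + (0ℚ + (0ℚ + (s * (σ * hs) + (c * (β * hc) + (p * (β * hp) + (n * (β * hn) + β * z))))))))) ≡
        β * (a * hA + (c * hc + (p * hp + (n * hn + z)))) + σ * (s * hs)
      regroup = solve 13 (λ a hA s hs c hc p hp n hn β σ z →
        con 0ℚ :+ (a :* (β :* hA) :+ (con 0ℚ :+ (con 0ℚ :+ (con 0ℚ :+ (con 0ℚ :+ (s :* (σ :* hs) :+ (c :* (β :* hc) :+ (p :* (β :* hp) :+ (n :* (β :* hn) :+ β :* z))))))))) :=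
        β :* (a :* hA :+ (c :* hc :+ (p :* hp :+ (n :* hn :+ z)))) :+ σ :* (s :* hs)) refl

    -- State 0 is never re-entered and a duplicated moment state behaves like its original, so these
    -- probabilities are independent of the input.
    pr : Live → List (Letter k) → List (Letter k) → ℚ
    pr l []      []      = 1ℚ
    pr l []      (_ ∷ _) = 0ℚ
    pr l (_ ∷ _) []      = 0ℚ
    pr l (a ∷ x) (b ∷ y) = apply (rowOf l (kind a)) (is false b) (is true b) (λ l → pr l x y)

    -- The initial distribution: half of the mass on A, the other half proportional to the second
    -- moments 1, n, n, n² of the registers (1 , n), that is, with denominator 2 (n + 1)².  As n is odd,
    -- all fractions are in lowest terms.

    input : ℕ → ℕ
    input t = suc (2 ℕ.* t)

    denom-1 : ℕ → ℕ
    denom-1 n = suc (2 ℕ.* (n ℕ.* (2 ℕ.+ n)))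

    coprime-input : ∀ t → Coprime (input t) (suc (denom-1 (input t)))
    coprime-input t {d} (d∣n , d∣M) = ∣1⇒≡1 (∣m+n∣m⇒∣n (subst (d ∣_) (ℕₚ.+-comm 1 (2 ℕ.* t)) d∣n) (∣m⇒∣m*n t d∣2))
      where
      n = input t
      d∣2 : d ∣ 2
      d∣2 = ∣m+n∣m⇒∣n (subst (d ∣_) (ℕₚ.+-comm 2 (2 ℕ.* (n ℕ.* (2 ℕ.+ n)))) d∣M) (∣n⇒∣m*n 2 (∣m⇒∣m*n (2 ℕ.+ n) d∣n))

    initial : ℕ → Fin States → ℚ
    initial t zero                                   = 0ℚ
    initial t (suc zero)                             = ½
    initial t (suc (suc zero))                       = mkℚ (pos 1) (denom-1 (input t)) (Coprimality.1-coprimeTo _)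
    initial t (suc (suc (suc zero)))                 = mkℚ (pos (input t)) (denom-1 (input t)) (coprime-input t)
    initial t (suc (suc (suc (suc zero))))           = mkℚ (pos (input t)) (denom-1 (input t)) (coprime-input t)
    initial t (suc (suc (suc (suc (suc zero)))))     =
      mkℚ (pos (input t ℕ.* input t)) (denom-1 (input t)) (coprime-* (coprime-input t) (coprime-input t))
    initial t (suc (suc (suc (suc (suc (suc _))))))  = 0ℚ

    module _ (t : ℕ) where

      private
        ν = ι (input t)

      κ : ℚ
      κ = mkℚ (pos 1) (denom-1 (input t)) (Coprimality.1-coprimeTo _)

      κ-unit : κ * (1ℚ + (1ℚ + two * (ν * (two + ν)))) ≡ 1ℚ
      κ-unit = trans (cong (κ *_) (cong (λ z → 1ℚ + (1ℚ + z)) (sym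
        (trans (ι-* 2 (input t ℕ.* (2 ℕ.+ input t))) (cong (two *_) (trans (ι-* (input t) (2 ℕ.+ input t)) (cong (ν *_) (ι-+ 2 (input t)))))))))
        (mkℚ*ι 1 (denom-1 (input t)) (Coprimality.1-coprimeTo _))

      0≤κ : 0ℚ ≤ κ
      0≤κ = nonNegative⁻¹ κ

      initial₁ : initial t (suc (suc (suc zero))) ≡ ν * κ
      initial₁ = mkℚ-scale (input t) (denom-1 (input t)) (coprime-input t) (Coprimality.1-coprimeTo _)

      initial₂ : initial t (suc (suc (suc (suc (suc zero))))) ≡ (ν * ν) * κ
      initial₂ = trans (mkℚ-scale (input t ℕ.* input t) (denom-1 (input t)) _ (Coprimality.1-coprimeTo _)) (cong (_* κ) (ι-* (input t) (input t)))

      initial-nonneg : ∀ q → 0ℚ ≤ initial t q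
      initial-nonneg zero                                  = ≤-refl
      initial-nonneg (suc zero)                            = nonNegative⁻¹ ½
      initial-nonneg (suc (suc zero))                      = 0≤κ
      initial-nonneg (suc (suc (suc zero)))                = nonNegative⁻¹ (initial t (suc (suc (suc zero))))
      initial-nonneg (suc (suc (suc (suc zero))))          = nonNegative⁻¹ (initial t (suc (suc (suc zero))))
      initial-nonneg (suc (suc (suc (suc (suc zero)))))    = nonNegative⁻¹ (initial t (suc (suc (suc (suc (suc zero))))))
      initial-nonneg (suc (suc (suc (suc (suc (suc _)))))) = ≤-refl

      half : κ + (ν * κ + (ν * κ + (ν * ν) * κ)) ≡ ½
      half = trans
        (solve 2 (λ x k → k :+ (x :* k :+ (x :* k :+ (x :* x) :* k)) := con ½ :* (k :* (con 1ℚ :+ (con 1ℚ :+ con two :* (x :* (con two :+ x)))))) refl ν κ)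
        (trans (cong (½ *_) κ-unit) (*-identityʳ ½))

      initial-sum : sumFin (initial t) ≡ 1ℚ
      initial-sum = begin
        0ℚ + (½ + (κ + (initial t (suc (suc (suc zero))) + (initial t (suc (suc (suc zero))) + (initial t (suc (suc (suc (suc (suc zero))))) + sumFin {4 ℕ.+ D ℕ.* D} (λ _ → 0ℚ))))))
          ≡⟨ cong (λ z → 0ℚ + (½ + (κ + z))) (cong₂ _+_ initial₁ (cong₂ _+_ initial₁ (cong₂ _+_ initial₂ (sum-0 (4 ℕ.+ D ℕ.* D))))) ⟩
        0ℚ + (½ + (κ + (ν * κ + (ν * κ + ((ν * ν) * κ + 0ℚ)))))
          ≡⟨ cong (λ z → 0ℚ + (½ + (κ + (ν * κ + (ν * κ + z))))) (+-identityʳ _) ⟩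
        0ℚ + (½ + (κ + (ν * κ + (ν * κ + (ν * ν) * κ))))
          ≡⟨ cong (λ z → 0ℚ + (½ + z)) half ⟩
        1ℚ ∎
        where open ≡-Reasoning

      startRow : Bool → Fin States → ℚ
      startRow true  = initial t
      startRow false = spread (accRow 0ℚ)

      trans-δ : Fin States → Letter k → Fin States → ℚ
      trans-δ zero    a = startRow (allFalse a)
      trans-δ (suc q) a = spread (rowOf (view q) (kind a))

      𝒯 : Transducer k States
      𝒯 = record
        { s₀ = zero
        ; δ = trans-δ
        ; δ-nonneg = nonneg
        ; δ-sum = sums
        ; ℓ = stateLabel
        }
        where
        nonneg : ∀ q a q' → 0ℚ ≤ trans-δ q a q'
        nonneg zero a with allFalse a
        ... | true  = initial-nonneg
        ... | false = spread-nonneg (accRow-stochastic ≤-refl 0≤1)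
        nonneg (suc q) a = spread-nonneg (rowOf-stochastic (view q) (kind a))
        sums : ∀ q a → sumFin (trans-δ q a) ≡ 1ℚ
        sums zero a with allFalse a
        ... | true  = initial-sum
        ... | false = spread-sum (accRow 0ℚ)
        sums (suc q) a = spread-sum (rowOf (view q) (kind a))

      prob-pr : ∀ q x y → probFrom 𝒯 (suc q) x y ≡ pr (view q) x y
      prob-pr q []      []      = refl
      prob-pr q []      (_ ∷ _) = refl
      prob-pr q (_ ∷ _) []      = refl
      prob-pr q (a ∷ x) (b ∷ y) =
        sum-spread (rowOf (view q) (kind a)) b (λ q → probFrom 𝒯 q x y) (λ l → pr l x y) (λ q → prob-pr q x y)

    -- The gap between a word and its image.

    linear : Row → (Live → ℚ) → ℚ
    linear r d = toA r * d A + (toAcc r * d acc + (to⁺ r * d e⁺ + (to⁻ r * d e⁻ + ΣΣ (λ i j → toM r i j * d (m i j)))))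

    -- The factor σ accompanies only `sink`, where the perturbation `d` vanishes, so `d` is
    -- propagated with the factor β alone.
    apply-+ : ∀ r β σ {h h' d : Live → ℚ} → (∀ l → h l ≡ h' l + d l) → d sink ≡ 0ℚ →
              apply r β σ h ≡ apply r β σ h' + β * linear r d
    apply-+ r β σ {h} {h'} {d} e d≡0 = begin
      apply r β σ h
        ≡⟨ cong₂ (λ x y → β * x + σ * ((1ℚ - total r) * y))
             (cong₂ _+_ (cong (toA r *_) (e A)) (cong₂ _+_ (cong (toAcc r *_) (e acc)) (cong₂ _+_ (cong (to⁺ r *_) (e e⁺))
               (cong₂ _+_ (cong (to⁻ r *_) (e e⁻)) moments))))
             (trans (e sink) (trans (cong (h' sink +_) d≡0) (+-identityʳ (h' sink)))) ⟩
      β * (toA r * (h' A + d A) + (toAcc r * (h' acc + d acc) + (to⁺ r * (h' e⁺ + d e⁺) + (to⁻ r * (h' e⁻ + d e⁻) + (z' + z))))) +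
        σ * ((1ℚ - total r) * h' sink)
        ≡⟨ regroup (toA r) (h' A) (d A) (toAcc r) (h' acc) (d acc) (to⁺ r) (h' e⁺) (d e⁺) (to⁻ r) (h' e⁻) (d e⁻) z' z β
             (σ * ((1ℚ - total r) * h' sink)) ⟩
      apply r β σ h' + β * linear r d ∎
      where
      open ≡-Reasoning
      z' = ΣΣ (λ i j → toM r i j * h' (m i j))
      z = ΣΣ (λ i j → toM r i j * d (m i j))
      moments : ΣΣ (λ i j → toM r i j * h (m i j)) ≡ z' + z
      moments = trans
        (sum-cong λ i → trans
          (sum-cong λ j → trans (cong (toM r i j *_) (e (m i j))) (*-distribˡ-+ (toM r i j) (h' (m i j)) (d (m i j))))
          (sum-+ (λ j → toM r i j * h' (m i j)) (λ j → toM r i j * d (m i j))))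
        (sum-+ (λ i → sumFin λ j → toM r i j * h' (m i j)) (λ i → sumFin λ j → toM r i j * d (m i j)))
      regroup : ∀ a hA dA c hc dc p hp dp n hn dn z' z β s →
        β * (a * (hA + dA) + (c * (hc + dc) + (p * (hp + dp) + (n * (hn + dn) + (z' + z))))) + s ≡
        (β * (a * hA + (c * hc + (p * hp + (n * hn + z')))) + s) + β * (a * dA + (c * dc + (p * dp + (n * dn + z))))
      regroup = solve 16 (λ a hA dA c hc dc p hp dp n hn dn z' z β s →
        β :* (a :* (hA :+ dA) :+ (c :* (hc :+ dc) :+ (p :* (hp :+ dp) :+ (n :* (hn :+ dn) :+ (z' :+ z))))) :+ s :=
        (β :* (a :* hA :+ (c :* hc :+ (p :* hp :+ (n :* hn :+ z')))) :+ s) :+ β :* (a :* dA :+ (c :* dc :+ (p :* dp :+ (n :* dn :+ z))))) refl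

    apply-acc : ∀ p β σ h → apply (accRow p) β σ h ≡ β * (p * h acc) + σ * ((1ℚ - p) * h sink)
    apply-acc p β σ h = cong₂ (λ x y → β * x + σ * ((1ℚ - y) * h sink))
      (trans (cong (λ z → 0ℚ * h A + (p * h acc + (0ℚ * h e⁺ + (0ℚ * h e⁻ + z))))
               (trans (sum-cong λ i → sum-cong λ j → *-zeroˡ (h (m i j))) ΣΣ-0))
        (solve 5 (λ a p c e f → con 0ℚ :* a :+ (p :* c :+ (con 0ℚ :* e :+ (con 0ℚ :* f :+ con 0ℚ))) := p :* c) refl
          (h A) p (h acc) (h e⁺) (h e⁻)))
      (trans (zeros 0ℚ p 0ℚ 0ℚ) (trans (+-identityˡ _) (+-identityʳ p)))

    -- The base case is ρ because the end letter scales the moments once more.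
    ρ^ : List (Fin (suc K)) → ℚ
    ρ^ []      = ρ
    ρ^ (_ ∷ w) = ρ * ρ^ w

    ρ^>0 : ∀ w → 0ℚ < ρ^ w
    ρ^>0 []      = ρ>0
    ρ^>0 (_ ∷ w) = positive⁻¹ (ρ * ρ^ w) {{pos*pos⇒pos ρ {{positive ρ>0}} (ρ^ w) {{positive (ρ^>0 w)}}}}

    -- The excess, from each state, of the probability of a word over that of its image under π; w is the
    -- sequence of instructions before the first end letter.
    gap : ℚ → List (Fin (suc K)) → Live → ℚ
    gap τ w A       = τ
    gap τ w sink    = 0ℚ
    gap τ w acc     = 0ℚ
    gap τ w e⁺      = - (τ * ρ^ w)
    gap τ w e⁻      = τ * ρ^ w
    gap τ w (m i j) = (τ * ρ^ w) * Φ w i j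

    -- One scalar and one instruction sequence describe the gap from all states at once. The scalar
    -- collects the output conditions and everything after the first end letter.
    record Gap (x y : List (Letter k)) (τ : ℚ) (w : List (Fin (suc K))) : Set where
      constructor mkGap
      field gap-at : ∀ l → pr l x y ≡ pr l (List.map flip x) (List.map flip y) + gap τ w l

    open Gap

    gap-zero : ∀ l → gap 0ℚ [] l ≡ 0ℚ
    gap-zero A       = refl
    gap-zero sink    = refl
    gap-zero acc     = refl
    gap-zero e⁺      = cong -_ (*-zeroˡ ρ)
    gap-zero e⁻      = *-zeroˡ ρ
    gap-zero (m i j) = trans (cong (_* Φ [] i j) (*-zeroˡ ρ)) (*-zeroˡ (Φ [] i j))

    equal⇒Gap : ∀ {x y} → (∀ l → pr l x y ≡ pr l (List.map flip x) (List.map flip y)) → Gap x y 0ℚ []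
    equal⇒Gap {x} {y} e = mkGap λ l → trans (e l) (sym (trans (cong (pr l (List.map flip x) (List.map flip y) +_) (gap-zero l)) (+-identityʳ _)))

    ΣΣ-* : ∀ c (f : Ix → Ix → ℚ) → ΣΣ (λ i j → c * f i j) ≡ c * ΣΣ f
    ΣΣ-* c f = trans (sum-cong λ i → sum-*ˡ c (f i)) (sum-*ˡ c (λ i → sumFin (f i)))

    -- At the moment states this is the defining recursion of `Φ`: the pulled-back form arrives
    -- through the moments, `test⁻` through `e⁻`, and `- test⁺` through `e⁺`.
    linear-gap : ∀ a τ w l β → β * linear (rowOf l (op a)) (gap τ w) ≡ gap (β * τ) (a ∷ w) l
    linear-gap a τ w l β = go l
      where
      R = ρ^ w
      none : ∀ p q r s → ((p * τ) + (q * 0ℚ + (r * - (τ * R) + (s * (τ * R) + ΣΣ (λ i j → 0ℚ * ((τ * R) * Φ w i j))))))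
                         ≡ p * τ + (s - r) * (τ * R)
      none p q r s = trans
        (cong (λ z → p * τ + (q * 0ℚ + (r * - (τ * R) + (s * (τ * R) + z)))) (trans (ΣΣ-* 0ℚ (λ i j → (τ * R) * Φ w i j)) (*-zeroˡ (ΣΣ λ i j → (τ * R) * Φ w i j))))
        (solve 6 (λ p q r s t u → p :* t :+ (q :* con 0ℚ :+ (r :* (:- u) :+ (s :* u :+ con 0ℚ))) := p :* t :+ (s :- r) :* u) refl p q r s τ (τ * R))
      go : ∀ l → β * linear (rowOf l (op a)) (gap τ w) ≡ gap (β * τ) (a ∷ w) l
      go A = trans (cong (β *_) (none 1ℚ 0ℚ 0ℚ 0ℚ))
        (solve 3 (λ b t u → b :* (con 1ℚ :* t :+ (con 0ℚ :- con 0ℚ) :* u) := b :* t) refl β τ (τ * R))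
      go sink = trans (cong (β *_) (none 0ℚ 0ℚ 0ℚ 0ℚ))
        (solve 3 (λ b t u → b :* (con 0ℚ :* t :+ (con 0ℚ :- con 0ℚ) :* u) := con 0ℚ) refl β τ (τ * R))
      go acc = trans (cong (β *_) (none 0ℚ 1ℚ 0ℚ 0ℚ))
        (solve 3 (λ b t u → b :* (con 0ℚ :* t :+ (con 0ℚ :- con 0ℚ) :* u) := con 0ℚ) refl β τ (τ * R))
      go e⁺ = trans (cong (β *_) (none 0ℚ 0ℚ ρ 0ℚ))
        (solve 4 (λ b t u r → b :* (con 0ℚ :* t :+ (con 0ℚ :- r) :* (t :* u)) := :- ((b :* t) :* (r :* u))) refl β τ R ρ)
      go e⁻ = trans (cong (β *_) (none 0ℚ 0ℚ 0ℚ ρ))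
        (solve 4 (λ b t u r → b :* (con 0ℚ :* t :+ (r :- con 0ℚ) :* (t :* u)) := (b :* t) :* (r :* u)) refl β τ R ρ)
      go (m i j) = trans
        (cong (λ z → β * (0ℚ * τ + (0ℚ * 0ℚ + ((ρ * test⁺ a i j) * - (τ * R) + ((ρ * test⁻ a i j) * (τ * R) + z)))))
          (trans
            (sum-cong λ k → sum-cong λ l →
              solve 4 (λ r u v f → (r :* u) :* (v :* f) := (r :* v) :* (u :* f)) refl ρ (upd# a k i * upd# a l j) (τ * R) (Φ w k l))
            (ΣΣ-* (ρ * (τ * R)) (λ k l → (upd# a k i * upd# a l j) * Φ w k l))))
        (solve 7 (λ b t u r p n z →
            b :* (con 0ℚ :* t :+ (con 0ℚ :* con 0ℚ :+ ((r :* p) :* (:- (t :* u)) :+ ((r :* n) :* (t :* u) :+ (r :* (t :* u)) :* z))))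
            := ((b :* t) :* (r :* u)) :* (z :+ (n :- p))) refl
          β τ R ρ (test⁺ a i j) (test⁻ a i j) (ΣΣ λ k l → (upd# a k i * upd# a l j) * Φ w k l))

    Gap-op : ∀ {x y τ w} a b {i} → kind a ≡ op i → Gap x y τ w → Gap (a ∷ x) (b ∷ y) (is false b * τ) (i ∷ w)
    Gap-op {x} {y} {τ} {w} a b {i} e g = mkGap λ l → begin
      apply (rowOf l (kind a)) (is false b) (is true b) (λ l → pr l x y)
        ≡⟨ cong (λ c → apply (rowOf l c) (is false b) (is true b) (λ l → pr l x y)) e ⟩
      apply (rowOf l (op i)) (is false b) (is true b) (λ l → pr l x y)
        ≡⟨ apply-+ (rowOf l (op i)) (is false b) (is true b) {h' = h'} {gap τ w} (gap-at g) refl ⟩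
      apply (rowOf l (op i)) (is false b) (is true b) h' + is false b * linear (rowOf l (op i)) (gap τ w)
        ≡⟨ cong₂ _+_
             (trans (cong (λ c → apply (rowOf l c) (is false b) (is true b) h') (sym (trans (kind-flip a) (cong flipKind e))))
                    (cong₂ (λ β σ → apply (rowOf l (kind (flip a))) β σ h') (sym (is-flip false b)) (sym (is-flip true b))))
             (linear-gap i τ w l (is false b)) ⟩
      pr l (flip a ∷ List.map flip x) (flip b ∷ List.map flip y) + gap (is false b * τ) (i ∷ w) l ∎
      where
      open ≡-Reasoning
      h' : Live → ℚ
      h' l = pr l (List.map flip x) (List.map flip y)

    end₁-weight end₂-weight : Live → ℚ
    end₁-weight A       = 1ℚ
    end₁-weight sink    = 0ℚ
    end₁-weight acc     = 1ℚ
    end₁-weight e⁺      = 0ℚ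
    end₁-weight e⁻      = ρ
    end₁-weight (m i j) = ρ * final⁺ i j
    end₂-weight A       = 0ℚ
    end₂-weight sink    = 0ℚ
    end₂-weight acc     = 1ℚ
    end₂-weight e⁺      = ρ
    end₂-weight e⁻      = 0ℚ
    end₂-weight (m i j) = ρ * final⁻ i j

    rowOf-end₁ : ∀ l → rowOf l end₁ ≡ accRow (end₁-weight l)
    rowOf-end₁ A       = refl
    rowOf-end₁ sink    = refl
    rowOf-end₁ acc     = refl
    rowOf-end₁ e⁺      = refl
    rowOf-end₁ e⁻      = refl
    rowOf-end₁ (m i j) = refl

    rowOf-end₂ : ∀ l → rowOf l end₂ ≡ accRow (end₂-weight l)
    rowOf-end₂ A       = refl
    rowOf-end₂ sink    = refl
    rowOf-end₂ acc     = refl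
    rowOf-end₂ e⁺      = refl
    rowOf-end₂ e⁻      = refl
    rowOf-end₂ (m i j) = refl

    gap-end : ∀ τ l → (end₁-weight l - end₂-weight l) * τ ≡ gap τ [] l
    gap-end τ A       = *-identityˡ τ
    gap-end τ sink    = *-zeroˡ τ
    gap-end τ acc     = *-zeroˡ τ
    gap-end τ e⁺      = solve 2 (λ r t → (con 0ℚ :- r) :* t := :- (t :* r)) refl ρ τ
    gap-end τ e⁻      = solve 2 (λ r t → (r :- con 0ℚ) :* t := t :* r) refl ρ τ
    gap-end τ (m i j) = solve 4 (λ r t p n → (r :* p :- r :* n) :* t := (t :* r) :* (p :- n)) refl ρ τ (final⁺ i j) (final⁻ i j)

    shift : ∀ β σ p s c c' → β * (c * p) + σ * ((1ℚ - c) * s) ≡ (β * (c' * p) + σ * ((1ℚ - c') * s)) + (c - c') * (β * p - σ * s)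
    shift = solve 6 (λ β σ p s c c' →
      β :* (c :* p) :+ σ :* ((con 1ℚ :- c) :* s) :=
      (β :* (c' :* p) :+ σ :* ((con 1ℚ :- c') :* s)) :+ (c :- c') :* (β :* p :- σ :* s)) refl

    -- After an end letter the probability is affine in the mass sent to `acc`, the rest going to
    -- `sink`; this is its slope.
    absorbed : List (Letter k) → Letter k → List (Letter k) → ℚ
    absorbed x b y = is false b * pr acc x y - is true b * pr sink x y

    pr-end : ∀ a b x y l {c r} → kind a ≡ c → rowOf l c ≡ accRow r →
             pr l (a ∷ x) (b ∷ y) ≡ is false b * (r * pr acc x y) + is true b * ((1ℚ - r) * pr sink x y)
    pr-end a b x y l {c} {r} refl e =
      trans (cong (λ r → apply r (is false b) (is true b) (λ l → pr l x y)) e) (apply-acc r (is false b) (is true b) (λ l → pr l x y))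

    module _ {x y τ w} (g : Gap x y τ w) (b : Letter k) where
      private
        x' = List.map flip x
        y' = List.map flip y

        pr-end-flip : ∀ a l {c r} → kind (flip a) ≡ c → rowOf l c ≡ accRow r →
          is false b * (r * pr acc x y) + is true b * ((1ℚ - r) * pr sink x y) ≡ pr l (flip a ∷ x') (flip b ∷ y')
        pr-end-flip a l {c} {r} e e' = sym (trans (pr-end (flip a) (flip b) x' y' l e e')
          (cong₂ _+_ (cong₂ _*_ (is-flip false b) (cong (r *_) (same acc refl)))
                     (cong₂ _*_ (is-flip true b) (cong ((1ℚ - r) *_) (same sink refl)))))
          where
          -- Once the mass is in `acc` or `sink`, input letters have no effect, so later end letters
          -- create no further gap.
          same : ∀ l → gap τ w l ≡ 0ℚ → pr l x' y' ≡ pr l x y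
          same l e = sym (trans (gap-at g l) (trans (cong (pr l x' y' +_) e) (+-identityʳ (pr l x' y'))))

      Gap-end₁ : ∀ a → kind a ≡ end₁ → Gap (a ∷ x) (b ∷ y) (absorbed x b y) []
      Gap-end₁ a e = mkGap λ l → trans (pr-end a b x y l e (rowOf-end₁ l)) (trans
        (shift (is false b) (is true b) (pr acc x y) (pr sink x y) (end₁-weight l) (end₂-weight l))
        (cong₂ _+_ (pr-end-flip a l (trans (kind-flip a) (cong flipKind e)) (rowOf-end₂ l)) (gap-end (absorbed x b y) l)))

      Gap-end₂ : ∀ a → kind a ≡ end₂ → Gap (a ∷ x) (b ∷ y) (- absorbed x b y) []
      Gap-end₂ a e = mkGap λ l → trans (pr-end a b x y l e (rowOf-end₂ l)) (trans
        (shift (is false b) (is true b) (pr acc x y) (pr sink x y) (end₂-weight l) (end₁-weight l))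
        (cong₂ _+_ (pr-end-flip a l (trans (kind-flip a) (cong flipKind e)) (rowOf-end₁ l))
          (trans (solve 3 (λ p q t → (p :- q) :* t := (q :- p) :* (:- t)) refl (end₂-weight l) (end₁-weight l) (absorbed x b y))
                 (gap-end (- absorbed x b y) l))))

    Unit : ℚ → Set
    Unit p = 0ℚ ≤ p × p ≤ 1ℚ

    Small : ℚ → Set
    Small p = - 1ℚ ≤ p × p ≤ 1ℚ

    pr-unit : ∀ q x y → Unit (pr (view q) x y)
    pr-unit q x y = subst Unit (prob-pr 0 q x y) (prob-nonneg (𝒯 0) (suc q) x y , prob≤1 (𝒯 0) (suc q) x y)

    indicator-* : ∀ b {p} → Unit p → Unit (indicator b * p)
    indicator-* b (0≤p , p≤1) = *-nonneg (indicator-nonneg b) 0≤p , ≤-trans (*-mono-≤1 (indicator-nonneg b) p≤1) (indicator≤1 b)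

    unit-difference : ∀ {p q} → Unit p → Unit q → Small (p - q)
    unit-difference {p} {q} (0≤p , p≤1) (0≤q , q≤1) =
      subst (_≤ p - q) (+-identityˡ (- 1ℚ)) (+-mono-≤ 0≤p (neg-antimono-≤ q≤1)) ,
      subst (p - q ≤_) (+-identityʳ 1ℚ) (+-mono-≤ p≤1 (neg-antimono-≤ 0≤q))

    absorbed-small : ∀ x b y → Small (absorbed x b y)
    absorbed-small x b y = unit-difference
      (indicator-* (replicate k false ≟ᴸ b) (pr-unit (suc (suc (suc (suc (suc (suc zero)))))) x y))
      (indicator-* (replicate k true ≟ᴸ b) (pr-unit (suc (suc (suc (suc (suc zero))))) x y))

    neg-small : ∀ {p} → Small p → Small (- p)
    neg-small {p} (l , u) = neg-antimono-≤ u , neg-antimono-≤ l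

    indicator-small : ∀ b {p} → Small p → Small (indicator b * p)
    indicator-small true  {p} s = subst Small (sym (*-identityˡ p)) s
    indicator-small false {p} s = subst Small (sym (*-zeroˡ p)) (neg-antimono-≤ 0≤1 , 0≤1)

    -- The scalar is 0, a difference of two probabilities up to sign, or such a number times an
    -- indicator; hence it lies between -1 and 1.
    exists-Gap : ∀ x y → ∃ λ τ → ∃ λ w → Small τ × Gap x y τ w
    exists-Gap []      []      = 0ℚ , [] , (neg-antimono-≤ 0≤1 , 0≤1) , equal⇒Gap (λ _ → refl)
    exists-Gap []      (_ ∷ _) = 0ℚ , [] , (neg-antimono-≤ 0≤1 , 0≤1) , equal⇒Gap (λ _ → refl)
    exists-Gap (_ ∷ _) []      = 0ℚ , [] , (neg-antimono-≤ 0≤1 , 0≤1) , equal⇒Gap (λ _ → refl)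
    exists-Gap (a ∷ x) (b ∷ y) with exists-Gap x y
    ... | τ , w , s , g = extend (kind a) refl
      where
      extend : ∀ c → kind a ≡ c → ∃ λ τ → ∃ λ w → Small τ × Gap (a ∷ x) (b ∷ y) τ w
      extend (op i) e = _ , _ , indicator-small (replicate k false ≟ᴸ b) s , Gap-op a b e g
      extend end₁   e = _ , _ , absorbed-small x b y , Gap-end₁ g b a e
      extend end₂   e = _ , _ , neg-small (absorbed-small x b y) , Gap-end₂ g b a e

    -- The initial distribution and the threshold 1/2.

    initialStore : ℕ → Store
    initialStore t zero                = 1
    initialStore t (suc zero)          = 0
    initialStore t (suc (suc zero))    = input t
    initialStore t (suc (suc (suc r))) = 0

    initialStore-hit : ∀ t r → ι (initialStore t r) ≡ hit 0 r + ι (input t) * hit 2 r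
    initialStore-hit t zero                = sym (cong (1ℚ +_) (*-zeroʳ (ι (input t))))
    initialStore-hit t (suc zero)          = sym (cong (0ℚ +_) (*-zeroʳ (ι (input t))))
    initialStore-hit t (suc (suc zero))    = sym (trans (+-identityˡ _) (*-identityʳ (ι (input t))))
    initialStore-hit t (suc (suc (suc r))) = sym (cong (0ℚ +_) (*-zeroʳ (ι (input t))))

    module _ (t : ℕ) where
      private
        ν = ι (input t)
        x₀ = vec {D} (initialStore t)

      dot-initial : (f : Ix → ℚ) → sumFin (λ j → x₀ j * f j) ≡ f i₀ + ν * f i₂
      dot-initial f = begin
        sumFin (λ j → x₀ j * f j)
          ≡⟨ sum-cong (λ j → trans (cong (_* f j) (initialStore-hit t (toℕ j)))
               (solve 4 (λ a n b f → (a :+ n :* b) :* f := a :* f :+ n :* (b :* f)) refl (hit 0 (toℕ j)) ν (hit 2 (toℕ j)) (f j))) ⟩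
        sumFin (λ j → hit 0 (toℕ j) * f j + ν * (hit 2 (toℕ j) * f j))
          ≡⟨ sum-+ (λ j → hit 0 (toℕ j) * f j) (λ j → ν * (hit 2 (toℕ j) * f j)) ⟩
        sumFin (λ j → hit 0 (toℕ j) * f j) + sumFin (λ j → ν * (hit 2 (toℕ j) * f j))
          ≡⟨ cong₂ _+_ (at i₀ (toℕ-fromℕ< _)) (trans (sum-*ˡ ν (λ j → hit 2 (toℕ j) * f j)) (cong (ν *_) (at i₂ (toℕ-fromℕ< _)))) ⟩
        f i₀ + ν * f i₂ ∎
        where
        open ≡-Reasoning
        at : ∀ i {r} → toℕ i ≡ r → sumFin (λ j → hit r (toℕ j) * f j) ≡ f i
        at i refl = sum-hit i f

      opaque
        unfolding quad

        value-initial : ∀ w → value w (initialStore t) ≡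
                        (Φ w i₀ i₀ + ν * Φ w i₀ i₂) + ν * (Φ w i₂ i₀ + ν * Φ w i₂ i₂)
        value-initial w = trans
          (sum-cong λ i → trans (sum-cong λ j → *-assoc (x₀ i) (x₀ j) (Φ w i j))
            (trans (sum-*ˡ (x₀ i) (λ j → x₀ j * Φ w i j)) (cong (x₀ i *_) (dot-initial (Φ w i)))))
          (dot-initial (λ i → Φ w i i₀ + ν * Φ w i i₂))

      startVal : (Live → ℚ) → ℚ
      startVal h = ½ * h A + (κ t * h (m i₀ i₀) + ((ν * κ t) * h (m i₀ i₂) + ((ν * κ t) * h (m i₂ i₀) + ((ν * ν) * κ t) * h (m i₂ i₂))))

      prob-start : ∀ a b x y → allFalse a ≡ true → probFrom (𝒯 t) zero (a ∷ x) (b ∷ y) ≡ is false b * startVal (λ l → pr l x y)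
      prob-start a b x y e = begin
        probFrom (𝒯 t) zero (a ∷ x) (b ∷ y)
          ≡⟨ cong (λ c → sumFin (λ q → startRow t c q * (indicator (stateLabel q ≟ᴸ b) * probFrom (𝒯 t) q x y))) e ⟩
        0ℚ * (β * probFrom (𝒯 t) zero x y) + (½ * (β * F 0F) + (κ t * (β * F 1F) + (p₁ * (β * F 2F) + (p₁ * (β * F 3F) + (p₂ * (β * F 4F) +
          sumFin (λ q → 0ℚ * G q))))))
          ≡⟨ cong₂ _+_ (*-zeroˡ (β * probFrom (𝒯 t) zero x y))
              (cong₂ _+_ (cong (λ v → ½ * (β * v)) (prob-pr t 0F x y)) (cong₂ _+_ (cong (λ v → κ t * (β * v)) (prob-pr t 1F x y))
              (cong₂ _+_ (cong₂ (λ u v → u * (β * v)) (initial₁ t) (prob-pr t 2F x y))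
              (cong₂ _+_ (cong₂ (λ u v → u * (β * v)) (initial₁ t) (prob-pr t 3F x y))
              (cong₂ _+_ (cong₂ (λ u v → u * (β * v)) (initial₂ t) (prob-pr t 4F x y))
                (trans (sum-cong λ q → *-zeroˡ (G q)) (sum-0 (4 ℕ.+ D ℕ.* D)))))))) ⟩
        0ℚ + (½ * (β * h A) + (κ t * (β * h (m i₀ i₀)) + ((ν * κ t) * (β * h (m i₀ i₂)) + ((ν * κ t) * (β * h (m i₂ i₀)) + (((ν * ν) * κ t) * (β * h (m i₂ i₂)) + 0ℚ)))))
          ≡⟨ solve 11 (λ a ha b hb c hc d hd e he β →
               con 0ℚ :+ (a :* (β :* ha) :+ (b :* (β :* hb) :+ (c :* (β :* hc) :+ (d :* (β :* hd) :+ (e :* (β :* he) :+ con 0ℚ))))) :=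
               β :* (a :* ha :+ (b :* hb :+ (c :* hc :+ (d :* hd :+ e :* he))))) refl
               ½ (h A) (κ t) (h (m i₀ i₀)) (ν * κ t) (h (m i₀ i₂)) (ν * κ t) (h (m i₂ i₀)) ((ν * ν) * κ t) (h (m i₂ i₂)) β ⟩
        β * startVal h ∎
        where
        open ≡-Reasoning
        β = is false b
        h : Live → ℚ
        h l = pr l x y
        F : Fin (9 ℕ.+ D ℕ.* D) → ℚ
        F q = probFrom (𝒯 t) (suc q) x y
        p₁ = initial t (suc (suc (suc zero)))
        p₂ = initial t (suc (suc (suc (suc (suc zero)))))
        G : Fin (4 ℕ.+ D ℕ.* D) → ℚ
        G q = indicator (stateLabel (6 Fin.↑ʳ q) ≟ᴸ b) * probFrom (𝒯 t) (6 Fin.↑ʳ q) x y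

      prob-reject : ∀ a b x y → allFalse a ≡ false →
                    probFrom (𝒯 t) zero (a ∷ x) (b ∷ y) ≡ apply (accRow 0ℚ) (is false b) (is true b) (λ l → pr l x y)
      prob-reject a b x y e = trans
        (cong (λ c → sumFin (λ q → startRow t c q * (indicator (stateLabel q ≟ᴸ b) * probFrom (𝒯 t) q x y))) e)
        (sum-spread (accRow 0ℚ) b (λ q → probFrom (𝒯 t) q x y) (λ l → pr l x y) (λ q → prob-pr t q x y))

      map-swap : ∀ xs → List.map (permLetter (swap₀₁ {K})) xs ≡ List.map flip xs
      map-swap = map-cong permLetter-swap

      -- The loaded masses are κ times the products of the initial registers, so the four moment
      -- terms assemble into κ times the value, while `A` adds τ/2.
      startVal-gap : ∀ τ w → startVal (gap τ w) ≡ τ * (½ + (ρ^ w * κ t) * value w (initialStore t))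
      startVal-gap τ w = trans
        (solve 9 (λ h n k t r a b c d →
           h :* t :+ (k :* ((t :* r) :* a) :+ ((n :* k) :* ((t :* r) :* b) :+ ((n :* k) :* ((t :* r) :* c) :+ ((n :* n) :* k) :* ((t :* r) :* d))))
           := t :* (h :+ (r :* k) :* ((a :+ n :* b) :+ n :* (c :+ n :* d)))) refl
           ½ ν (κ t) τ (ρ^ w) (Φ w i₀ i₀) (Φ w i₀ i₂) (Φ w i₂ i₀) (Φ w i₂ i₂))
        (cong (λ v → τ * (½ + (ρ^ w * κ t) * v)) (sym (value-initial w)))

      startVal-+ : ∀ {h h' d : Live → ℚ} → (∀ l → h l ≡ h' l + d l) → startVal h ≡ startVal h' + startVal d
      startVal-+ {h} {h'} {d} e = trans
        (cong₂ _+_ (cong (½ *_) (e A)) (cong₂ _+_ (cong (κ t *_) (e (m i₀ i₀))) (cong₂ _+_ (cong ((ν * κ t) *_) (e (m i₀ i₂)))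
          (cong₂ _+_ (cong ((ν * κ t) *_) (e (m i₂ i₀))) (cong (((ν * ν) * κ t) *_) (e (m i₂ i₂)))))))
        (solve 14 (λ p a a' q b b' r c c' d d' s e e' →
           p :* (a :+ a') :+ (q :* (b :+ b') :+ (r :* (c :+ c') :+ (r :* (d :+ d') :+ s :* (e :+ e')))) :=
           (p :* a :+ (q :* b :+ (r :* c :+ (r :* d :+ s :* e)))) :+ (p :* a' :+ (q :* b' :+ (r :* c' :+ (r :* d' :+ s :* e'))))) refl
           ½ (h' A) (d A) (κ t) (h' (m i₀ i₀)) (d (m i₀ i₀)) (ν * κ t) (h' (m i₀ i₂)) (d (m i₀ i₂)) (h' (m i₂ i₀)) (d (m i₂ i₀))
           ((ν * ν) * κ t) (h' (m i₂ i₂)) (d (m i₂ i₂)))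

      start-gap : ∀ a b {x y τ w} → allFalse a ≡ true → Gap x y τ w →
        probFrom (𝒯 t) zero (a ∷ x) (b ∷ y) - probFrom (𝒯 t) zero (flip a ∷ List.map flip x) (flip b ∷ List.map flip y) ≡
        is false b * startVal (gap τ w)
      start-gap a b {x} {y} {τ} {w} e g = begin
        probFrom (𝒯 t) zero (a ∷ x) (b ∷ y) - probFrom (𝒯 t) zero (flip a ∷ x') (flip b ∷ y')
          ≡⟨ cong₂ _-_ (prob-start a b x y e)
               (trans (prob-start (flip a) (flip b) x' y' (trans (allFalse-flip a) e)) (cong (_* startVal h') (is-flip false b))) ⟩
        β * startVal (λ l → pr l x y) - β * startVal h'
          ≡⟨ cong (λ v → β * v - β * startVal h') (startVal-+ {λ l → pr l x y} {h'} {gap τ w} (gap-at g)) ⟩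
        β * (startVal h' + startVal (gap τ w)) - β * startVal h'
          ≡⟨ solve 3 (λ b p q → b :* (p :+ q) :- b :* p := b :* q) refl β (startVal h') (startVal (gap τ w)) ⟩
        β * startVal (gap τ w) ∎
        where
        open ≡-Reasoning
        x' = List.map flip x
        y' = List.map flip y
        β = is false b
        h' : Live → ℚ
        h' l = pr l x' y'

      reject-gap : ∀ a b {x y τ w} → allFalse a ≡ false → Gap x y τ w →
        probFrom (𝒯 t) zero (a ∷ x) (b ∷ y) - probFrom (𝒯 t) zero (flip a ∷ List.map flip x) (flip b ∷ List.map flip y) ≡ 0ℚ
      reject-gap a b {x} {y} {τ} {w} e g = trans
        (cong₂ _-_ (trans (prob-reject a b x y e) (apply-acc 0ℚ (is false b) (is true b) (λ l → pr l x y)))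
          (trans (prob-reject (flip a) (flip b) x' y' (trans (allFalse-flip a) e)) (apply-acc 0ℚ (is false (flip b)) (is true (flip b)) h')))
        (trans (cong (λ z → z - (is false (flip b) * (0ℚ * h' acc) + is true (flip b) * ((1ℚ - 0ℚ) * h' sink)))
                 (cong₂ _+_ (cong₂ (λ β v → β * (0ℚ * v)) (sym (is-flip false b)) (same acc refl))
                            (cong₂ (λ σ v → σ * ((1ℚ - 0ℚ) * v)) (sym (is-flip true b)) (same sink refl))))
               (+-inverseʳ (is false (flip b) * (0ℚ * h' acc) + is true (flip b) * ((1ℚ - 0ℚ) * h' sink))))
        where
        x' = List.map flip x
        y' = List.map flip y
        h' : Live → ℚ
        h' l = pr l x' y'
        same : ∀ l → gap τ w l ≡ 0ℚ → pr l x y ≡ h' l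
        same l e = trans (gap-at g l) (trans (cong (h' l +_) e) (+-identityʳ (h' l)))

      gap-small : ∀ q {x y τ w} → Gap x y τ w → Small (gap τ w (view q))
      gap-small q {x} {y} {τ} {w} g = subst Small
        (trans (cong (_- p') (gap-at g (view q))) (solve 2 (λ p d → (p :+ d) :- p := d) refl p' (gap τ w (view q))))
        (unit-difference (pr-unit q x y) (pr-unit q (List.map flip x) (List.map flip y)))
        where p' = pr (view q) (List.map flip x) (List.map flip y)

      scale-small : ∀ {c p} → 0ℚ ≤ c → Small p → - c ≤ c * p × c * p ≤ c
      scale-small {c} {p} 0≤c (l , u) =
        subst (_≤ c * p) (solve 1 (λ c → c :* (con (- 1ℚ)) := :- c) refl c) (*-monoˡ-≤-nonNeg c {{nonNegative 0≤c}} l) ,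
        *-mono-≤1 0≤c u

      private
        0≤ν = ι-nonneg (input t)
        0≤νκ = *-nonneg 0≤ν (0≤κ t)
        0≤ννκ = *-nonneg (*-nonneg 0≤ν 0≤ν) (0≤κ t)

      -- The value itself has no lower bound. The estimate comes from probability instead: at each
      -- moment state the gap is a difference of probabilities, and the masses loaded there add up
      -- to 1/2 by `half`.
      moment-part : ∀ {x y τ w} → Gap x y τ w →
        - ½ ≤ τ * ((ρ^ w * κ t) * value w (initialStore t)) × τ * ((ρ^ w * κ t) * value w (initialStore t)) ≤ ½
      moment-part {x} {y} {τ} {w} g =
        subst₂ _≤_ (trans (solve 3 (λ a b c → (:- a) :+ ((:- b) :+ ((:- b) :+ (:- c))) := :- (a :+ (b :+ (b :+ c)))) refl (κ t) (ν * κ t) ((ν * ν) * κ t)) (cong -_ (half t))) sum≡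
          (+-mono-≤ (proj₁ s₁) (+-mono-≤ (proj₁ s₂) (+-mono-≤ (proj₁ s₃) (proj₁ s₄)))) ,
        subst₂ _≤_ sum≡ (half t)
          (+-mono-≤ (proj₂ s₁) (+-mono-≤ (proj₂ s₂) (+-mono-≤ (proj₂ s₃) (proj₂ s₄))))
        where
        d = gap τ w
        s₁ = scale-small (0≤κ t) (gap-small 1F g)
        s₂ = scale-small 0≤νκ (gap-small 2F g)
        s₃ = scale-small 0≤νκ (gap-small 3F g)
        s₄ = scale-small 0≤ννκ (gap-small 4F g)
        sum≡ : κ t * d (m i₀ i₀) + ((ν * κ t) * d (m i₀ i₂) + ((ν * κ t) * d (m i₂ i₀) + ((ν * ν) * κ t) * d (m i₂ i₂)))
               ≡ τ * ((ρ^ w * κ t) * value w (initialStore t))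
        sum≡ = trans
          (solve 8 (λ n k t r a b c d →
             k :* ((t :* r) :* a) :+ ((n :* k) :* ((t :* r) :* b) :+ ((n :* k) :* ((t :* r) :* c) :+ ((n :* n) :* k) :* ((t :* r) :* d)))
             := t :* ((r :* k) :* ((a :+ n :* b) :+ n :* (c :+ n :* d)))) refl
             ν (κ t) τ (ρ^ w) (Φ w i₀ i₀) (Φ w i₀ i₂) (Φ w i₂ i₀) (Φ w i₂ i₂))
          (cong (λ v → τ * ((ρ^ w * κ t) * v)) (sym (value-initial w)))

      κ>0 : 0ℚ < κ t
      κ>0 = positive⁻¹ (κ t)

      ρκ>0 : ∀ w → 0ℚ < ρ^ w * κ t
      ρκ>0 w = positive⁻¹ (ρ^ w * κ t) {{pos*pos⇒pos (ρ^ w) {{positive (ρ^>0 w)}} (κ t) {{positive κ>0}}}}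

      abs≤½ : ∀ {p} → - ½ ≤ p → p ≤ ½ → ∣ p ∣ ≤ ½
      abs≤½ {p} l u with ∣p∣≡p∨∣p∣≡-p p
      ... | inj₁ e = subst (_≤ ½) (sym e) u
      ... | inj₂ e = subst (_≤ ½) (sym e) (neg-antimono-≤ l)

      indicator-abs : ∀ b {p} → ∣ p ∣ ≤ ½ → ∣ indicator b * p ∣ ≤ ½
      indicator-abs true  {p} s = subst (λ v → ∣ v ∣ ≤ ½) (sym (*-identityˡ p)) s
      indicator-abs false {p} s = subst (λ v → ∣ v ∣ ≤ ½) (sym (*-zeroˡ p)) (nonNegative⁻¹ ½)

      -- τ/2 and the contribution of the moments have opposite signs, and both are at most ½ in absolute value.
      opposite : ∀ {τ v} → Small τ → v ≤ 0ℚ → - ½ ≤ τ * v → τ * v ≤ ½ → ∣ τ * (½ + v) ∣ ≤ ½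
      opposite {τ} {v} (l , u) v≤0 Yl Yu = subst (λ z → ∣ z ∣ ≤ ½) (sym expand) (by-sign (≤-total 0ℚ τ))
        where
        expand : τ * (½ + v) ≡ ½ * τ + τ * v
        expand = solve 2 (λ t v → t :* (con ½ :+ v) := con ½ :* t :+ t :* v) refl τ v
        Xs = scale-small (nonNegative⁻¹ ½) (l , u)
        by-sign : _ → ∣ ½ * τ + τ * v ∣ ≤ ½
        by-sign (inj₁ 0≤τ) = abs≤½
          (subst (_≤ ½ * τ + τ * v) (+-identityˡ (- ½)) (+-mono-≤ (*-nonneg (nonNegative⁻¹ ½) 0≤τ) Yl))
          (subst (½ * τ + τ * v ≤_) (+-identityʳ ½)
            (+-mono-≤ (proj₂ Xs) (subst (τ * v ≤_) (*-zeroʳ τ) (*-monoˡ-≤-nonNeg τ {{nonNegative 0≤τ}} v≤0))))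
        by-sign (inj₂ τ≤0) = abs≤½
          (subst (_≤ ½ * τ + τ * v) (+-identityʳ (- ½))
            (+-mono-≤ (proj₁ Xs) (subst (_≤ τ * v) (*-zeroʳ τ) (*-monoˡ-≤-nonPos τ {{nonPositive τ≤0}} v≤0))))
          (subst (½ * τ + τ * v ≤_) (+-identityˡ ½)
            (+-mono-≤ (subst (½ * τ ≤_) (*-zeroʳ ½) (*-monoˡ-≤-nonNeg ½ τ≤0)) Yu))

      -- Any pair of words yields some instruction sequence, possibly one that no run follows;
      -- still, rejection makes its value nonpositive, and `opposite` applies.
      rejecting⇒symmetric : (∀ w → ¬ Accepts code w (initialStore t)) → Symmetric (𝒯 t) swap₀₁ ½
      rejecting⇒symmetric reject (a ∷ x) (b ∷ y) = subst (λ v → ∣ v ∣ ≤ ½)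
        (sym (cong₂ (λ x' y' → probFrom (𝒯 t) zero (a ∷ x) (b ∷ y) - probFrom (𝒯 t) zero x' y')
          (cong₂ _∷_ (permLetter-swap a) (map-swap x)) (cong₂ _∷_ (permLetter-swap b) (map-swap y))))
        (bounded-gap (allFalse a) refl)
        where
        bounded-gap : ∀ c → allFalse a ≡ c →
          ∣ probFrom (𝒯 t) zero (a ∷ x) (b ∷ y) - probFrom (𝒯 t) zero (flip a ∷ List.map flip x) (flip b ∷ List.map flip y) ∣ ≤ ½
        bounded-gap false e =
          let τ , w , _ , g = exists-Gap x y in subst (λ v → ∣ v ∣ ≤ ½) (sym (reject-gap a b e g)) (nonNegative⁻¹ ½)
        bounded-gap true e with exists-Gap x y
        ... | τ , w , s , g = subst (λ v → ∣ v ∣ ≤ ½) (sym (trans (start-gap a b e g) (cong (is false b *_) (startVal-gap τ w))))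
          (indicator-abs (replicate k false ≟ᴸ b)
            (opposite s
              (subst ((ρ^ w * κ t) * value w (initialStore t) ≤_) (*-zeroʳ (ρ^ w * κ t))
                (*-monoˡ-≤-nonNeg (ρ^ w * κ t) {{nonNegative (<⇒≤ (ρκ>0 w))}}
                  (≮⇒≥ λ 0<v → reject w (value-accepts w (initialStore t) refl 0<v))))
              (proj₁ (moment-part g)) (proj₂ (moment-part g))))

      blank : Letter k
      blank = replicate k false

      -- The witness of asymmetry, to be preceded by the loading letter: it performs the accepting
      -- sequence, ends with the letter that collects the positive part, and never expects the
      -- output of `sink`.
      inWord outWord : List (Fin (suc K)) → List (Letter k)
      inWord []      = (true ∷ false ∷ replicate K false) ∷ []
      inWord (i ∷ w) = (false ∷ false ∷ encode i) ∷ inWord w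
      outWord []      = blank ∷ []
      outWord (i ∷ w) = blank ∷ outWord w

      is-blank : is false blank ≡ 1ℚ
      is-blank = cong indicator (dec-true (≡-dec Data.Bool._≟_ blank blank) refl)

      Gap-accepting : ∀ w → Gap (inWord w) (outWord w) 1ℚ w
      -- With nothing left to read, the slope `absorbed` is 1 - 0: the expected last output is that
      -- of `acc` and not that of `sink`.
      Gap-accepting [] = subst (λ τ → Gap (inWord []) (outWord []) τ []) (cong (λ β → β * 1ℚ - 0ℚ * 1ℚ) is-blank)
        (Gap-end₁ (equal⇒Gap {[]} {[]} (λ _ → refl)) blank (true ∷ false ∷ replicate K false) refl)
      Gap-accepting (i ∷ w) = subst (λ τ → Gap (inWord (i ∷ w)) (outWord (i ∷ w)) τ (i ∷ w)) (cong (_* 1ℚ) is-blank)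
        (Gap-op (false ∷ false ∷ encode i) blank (cong op (decode-encode i)) (Gap-accepting w))

      accepting⇒¬symmetric : ∀ w → Accepts code w (initialStore t) → ¬ Symmetric (𝒯 t) swap₀₁ ½
      accepting⇒¬symmetric w accepted symmetric = <-irrefl refl (<-≤-trans ½<gap gap≤½)
        where
        g : ℚ
        g = ρ^ w * κ t
        difference = probFrom (𝒯 t) zero (blank ∷ inWord w) (blank ∷ outWord w)
                       - probFrom (𝒯 t) zero (flip blank ∷ List.map flip (inWord w)) (flip blank ∷ List.map flip (outWord w))
        gap≡ : difference ≡ ½ + g
        gap≡ = trans (start-gap blank blank (allFalse-replicate k) (Gap-accepting w)) (trans
          (cong₂ _*_ is-blank (trans (startVal-gap 1ℚ w) (cong (λ v → 1ℚ * (½ + g * v)) (accepts-value w (initialStore t) refl accepted))))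
          (solve 2 (λ h g → con 1ℚ :* (con 1ℚ :* (h :+ g :* con 1ℚ)) := h :+ g) refl ½ g))
        ½<gap : ½ < ½ + g
        ½<gap = subst (_< ½ + g) (+-identityʳ ½) (+-monoʳ-< ½ (ρκ>0 w))
        gap≤½ : ½ + g ≤ ½
        gap≤½ = subst (_≤ ½) (trans (cong ∣_∣ gap≡) (0≤p⇒∣p∣≡p (<⇒≤ (<-trans (positive⁻¹ ½) ½<gap))))
          (subst (λ v → ∣ v ∣ ≤ ½)
            (cong₂ (λ x' y' → probFrom (𝒯 t) zero (blank ∷ inWord w) (blank ∷ outWord w) - probFrom (𝒯 t) zero x' y')
              (cong₂ _∷_ (permLetter-swap blank) (map-swap (inWord w))) (cong₂ _∷_ (permLetter-swap blank) (map-swap (outWord w))))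
            (symmetric (blank ∷ inWord w) (blank ∷ outWord w)))

-- The code of the transducer as a function of its input.

module Codes where

  open RecursiveFunctions
  open Programs
  open Machines
  open Transducers
  open import Data.Nat as ℕ using (ℕ; zero; suc)
  open import Data.Bool using (true; false)
  open import Data.Fin as Fin using (Fin; zero; suc)
  open import Data.Fin.Patterns
  open import Data.Fin.Permutation using (Permutation′; _⟨$⟩ʳ_)
  open import Data.Integer using () renaming (+_ to pos)
  open import Data.Rational using (ℚ; 0ℚ; ½)
  open import Data.Rational.Properties using (positive⁻¹)
  open import Data.Vec as Vec using (Vec; []; _∷_; replicate)
  open import Data.Vec.Properties using (tabulate-cong)
  open import Data.List.Properties using (map-cong)
  open import Data.Vec.Relation.Unary.All using ([]; _∷_)
  open import Data.List as List using (List; []; _∷_; _++_)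
  open import Data.List.Relation.Unary.All as All using (All; []; _∷_)
  import Data.List.Relation.Unary.All.Properties as AllP
  open import Data.Product using (∃; _×_; _,_; proj₁; proj₂)
  open import Relation.Binary.PropositionalEquality using (_≡_; refl; trans; cong; cong₂)

  allLetters-split : ∀ k → ∃ λ rest → allLetters k ≡ replicate k false ∷ rest × All (λ a → allFalse a ≡ false) rest
  allLetters-split zero    = [] , refl , []
  allLetters-split (suc k) with allLetters-split k
  ... | rest , e , f =
    List.map (false ∷_) rest ++ List.map (true ∷_) (allLetters k) ,
    cong (λ ls → List.map (false ∷_) ls ++ List.map (true ∷_) (allLetters k)) e ,
    AllP.++⁺ (AllP.map⁺ f) (AllP.map⁺ (All.universal (λ _ → refl) (allLetters k)))

  tab-cong : ∀ {n} {f g : Fin n → ℕ} → (∀ q → f q ≡ g q) → tab f ≡ tab g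
  tab-cong e = cong Vec.toList (tabulate-cong e)

  ratCode : ℚ → ℕ
  ratCode r = ⟪ codeℤ (ℚ.numerator r) , ℚ.denominator-1 r ⟫

  rowCode : ∀ {n} → (Fin n → ℚ) → ℕ
  rowCode r = fold (tab (λ q → ratCode (r q)))

  rowsCode : ∀ {k n} → (Letter k → Fin n → ℚ) → List (Letter k) → ℕ
  rowsCode f ls = fold (List.map (λ a → rowCode (f a)) ls)

  opaque
    unfolding cons

    tailCode : ∀ {k n} → (Fin n → Letter k) → Permutation′ k → ℚ → ℕ
    tailCode ℓ π ε = codeList (codeList (tab (λ q → codeLetter (ℓ q))) ∷ codeList (tab (λ j → codeFin (π ⟨$⟩ʳ j))) ∷ codeℚ ε ∷ [])

    codeInstance-cons : ∀ I → let open Instance I in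
      codeInstance I ≡
      cons k (cons n (cons (codeFin (Transducer.s₀ T))
        (cons (fold (tab (λ q → rowsCode (Transducer.δ T q) (allLetters k)))) (tailCode (Transducer.ℓ T) π ε))))
    codeInstance-cons I =
      cong (λ X → cons k (cons n (cons (codeFin (Transducer.s₀ T)) (cons X (tailCode (Transducer.ℓ T) π ε)))))
        (trans (codeList-fold (tab (λ q → codeList (List.map (λ a → codeList (tab (λ q' → codeℚ (Transducer.δ T q a q')))) (allLetters k)))))
          (cong fold (tab-cong λ q → trans
            (codeList-fold (List.map (λ a → codeList (tab (λ q' → codeℚ (Transducer.δ T q a q')))) (allLetters k)))
            (cong fold (map-cong (λ a → codeList-fold (tab (λ q' → codeℚ (Transducer.δ T q a q')))) (allLetters k))))))
      where open Instance I

  -- The leading 0 makes the code 2⁰ (2 c + 1), hence odd, as the initial fractions require.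
  packE : Expr 6
  packE = consE (lit 0) (consE (var 0F) (consE (var 1F) (consE (var 2F) (consE (var 3F) (consE (var 4F) (consE (var 5F) (lit 0)))))))

  denomE : Expr 7
  denomE = lit 1 ⊕ lit 2 ⊗ (var 6F ⊗ (lit 2 ⊕ var 6F))

  -- The code of `initial`, with variable 6 as the input n. Numerators are doubled because `codeℤ`
  -- doubles nonnegative integers. As the fractions are reduced, both of their components are
  -- polynomials in n and no gcd has to be computed; the remaining zeros form the constant tail,
  -- variable 2.
  rowE : Expr 7
  rowE = consE (pairE (lit 0) (lit 0)) (consE (pairE (lit 2) (lit 1)) (consE (pairE (lit 2) denomE)
    (consE (pairE (lit 2 ⊗ var 6F) denomE) (consE (pairE (lit 2 ⊗ var 6F) denomE)
      (consE (pairE (lit 2 ⊗ (var 6F ⊗ var 6F)) denomE) (var 2F))))))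

  instanceE : Expr 7
  instanceE = consE (var 0F) (consE (var 1F) (consE (lit 0) (consE (consE (consE rowE (var 3F)) (var 4F)) (var 5F))))

  module Coding {K D : ℕ} (code : Fin (suc K) → Instr) (2<D : 2 ℕ.< D) (bounded : ∀ a → Bounded D (code a)) where

    open Reduction code 2<D bounded

    instance-of : ℕ → Instance
    instance-of t = record { k = k ; n = States ; T = 𝒯 t ; π = swap₀₁ ; ε = ½ ; ε>0 = positive⁻¹ ½ }

    rest : List (Letter k)
    rest = proj₁ (allLetters-split k)

    constants : Vec ℕ 6
    constants =
      k ∷ States ∷
      fold (tab {4 ℕ.+ D ℕ.* D} (λ _ → ratCode 0ℚ)) ∷
      rowsCode (λ _ → spread (accRow 0ℚ)) rest ∷
      fold (tab (λ q → rowsCode (λ a → spread (rowOf (view q) (kind a))) (allLetters k))) ∷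
      tailCode stateLabel (swap₀₁ {K}) ½ ∷ []

    start-rows : ∀ t → rowsCode (trans-δ t zero) (allLetters k) ≡
                 cons (rowCode (initial t)) (rowsCode (λ _ → spread (accRow 0ℚ)) rest)
    start-rows t = trans (cong (rowsCode (trans-δ t zero)) (proj₁ (proj₂ (allLetters-split k))))
      (cong₂ cons (cong (λ c → rowCode (startRow t c)) (allFalse-replicate k))
                  (cong fold (map-const (proj₂ (proj₂ (allLetters-split k))))))
      where
      map-const : ∀ {ls} → All (λ a → allFalse a ≡ false) ls →
        List.map (λ a → rowCode (trans-δ t zero a)) ls ≡ List.map (λ _ → rowCode (spread (accRow 0ℚ))) ls
      map-const []      = refl
      map-const (e ∷ f) = cong₂ _∷_ (cong (λ c → rowCode (startRow t c)) e) (map-const f)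

    code-instance : ∀ t → codeInstance (instance-of t) ≡ eval instanceE (constants Vec.++ input t ∷ [])
    code-instance t = trans (codeInstance-cons (instance-of t))
      (cong (λ X → cons k (cons States (cons 0 (cons (cons X R₁) R)))) (start-rows t))
      where
      R₁ = fold (tab (λ q → rowsCode (λ a → spread (rowOf (view q) (kind a))) (allLetters k)))
      R = tailCode stateLabel (swap₀₁ {K}) ½

-- The self-referential program and the contradiction.

open RecursiveFunctions
open Programs
open Machines
open Transducers
open Codes
open import Data.Nat as ℕ using (ℕ; zero; suc; z≤n; s≤s)
import Data.Nat.Properties as ℕₚ
open import Data.Fin using (zero; suc)
open import Data.Vec as Vec using (Vec; []; _∷_)
open import Data.Vec.Properties using (toList-injective; cast-is-id)
open import Data.Vec.Relation.Unary.All as VecAll using ([]; _∷_)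
open import Data.List using ([]; _∷_)
open import Data.Product using (∃; _×_; _,_; proj₁; proj₂)
open import Relation.Nullary using (¬_)
open import Relation.Binary.PropositionalEquality using (_≡_; refl; sym; trans; subst; subst₂; cong; cong₂)

open Agree

guess : ℕ → ℕ → Prog
guess zero    b = act nop
guess (suc m) b = count-up b ⨾ guess m (suc b)

guess-sound : ∀ m b {g g'} → Run (guess m b) g g' → Agree b g g'
guess-sound zero    b (run-act refl) = agree-refl
guess-sound (suc m) b (run-⨾ r rs)   =
  agree-trans (agree-except ℕₚ.≤-refl (proj₂ (count-up-sound r))) (agree-≤ (ℕₚ.n≤1+n b) (guess-sound m (suc b) rs))

-- Counting only increases a register, so every vector is reachable because the registers start at
-- 0.
guess-complete : ∀ {m} (cs : Vec ℕ m) b g → (∀ r → b ℕ.≤ r → g r ≡ 0) →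
                 ∃ λ g' → Run (guess m b) g g' × Vec.map g' (range m b) ≡ cs
guess-complete []       b g z = g , run-act refl , refl
guess-complete {suc m} (c ∷ cs) b g z with count-up-complete b c g
... | h , r , e with guess-complete cs (suc b) h
                       (λ i b<i → trans (proj₂ (count-up-sound r) i (λ i≡b → ℕₚ.<⇒≢ b<i (sym i≡b))) (z i (ℕₚ.<⇒≤ b<i)))
... | k , rs , es =
  k , run-⨾ r rs ,
  cong₂ _∷_ (trans (at (guess-sound m (suc b) rs) b (ℕₚ.n<1+n b))
                   (trans e (trans (cong (c ℕ.+_) (z b ℕₚ.≤-refl)) (ℕₚ.+-identityʳ c)))) es

eval-packE : ∀ v → eval packE v ≡ suc (2 ℕ.* codeList (Vec.toList v))
eval-packE (c₁ ∷ c₂ ∷ c₃ ∷ c₄ ∷ c₅ ∷ c₆ ∷ []) =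
  trans (sym (codeList-fold (0 ∷ cs))) (trans (suc-pair 0 (codeList cs))
    (trans (ℕₚ.*-identityˡ _) (ℕₚ.+-comm (2 ℕ.* codeList cs) 1)))
  where cs = c₁ ∷ c₂ ∷ c₃ ∷ c₄ ∷ c₅ ∷ c₆ ∷ []

packE-injective : ∀ v v' → eval packE v ≡ eval packE v' → v ≡ v'
packE-injective v v' e = trans (sym (cast-is-id refl v)) (toList-injective refl v v'
  (codeList-injective _ _ (ℕₚ.*-cancelˡ-≡ _ _ 2 (ℕₚ.suc-injective (trans (sym (eval-packE v)) (trans e (eval-packE v')))))))

packE-odd : ∀ v → ∃ λ t → eval packE v ≡ suc (2 ℕ.* t)
packE-odd v = codeList (Vec.toList v) , eval-packE v

query : μRec 1 → μRec 7
query p = comp p (term instanceE ∷ [])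

-- The program P is kept abstract to prevent the type checker from flattening the actual one.
module Recursion (p : μRec 1) (P : Prog)
  (P-sound : ∀ {g g'} → Run P g g' →
             ∃ λ cs → term packE ⟦ cs ⟧⇓ g 0 × query p ⟦ cs Vec.++ g 0 ∷ [] ⟧⇓ 1)
  (P-complete : ∀ cs g → (∀ r → 1 ℕ.≤ r → g r ≡ 0) →
                term packE ⟦ cs ⟧⇓ g 0 → query p ⟦ cs Vec.++ g 0 ∷ [] ⟧⇓ 1 → ∃ (Run P g)) where

  open Machine P
  open Coding code (s≤s (s≤s (s≤s z≤n))) code-bounded
  open Reduction code (s≤s (s≤s (s≤s z≤n))) code-bounded
    using (initialStore; input; accepting⇒¬symmetric; rejecting⇒symmetric)

  -- Keeping t a variable prevents the type checker from unfolding the code of the constants.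
  module _ (t : ℕ) (pack-constants : eval packE constants ≡ input t) where

    store : Store
    store r = initialStore t (2 ℕ.+ r)

    represents : Represents (initialStore t) 0 store
    represents = record { one = refl ; pc = refl ; regs = λ _ → refl }

    own : ℕ
    own = codeInstance (instance-of t)

    own-code : term instanceE ⟦ constants Vec.++ input t ∷ [] ⟧⇓ own
    own-code = subst (term instanceE ⟦ constants Vec.++ input t ∷ [] ⟧⇓_) (sym (code-instance t))
                 (term-correct instanceE (constants Vec.++ input t ∷ []))

    query-own : ∀ {v} → p ⟦ own ∷ [] ⟧⇓ v → query p ⟦ constants Vec.++ input t ∷ [] ⟧⇓ v
    query-own ev = ev-comp (ev-∷ own-code ev-[]) ev

    own-query : ∀ {v} → query p ⟦ constants Vec.++ input t ∷ [] ⟧⇓ v → p ⟦ own ∷ [] ⟧⇓ v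
    own-query (ev-comp (ev-∷ ev ev-[]) evp) = subst (λ c → p ⟦ c ∷ [] ⟧⇓ _) (⇓-deterministic ev own-code) evp

    accepting : p ⟦ own ∷ [] ⟧⇓ 1 → ∃ λ w → Accepts code w (initialStore t)
    accepting ev = machine-complete represents (proj₂ (P-complete constants store cleared
        (subst (term packE ⟦ constants ⟧⇓_) pack-constants (term-correct packE constants)) (query-own ev)))
      where
      cleared : ∀ r → 1 ℕ.≤ r → store r ≡ 0
      cleared (suc r) _ = refl

    -- An accepting run has validated its guess against the input, and `packE` is injective, so the
    -- guess is the true vector of constants and the query concerns this very transducer.
    accepted : ∀ w → Accepts code w (initialStore t) → p ⟦ own ∷ [] ⟧⇓ 1
    accepted w acc =
      let cs , evp , evq = P-sound (proj₂ (machine-sound w represents acc))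
          cs≡ = packE-injective cs constants (trans (⇓-deterministic (term-correct packE cs) evp) (sym pack-constants))
      in own-query (subst (λ v → query p ⟦ v Vec.++ input t ∷ [] ⟧⇓ 1) cs≡ evq)

    undecided-at : ¬ DecidesSymmetry p
    undecided-at decides =
      -- No case distinction on symmetry is made: the answer 1 is refuted first, so no word is
      -- accepted, which makes the transducer symmetric and forces the answer 1 after all.
      ¬yes (proj₁ (decides (instance-of t)) (rejecting⇒symmetric t λ w acc → ¬yes (accepted w acc)))
      where
      ¬yes : ¬ p ⟦ own ∷ [] ⟧⇓ 1
      ¬yes ev = let w , acc = accepting ev in
        ℕₚ.1+n≢0 (⇓-deterministic ev (proj₂ (decides (instance-of t)) (accepting⇒¬symmetric t w acc)))

  undecided : ¬ DecidesSymmetry p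
  undecided = undecided-at (proj₁ (packE-odd constants)) (proj₂ (packE-odd constants))

module Diagonal (p : μRec 1) where

  -- The input register 0 comes last, as variable 6 of `instanceE`.
  queryInputs : Vec ℕ 7
  queryInputs = 1 ∷ 2 ∷ 3 ∷ 4 ∷ 5 ∷ 6 ∷ 0 ∷ []

  -- Register 0 holds the input. The constants of the program's own transducer are guessed into the
  -- registers 1, …, 6, validated against the input, and p is then asked about that very transducer.
  diagonal : Prog
  diagonal =
    guess 6 1 ⨾ compile (term packE) (range 6 1) 7 ⨾ act (eq 7 0)
      ⨾ compile (query p) queryInputs 7 ⨾ act (asg 8 (const 1)) ⨾ act (eq 7 8)

  inputs< : VecAll.All (ℕ._< 7) queryInputs
  inputs< = s≤s (s≤s z≤n) ∷ s≤s (s≤s (s≤s z≤n)) ∷ s≤s (s≤s (s≤s (s≤s z≤n))) ∷ s≤s (s≤s (s≤s (s≤s (s≤s z≤n)))) ∷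
            s≤s (s≤s (s≤s (s≤s (s≤s (s≤s z≤n))))) ∷ s≤s (s≤s (s≤s (s≤s (s≤s (s≤s (s≤s z≤n)))))) ∷ s≤s z≤n ∷ []

  diagonal-sound : ∀ {g g'} → Run diagonal g g' →
    ∃ λ cs → term packE ⟦ cs ⟧⇓ g 0 × query p ⟦ cs Vec.++ g 0 ∷ [] ⟧⇓ 1
  diagonal-sound {g} (run-⨾ {h = h₁} rg (run-⨾ {h = h₂} rp (run-⨾ (run-act (e₁ , refl))
      (run-⨾ {h = h₃} rq (run-⨾ {h = h₄} (run-act (e₂ , f₂)) (run-act (e₃ , refl)))))))
    with sound (term packE) (range 6 1) 7 (range-< 6 1) rp | sound (query p) queryInputs 7 inputs< rq
  ... | evp , agp | evq , agq =
    Vec.map h₁ (range 6 1) ,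
    subst (term packE ⟦ Vec.map h₁ (range 6 1) ⟧⇓_) (trans e₁ zero≡) evp ,
    subst₂ (λ xs v → query p ⟦ xs ⟧⇓ v)
      (trans (map-agree inputs< agp) (cong (λ z → Vec.map h₁ (range 6 1) Vec.++ z ∷ []) zero₁))
      (trans (sym (f₂ 7 λ ())) (trans e₃ e₂)) evq
    where
    zero₁ : h₁ 0 ≡ g 0
    zero₁ = at (guess-sound 6 1 rg) 0 (s≤s z≤n)
    zero≡ : h₂ 0 ≡ g 0
    zero≡ = trans (at agp 0 (s≤s z≤n)) zero₁

  diagonal-complete : ∀ (cs : Vec ℕ 6) g → (∀ r → 1 ℕ.≤ r → g r ≡ 0) →
    term packE ⟦ cs ⟧⇓ g 0 → query p ⟦ cs Vec.++ g 0 ∷ [] ⟧⇓ 1 → ∃ (Run diagonal g)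
  diagonal-complete cs@(c₁ ∷ c₂ ∷ c₃ ∷ c₄ ∷ c₅ ∷ c₆ ∷ []) g z evp evq with guess-complete cs 1 g z
  ... | h₁ , rg , e₁ with complete-at (complete (term packE)) (range 6 1) 7 h₁ (range-< 6 1) e₁ evp
  ... | h₂ , rp , e₂ , ag₂
    with complete-at (complete (query p)) queryInputs 7 h₂ inputs<
           (trans (map-agree inputs< ag₂) (trans (snoc e₁) (cong (λ z → cs Vec.++ z ∷ []) zero₁))) evq
    where
    zero₁ : h₁ 0 ≡ g 0
    zero₁ = at (guess-sound 6 1 rg) 0 (s≤s z≤n)
    snoc : Vec.map h₁ (range 6 1) ≡ cs → Vec.map h₁ queryInputs ≡ cs Vec.++ h₁ 0 ∷ []
    snoc e = cong (Vec._++ h₁ 0 ∷ []) e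
  ... | h₃ , rq , e₃ , ag₃ =
    _ , run-⨾ rg (run-⨾ rp (run-⨾ (run-eq h₂ (trans e₂ (sym zero₂)))
          (run-⨾ rq (run-⨾ (run-asg h₃ 8 (const 1))
            (run-eq _ (trans (update-other h₃ 8 1 7 λ ()) (trans e₃ (sym (update-same h₃ 8 1)))))))))
    where
    zero₂ : h₂ 0 ≡ g 0
    zero₂ = trans (at ag₂ 0 (s≤s z≤n)) (at (guess-sound 6 1 rg) 0 (s≤s z≤n))

theorem8 : ¬ SymmetryDecidable
theorem8 (p , decides) = Recursion.undecided p diagonal diagonal-sound diagonal-complete decides
  where open Diagonal p
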